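{- Let $\mathcal{D}$ be a finite nonempty dataset of transactions over a finite set of items $\mathcal{I}$, let $w\ge1$ be an integer, $m=|U(\mathcal{I},w)|$, $1\le K\le m$ an integer, and $\varepsilon,\delta\in(0,1)$. Then the progressive sampling algorithm (defined in the context), run with input $\mathcal{D},K,w,\varepsilon,\delta$, returns an $\varepsilon$-approximation to $\mathrm{TOPK}(\mathcal{D},\mathcal{I},K,w)$ with probability at least $1-\delta$.
   Context: Basic notions. A dataset (or sample) is a finite multiset/sequence of transactions, each transaction being a subset of the item set $\mathcal{I}$, $|\mathcal{I}|=n$. $U(\mathcal{I},w)$ is the family of all itemsets $x\subseteq\mathcal{I}$ with $1\le|x|\le w$, and $m=|U(\mathcal{I},w)|=\sum_{i=1}^w\binom{n}{i}$. For a dataset or sample $\mathcal{T}$, $f_{\mathcal{T}}(x)$ is the fraction of transactions of $\mathcal{T}$ (counted with multiplicity) that contain $x$ as a subset, and, for $1\le r\le m$, $f_{\mathcal{T}}^{(r)}$ is the frequency of the $r$-th itemset when the itemsets of $U(\mathcal{I},w)$ are sorted by decreasing $f_{\mathcal{T}}$ (ties broken arbitrarily). Define $$\mathrm{TOPK}(\mathcal{T},\mathcal{I},K,w)=\{(x,f_{\mathcal{T}}(x)) : x\in U(\mathcal{I},w),\ f_{\mathcal{T}}(x)\ge f_{\mathcal{T}}^{(K)}\}.$$ For $\varepsilon\in(0,1)$, an $\varepsilon$-approximation to $\mathrm{TOPK}(\mathcal{D},\mathcal{I},K,w)$ is a set $W$ of $K$ or more ordered pairs $(x,f)$ with $x\in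 U(\mathcal{I},w)$, $f\in[0,1]$, such that: (P1) for each $(x,f)\in W$, $f_{\mathcal{D}}(x)\ge f_{\mathcal{D}}^{(K)}-\varepsilon$; (P2) for each $x\in U(\mathcal{I},w)$ that does not occur as first component of a pair in $W$, $f_{\mathcal{D}}(x)<f_{\mathcal{D}}^{(K)}+\varepsilon$; (P3) for each $(x,f)\in W$, $|f-f_{\mathcal{D}}(x)|\le\varepsilon$. Algorithm parameters. For $j\ge0$ let $$t_j=\frac{8}{\varepsilon^2}\left(\ln\frac{8K}{\delta}+j\right),$$ and let $j_{\max}\ge0$ be the smallest index such that $t_{j_{\max}}\ge\min\left\{|\mathcal{D}|,\ \frac{2}{\varepsilon^2}\ln\frac{2m+K(m-K)}{\delta}\right\}$. Let $\sigma_j=K(e/2)^j$ ($e$ is the base of natural logarithms); for $i\ge0$ let $s_j(i)=\left\lfloor(2\sigma_j)^{(i+1)^2}/2\right\rfloor$ and $S_j(i)=\sum_{r=0}^{i}s_j(r)$, with $S_j(-1)=0$. Let $h(j)$ be the largest index such that $S_j(h(j)-1)+1\le m$. Algorithm. It executes Phases $j=0,1,2,\ldots$. In Phase $j<j_{\max}$ it draws a random sample $\mathcal{S}$ of $\lceil t_j\rceil$ transactions uniformly with replacement from $\mathcal{D}$; if the stopping condition $$f_{\mathcal{S}}^{(K)}-f_{\mathcal{S}}^{(S_j(i-1)+1)}>(i+1)\varepsilon\quad\text{for all } i \text{ with } 1\le i\le h(j)$$ holds, it stops and returns $\mathrm{TOPK}(\mathcal{S},\mathcal{I},K,w)$; otherwise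 it proceeds to Phase $j+1$. In Phase $j_{\max}$: if $t_{j_{\max}}\ge|\mathcal{D}|$ it sets $\mathcal{S}=\mathcal{D}$; otherwise it draws a random sample $\mathcal{S}$ of $\lceil t_{j_{\max}}\rceil$ transactions uniformly with replacement from $\mathcal{D}$; it then stops and returns $\mathrm{TOPK}(\mathcal{S},\mathcal{I},K,w)$. The paper does not specify the joint distribution of the samples of different phases. -}

module Defs where

open import Level using (0ℓ; suc)
open import Algebra.Bundles using (CommutativeRing)
open import Axiom.ExcludedMiddle using (ExcludedMiddle)
open import Data.Bool.Base using (if_then_else_)
open import Data.Fin.Base using (Fin; toℕ)
open import Data.Fin.Subset using (Subset; inside; outside; ∣_∣)
open import Data.Fin.Subset.Properties using (_⊆?_)
open import Data.List.Base as List using (List; []; _∷_; _++_)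
import Data.List.Sort as Sort
open import Data.Maybe.Base using (maybe′)
open import Data.Nat.Base as ℕ using (ℕ)
import Data.Nat.Properties as ℕ
open import Data.Product.Base using (Σ; ∃; _×_; _,_)
open import Data.Product.Relation.Binary.Pointwise.NonDependent using (Pointwise)
open import Data.Sum.Base using (_⊎_)
open import Data.Vec.Base as Vec using (Vec)
open import Function.Definitions using (Injective)
open import Relation.Binary.Bundles using (TotalOrder; DecTotalOrder)
import Relation.Binary.Construct.Flip.EqAndOrd as Flip
import Relation.Binary.Construct.NonStrictToStrict as ToStrict
import Relation.Binary.Construct.On as On
open import Relation.Binary.Core using (Rel)
open import Relation.Binary.PropositionalEquality.Core using (_≡_)
open import Relation.Binary.Structures using (IsTotalOrder)
open import Relation.Nullary.Decidable.Core using (does; yes; no; _×-dec_)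
open import Relation.Nullary.Negation.Core using (¬_)

-- Dedekind-complete ordered fields.  Classically there is exactly one up
-- to isomorphism, so "for every complete ordered field" reads "for ℝ".
-- The inverse is total; its value at 0# is unconstrained.

record CompleteOrderedField : Set (suc 0ℓ) where
  infix  4 _≤_
  infix  8 _⁻¹
  field
    commutativeRing : CommutativeRing 0ℓ 0ℓ
  open CommutativeRing commutativeRing public
  field
    _≤_          : Rel Carrier 0ℓ
    isTotalOrder : IsTotalOrder _≈_ _≤_
    _⁻¹          : Carrier → Carrier
    0≉1          : ¬ 0# ≈ 1#
    ⁻¹-inverse   : ∀ {x} → ¬ x ≈ 0# → x * x ⁻¹ ≈ 1#
    +-mono-≤     : ∀ {x y} z → x ≤ y → x + z ≤ y + z
    *-nonNeg     : ∀ {x y} → 0# ≤ x → 0# ≤ y → 0# ≤ x * y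

  UpperBound : (Carrier → Set) → Carrier → Set
  UpperBound P b = ∀ {x} → P x → x ≤ b

  field
    complete : (P : Carrier → Set) → ∃ P → ∃ (UpperBound P) →
               Σ Carrier λ s → UpperBound P s × (∀ b → UpperBound P b → s ≤ b)

module Classical (em : ExcludedMiddle 0ℓ) (ℝ : CompleteOrderedField) where

  open CompleteOrderedField ℝ public renaming (Carrier to R)

  totalOrder : TotalOrder 0ℓ 0ℓ 0ℓ
  totalOrder = record { isTotalOrder = isTotalOrder }

  decTotalOrder : DecTotalOrder 0ℓ 0ℓ 0ℓ
  decTotalOrder = record
    { isDecTotalOrder = record
      { isTotalOrder = isTotalOrder
      ; _≟_          = λ _ _ → em
      ; _≤?_         = λ _ _ → em
      }
    }

  open ToStrict _≈_ _≤_ public using (_<_)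
  open import Algebra.Construct.NaturalChoice.Min totalOrder public using (_⊓_)
  open import Algebra.Construct.NaturalChoice.Max totalOrder public using (_⊔_)
  open import Algebra.Properties.Semiring.Exp semiring public using (_^_)
  open import Algebra.Properties.Semiring.Mult semiring public using () renaming (_×_ to _·_)
  open import Algebra.Properties.Semiring.Sum semiring public using (sum)

  infixl 7 _/_
  _/_ : R → R → R
  x / y = x * y ⁻¹

  abs : R → R
  abs x = x ⊔ - x

  fromℕ : ℕ → R
  fromℕ n = n · 1#

  ite : ∀ {a} {A : Set a} → Set → A → A → A
  ite P x y = if does (em {P}) then x else y

  -- "The x such that P x".  The default is returned only if there is no such
  -- x, which never happens in the instances the algorithm uses.

  theℝ : (R → Set) → R
  theℝ P with em {∃ P}
  ... | yes (x , _) = x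
  ... | no _        = 0#

  theℕ : (ℕ → Set) → ℕ
  theℕ P with em {∃ P}
  ... | yes (n , _) = n
  ... | no _        = 0

  least greatest : (ℕ → Set) → ℕ
  least    P = theℕ λ n → P n × (∀ k → P k → n ℕ.≤ k)
  greatest P = theℕ λ n → P n × (∀ k → P k → k ℕ.≤ n)

  -- Into ℕ, hence only meant for nonnegative arguments.

  ⌈_⌉ ⌊_⌋ : R → ℕ
  ⌈ x ⌉ = least    λ n → x ≤ fromℕ n
  ⌊ x ⌋ = greatest λ n → fromℕ n ≤ x

  _⟶_ : (ℕ → R) → R → Set
  a ⟶ l = ∀ η → 0# < η → ∃ λ N → ∀ n → N ℕ.≤ n → abs (a n - l) < η

  expPartialSum : R → ℕ → R
  expPartialSum x n = sum {n} λ k → x ^ toℕ k / fromℕ (toℕ k ℕ.!)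

  exp : R → R
  exp x = theℝ λ y → expPartialSum x ⟶ y

  𝕖 : R
  𝕖 = exp 1#

  -- Only meant for positive arguments.

  ln : R → R
  ln x = theℝ λ y → exp y ≈ x

  record FiniteProbabilitySpace : Set where
    field
      size    : ℕ
      weight  : Fin size → R
      nonNeg  : ∀ ω → 0# ≤ weight ω
      total-1 : sum weight ≈ 1#

    Outcome : Set
    Outcome = Fin size

    Pr : (Outcome → Set) → R
    Pr E = sum λ ω → ite (E ω) (weight ω) 0#

  Itemset Transaction : ℕ → Set
  Itemset     = Subset
  Transaction = Subset

  Dataset : ℕ → ℕ → Set
  Dataset n k = Vec (Transaction n) k

  allItemsets : ∀ n → List (Itemset n)
  allItemsets ℕ.zero    = Vec.[] ∷ []
  allItemsets (ℕ.suc n) = List.map (inside Vec.∷_) (allItemsets n)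
                       ++ List.map (outside Vec.∷_) (allItemsets n)

  InU : ∀ {n} → ℕ → Itemset n → Set
  InU w x = 1 ℕ.≤ ∣ x ∣ × ∣ x ∣ ℕ.≤ w

  U : ∀ n → ℕ → List (Itemset n)
  U n w = List.filter (λ x → (1 ℕ.≤? ∣ x ∣) ×-dec (∣ x ∣ ℕ.≤? w)) (allItemsets n)

  cardU : ℕ → ℕ → ℕ
  cardU n w = List.length (U n w)

  freq : ∀ {n k} → Dataset n k → Itemset n → R
  freq {k = k} T x = fromℕ (Vec.count (x ⊆?_) T) / fromℕ k

  -- Decreasing, because the order on frequencies is flipped.

  ranked : ∀ {n k} → ℕ → Dataset n k → List (Itemset n)
  ranked {n} w T = Sort.sort (On.decTotalOrder (Flip.decTotalOrder decTotalOrder) (freq T)) (U n w)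

  -- Ranks count from 1; the default 0# is returned only for r > cardU n w.

  freqRank : ∀ {n k} → ℕ → Dataset n k → ℕ → R
  freqRank w T r = maybe′ (freq T) 0# (List.head (List.drop (r ℕ.∸ 1) (ranked w T)))

  PairSet : ℕ → Set₁
  PairSet n = Itemset n → R → Set

  TOPK : ∀ {n k} → Dataset n k → (K w : ℕ) → PairSet n
  TOPK T K w x f = InU w x × f ≈ freq T x × freqRank w T K ≤ freq T x

  HasAtLeast : ∀ {n} → ℕ → PairSet n → Set
  HasAtLeast {n} K W =
    Σ (Fin K → Itemset n × R) λ g →
      (∀ i → let (x , f) = g i in W x f) × Injective _≡_ (Pointwise _≡_ _≈_) g

  record IsApproximation {n d} (D : Dataset n d) (K w : ℕ) (ε : R) (W : PairSet n) : Set where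
    field
      card : HasAtLeast K W
      inU  : ∀ x f → W x f → InU w x
      in01 : ∀ x f → W x f → 0# ≤ f × f ≤ 1#
      P1   : ∀ x f → W x f → freqRank w D K - ε ≤ freq D x
      P2   : ∀ x → InU w x → ¬ ∃ (W x) → freq D x < freqRank w D K + ε
      P3   : ∀ x f → W x f → abs (f - freq D x) ≤ ε

  module Progressive {n d : ℕ} (D : Dataset n d) (K w : ℕ) (ε δ : R) where

    m : ℕ
    m = cardU n w

    t : ℕ → R
    t j = fromℕ 8 / ε ^ 2 * (ln (fromℕ 8 * fromℕ K / δ) + fromℕ j)

    tMax : R
    tMax = fromℕ 2 / ε ^ 2 *
      ln ((fromℕ 2 * fromℕ m + fromℕ K * (fromℕ m - fromℕ K)) / δ)

    jMax : ℕ
    jMax = least λ j → fromℕ d ⊓ tMax ≤ t j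

    σ : ℕ → R
    σ j = fromℕ K * (𝕖 / fromℕ 2) ^ j

    s : ℕ → ℕ → ℕ
    s j i = ⌊ (fromℕ 2 * σ j) ^ ((i ℕ.+ 1) ℕ.^ 2) / fromℕ 2 ⌋

    -- S< j i is the sum of s j r over r < i, that is, S_j(i - 1).

    S< : ℕ → ℕ → ℕ
    S< j i = List.sum (List.map (s j) (List.upTo i))

    h : ℕ → ℕ
    h j = greatest λ i → S< j i ℕ.+ 1 ℕ.≤ m

    -- Positions in D rather than transactions, so that repeated
    -- transactions of D are drawn with the right multiplicity.

    Draw : ℕ → Set
    Draw j = Vec (Fin d) ⌈ t j ⌉

    sample : ∀ {j} → Draw j → Dataset n ⌈ t j ⌉
    sample = Vec.map (Vec.lookup D)

    StoppingCondition : ∀ {k} → ℕ → Dataset n k → Set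
    StoppingCondition j S = ∀ i → 1 ℕ.≤ i → i ℕ.≤ h j →
      fromℕ (i ℕ.+ 1) * ε < freqRank w S K - freqRank w S (S< j i ℕ.+ 1)

    -- Draws at phases where nothing is drawn (see IsDrawn) are never used.

    Draws : Set
    Draws = ∀ j → Draw j

    finalPhase : Draws → PairSet n
    finalPhase X = ite (fromℕ d ≤ t jMax)
      (TOPK D K w)
      (TOPK (sample {jMax} (X jMax)) K w)

    -- The run from Phase j on, when r further phases precede Phase jMax.

    runFrom : Draws → (j r : ℕ) → PairSet n
    runFrom X j ℕ.zero    = finalPhase X
    runFrom X j (ℕ.suc r) = ite (StoppingCondition j (sample {j} (X j)))
      (TOPK (sample {j} (X j)) K w)
      (runFrom X (ℕ.suc j) r)

    output : Draws → PairSet n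
    output X = runFrom X 0 jMax

    IsDrawn : ℕ → Set
    IsDrawn j = j ℕ.< jMax ⊎ (j ≡ jMax × ¬ fromℕ d ≤ t jMax)

    -- Only the marginals are prescribed: the joint distribution of the
    -- samples of different phases is arbitrary.

    UniformDraws : (Ω : FiniteProbabilitySpace) →
                   (FiniteProbabilitySpace.Outcome Ω → Draws) → Set
    UniformDraws Ω X = ∀ j → IsDrawn j → (v : Draw j) →
      FiniteProbabilitySpace.Pr Ω (λ ω → X ω j ≡ v) ≈ 1# / fromℕ d ^ ⌈ t j ⌉

{-# OPTIONS --safe #-}

-- Rank the itemsets by their frequency in D and cut the ranking into the consecutive
-- blocks of sizes s j 0, s j 1, …  In phase j call the sample good if every itemset of
-- block i has a frequency error of at most (i + 1) ε / 2.  If the sample is good and the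
-- stopping condition holds, no itemset of a block i ≥ 1 reaches the sample's K-th
-- frequency: S_j(i - 1) + 1 itemsets are at least as frequent as it in D, and they would
-- have sample frequencies within (i + 1) ε of the K-th.  So only errors of at most ε / 2
-- matter, and the output is an ε-approximation.  By a Hoeffding bound exp (- N a²) for each
-- itemset, block i is bad with probability at most q_j ^ (i + 1)² with
-- q_j ≤ δ² / (32 K) 2⁻ʲ, so all sampled phases together fail with probability at most
-- δ² / (8 K).
--
-- A naive union bound for the last phase leaves no room for this.  There (P1) and (P2)
-- can only fail if some pair x, y with x among the first K itemsets of D, y not among
-- them, and f_D(x) ≥ f_D(y) + ε is inverted by the sample; each such pair costs δ / M with
-- M = 2 m + K (m - K), while (P3) costs 2 (δ / M)² per itemset.  The total
-- K (m - K) δ / M + 2 m (δ / M)² ≤ δ - m δ / M leaves m δ / M ≥ δ² / (8 K).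

module Submission where

open import Defs
open import Level using (0ℓ)
open import Axiom.ExcludedMiddle using (ExcludedMiddle)
open import Axiom.DoubleNegationElimination using (em⇒dne)
open import Data.Nat.Base as ℕ using (ℕ)
import Data.Nat.Properties as ℕ
import Data.Nat.ListAction.Properties as ListAction
open import Algebra.Solver.Ring.AlmostCommutativeRing
  using (fromCommutativeRing; _-Raw-AlmostCommutative⟶_)
open import Data.Bool.Base using (if_then_else_; true; false)
open import Data.Empty using (⊥; ⊥-elim)
open import Data.Fin.Base as Fin using (Fin)
import Data.Fin.Properties as Fin
open import Data.Fin.Subset using (inside; outside; ∣_∣)
open import Data.Fin.Subset.Properties using (_⊆?_)
open import Data.Integer.Base as ℤ using (ℤ; -[1+_])
import Data.Integer.Properties as ℤ
open import Data.List.Base as List using (List; []; _∷_; length; take; drop; head; lookup)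
import Data.List.Properties as List
import Data.List.Sort as Sort
open import Data.List.Membership.Propositional using (_∈_)
open import Data.List.Membership.Propositional.Properties
  using (∈-filter⁺; ∈-filter⁻; ∈-lookup; ∈-map⁺; ∈-map⁻; ∈-++⁺ˡ; ∈-++⁺ʳ; ∈-++⁻)
open import Data.List.Relation.Unary.All as All using (All; []; _∷_)
open import Data.List.Relation.Unary.AllPairs using (AllPairs; []; _∷_)
open import Data.List.Relation.Unary.Any as Any using (Any; here; there)
import Data.List.Relation.Unary.Any.Properties as Any
import Data.List.Relation.Unary.Sorted.TotalOrder.Properties as Sorted
open import Data.List.Relation.Unary.Unique.Propositional using (Unique)
import Data.List.Relation.Unary.Unique.Propositional.Properties as Unique
open import Data.List.Relation.Binary.Permutation.Propositional using (_↭_; ↭-sym; ↭⇒↭ₛ)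
import Data.List.Relation.Binary.Permutation.Propositional.Properties as ↭
import Data.List.Relation.Binary.Permutation.Setoid.Properties as ↭ₛ
open import Data.Maybe.Base using (Maybe; just; nothing; maybe′)
open import Data.Product.Base using (∃; _×_; _,_; proj₁; proj₂)
open import Data.Sum.Base using (_⊎_; inj₁; inj₂; [_,_]′)
open import Data.Unit.Base using (⊤; tt)
open import Data.Vec.Base as Vec using (Vec)
import Data.Vec.Properties as Vec
open import Function.Base using (_∘_; id; _$_)
open import Relation.Binary.Bundles using (DecTotalOrder; TotalOrder)
import Relation.Binary.Construct.Flip.EqAndOrd as Flip
import Relation.Binary.Construct.On as On
open import Relation.Binary.PropositionalEquality as ≡ using (_≡_)
open import Relation.Binary.Structures using (IsTotalOrder)
open import Relation.Nullary.Decidable.Core using (Dec; yes; no; does; toSum; _×-dec_)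
open import Relation.Nullary.Negation.Core using (¬_)

-- Nothing is known about the joint distribution of the samples, so everything rests on union bounds
-- over phases, blocks and itemsets. This is why the blocks are cut along the ranking of the
-- dataset, which is deterministic, although the stopping condition speaks of ranks in the sample; a
-- pigeonhole argument (`topᴰ-in-tailˢ`) translates between the two rankings.
--
-- The costs in the last phase come from one exponent: a sample of size `N` inverts a gap `ε` with
-- probability at most `exp (- N ε² / 2)`, which the size `tMax` brings down to `z`, the `δ / M` of
-- the overview, while one itemset errs by more than `ε` with probability at most `2 exp (- N ε²)`,
-- that is, at most `2 z²`. Two itemsets may be arbitrarily correlated within a transaction, so the
-- moment of the difference of their indicators is bounded through its mean alone.
--
-- The reals are an axiomatic complete ordered field. Exponential and logarithm are therefore built
-- from suprema and partial sums, and the later estimates reduce to `1 + x ≤ exp x` and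
-- `cosh u ≤ exp (u² / 2)`.

module Development (em : ExcludedMiddle 0ℓ) (ℝ : CompleteOrderedField) where

  open Classical em ℝ hiding (zero)
  open IsTotalOrder isTotalOrder using (antisym; total)
    renaming (refl to ≤-refl; trans to ≤-trans; reflexive to ≤-reflexive)
  open import Algebra.Construct.NaturalChoice.Max totalOrder using (x≤x⊔y; x≤y⊔x; ⊔-lub)
  open import Algebra.Construct.NaturalChoice.Min totalOrder using (⊓-sel; x⊓y≤x)
  open import Algebra.Properties.AbelianGroup +-abelianGroup using (⁻¹-∙-comm)
  open import Algebra.Properties.CommutativeSemiring.Exp commutativeSemiring
    using (^-congˡ; ^-distrib-*)
  open import Algebra.Properties.Ring ring using (-0#≈0#; -‿involutive; -‿distribˡ-*)
  open import Algebra.Properties.Semiring.Mult semiring using (×-homo-+; ×1-homo-*)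
  open import Algebra.Properties.Semiring.Sum semiring
    using (sum-cong-≋; sum-init-last; ∑-distrib-+; ∑-comm; *-distribˡ-sum; *-distribʳ-sum)
  import Algebra.Solver.Ring as RingSolver
  import Relation.Binary.Reasoning.Setoid setoid as ≈R
  import Relation.Binary.Reasoning.PartialOrder (TotalOrder.poset totalOrder) as ≤R

  -- The ring solver with integer coefficients

  fromℕ-+ : ∀ m n → fromℕ (m ℕ.+ n) ≈ fromℕ m + fromℕ n
  fromℕ-+ = ×-homo-+ 1#

  fromℕ-* : ∀ m n → fromℕ (m ℕ.* n) ≈ fromℕ m * fromℕ n
  fromℕ-* = ×1-homo-*

  fromℤ : ℤ → R
  fromℤ (ℤ.+ n)    = fromℕ n
  fromℤ (-[1+ n ]) = - fromℕ (ℕ.suc n)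

  private
    x-0≈x : ∀ x → x - 0# ≈ x
    x-0≈x x = trans (+-congˡ -0#≈0#) (+-identityʳ x)

    cancel-suc : ∀ x y → (1# + x) - (1# + y) ≈ x - y
    cancel-suc x y = begin
      (1# + x) - (1# + y)       ≈⟨ +-congˡ (sym (⁻¹-∙-comm 1# y)) ⟩
      (1# + x) + (- 1# - y)     ≈⟨ +-congʳ (+-comm 1# x) ⟩
      (x + 1#) + (- 1# - y)     ≈⟨ +-assoc x 1# _ ⟩
      x + (1# + (- 1# - y))     ≈⟨ +-congˡ (sym (+-assoc 1# (- 1#) (- y))) ⟩
      x + ((1# - 1#) - y)       ≈⟨ +-congˡ (+-congʳ (-‿inverseʳ 1#)) ⟩
      x + (0# - y)              ≈⟨ +-congˡ (+-identityˡ _) ⟩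
      x - y                     ∎
      where open ≈R

    fromℤ-⊖ : ∀ m n → fromℤ (m ℤ.⊖ n) ≈ fromℕ m - fromℕ n
    fromℤ-⊖ ℕ.zero    ℕ.zero    = sym (x-0≈x 0#)
    fromℤ-⊖ ℕ.zero    (ℕ.suc n) = sym (+-identityˡ _)
    fromℤ-⊖ (ℕ.suc m) ℕ.zero    = sym (x-0≈x _)
    fromℤ-⊖ (ℕ.suc m) (ℕ.suc n) = begin
      fromℤ (ℕ.suc m ℤ.⊖ ℕ.suc n)   ≡⟨ ≡.cong fromℤ (ℤ.[1+m]⊖[1+n]≡m⊖n m n) ⟩
      fromℤ (m ℤ.⊖ n)               ≈⟨ fromℤ-⊖ m n ⟩
      fromℕ m - fromℕ n             ≈⟨ cancel-suc _ _ ⟨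
      fromℕ (ℕ.suc m) - fromℕ (ℕ.suc n) ∎
      where open ≈R

    fromℤ-+ : ∀ i j → fromℤ (i ℤ.+ j) ≈ fromℤ i + fromℤ j
    fromℤ-+ (ℤ.+ m)    (ℤ.+ n)    = fromℕ-+ m n
    fromℤ-+ (ℤ.+ m)    (-[1+ n ]) = fromℤ-⊖ m (ℕ.suc n)
    fromℤ-+ (-[1+ m ]) (ℤ.+ n)    = trans (fromℤ-⊖ n (ℕ.suc m)) (+-comm _ _)
    fromℤ-+ (-[1+ m ]) (-[1+ n ]) = begin
      - fromℕ (ℕ.suc (ℕ.suc (m ℕ.+ n)))          ≡⟨ ≡.cong (λ k → - fromℕ (ℕ.suc k)) (ℕ.+-suc m n) ⟨
      - fromℕ (ℕ.suc m ℕ.+ ℕ.suc n)              ≈⟨ -‿cong (fromℕ-+ (ℕ.suc m) (ℕ.suc n)) ⟩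
      - (fromℕ (ℕ.suc m) + fromℕ (ℕ.suc n))      ≈⟨ ⁻¹-∙-comm _ _ ⟨
      - fromℕ (ℕ.suc m) - fromℕ (ℕ.suc n)        ∎
      where open ≈R

    fromℤ-neg : ∀ i → fromℤ (ℤ.- i) ≈ - fromℤ i
    fromℤ-neg (ℤ.+ ℕ.zero)    = sym -0#≈0#
    fromℤ-neg (ℤ.+ (ℕ.suc n)) = refl
    fromℤ-neg (-[1+ n ])      = sym (-‿involutive _)

    fromℤ-pos* : ∀ m j → fromℤ ((ℤ.+ m) ℤ.* j) ≈ fromℕ m * fromℤ j
    fromℤ-pos* ℕ.zero j = trans (reflexive (≡.cong fromℤ (ℤ.*-zeroˡ j))) (sym (zeroˡ _))
    fromℤ-pos* (ℕ.suc m) j = begin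
      fromℤ (ℤ.+ (ℕ.suc m) ℤ.* j)          ≡⟨ ≡.cong fromℤ (ℤ.suc-* (ℤ.+ m) j) ⟩
      fromℤ (j ℤ.+ (ℤ.+ m) ℤ.* j)          ≈⟨ fromℤ-+ j _ ⟩
      fromℤ j + fromℤ ((ℤ.+ m) ℤ.* j)      ≈⟨ +-cong (sym (*-identityˡ _)) (fromℤ-pos* m j) ⟩
      1# * fromℤ j + fromℕ m * fromℤ j     ≈⟨ distribʳ _ _ _ ⟨
      fromℕ (ℕ.suc m) * fromℤ j            ∎
      where open ≈R

    fromℤ-* : ∀ i j → fromℤ (i ℤ.* j) ≈ fromℤ i * fromℤ j
    fromℤ-* (ℤ.+ m)    j = fromℤ-pos* m j
    fromℤ-* (-[1+ m ]) j = begin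
      fromℤ (-[1+ m ] ℤ.* j)               ≡⟨ ≡.cong fromℤ (ℤ.neg-distribˡ-* (ℤ.+ (ℕ.suc m)) j) ⟨
      fromℤ (ℤ.- (ℤ.+ (ℕ.suc m) ℤ.* j))    ≈⟨ fromℤ-neg (ℤ.+ (ℕ.suc m) ℤ.* j) ⟩
      - fromℤ (ℤ.+ (ℕ.suc m) ℤ.* j)        ≈⟨ -‿cong (fromℤ-pos* (ℕ.suc m) j) ⟩
      - (fromℕ (ℕ.suc m) * fromℤ j)        ≈⟨ -‿distribˡ-* _ _ ⟩
      - fromℕ (ℕ.suc m) * fromℤ j          ∎
      where open ≈R

    -- Unlike fromℤ, this sends the literal 1 to 1# on the nose.
    ⟦_⟧ℤ : ℤ → R
    ⟦ ℤ.+ 1 ⟧ℤ = 1#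
    ⟦ i     ⟧ℤ = fromℤ i

    ⟦⟧≈ : ∀ i → ⟦ i ⟧ℤ ≈ fromℤ i
    ⟦⟧≈ (ℤ.+ 0)                   = refl
    ⟦⟧≈ (ℤ.+ 1)                   = sym (+-identityʳ 1#)
    ⟦⟧≈ (ℤ.+ (ℕ.suc (ℕ.suc n)))   = refl
    ⟦⟧≈ (-[1+ n ])                = refl

    morphism : ℤ.+-*-rawRing -Raw-AlmostCommutative⟶ fromCommutativeRing commutativeRing
    morphism = record
      { ⟦_⟧    = ⟦_⟧ℤ
      ; +-homo = λ i j → trans (⟦⟧≈ (i ℤ.+ j)) (trans (fromℤ-+ i j) (sym (+-cong (⟦⟧≈ i) (⟦⟧≈ j))))
      ; *-homo = λ i j → trans (⟦⟧≈ (i ℤ.* j)) (trans (fromℤ-* i j) (sym (*-cong (⟦⟧≈ i) (⟦⟧≈ j))))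
      ; -‿homo = λ i → trans (⟦⟧≈ (ℤ.- i)) (trans (fromℤ-neg i) (-‿cong (sym (⟦⟧≈ i))))
      ; 0-homo = refl
      ; 1-homo = refl
      }

    coeff≟ : ∀ i j → Maybe (⟦ i ⟧ℤ ≈ ⟦ j ⟧ℤ)
    coeff≟ i j with i ℤ.≟ j
    ... | yes i≡j = just (reflexive (≡.cong ⟦_⟧ℤ i≡j))
    ... | no  _   = nothing

  open RingSolver ℤ.+-*-rawRing (fromCommutativeRing commutativeRing) morphism coeff≟
    using (solve; _:=_; _:+_; _:*_; _:-_; :-_; _:^_; con; Polynomial)

  :0 :1 :2 :3 :4 :8 : ∀ {n} → Polynomial n
  :0 = con (ℤ.+ 0)
  :1 = con (ℤ.+ 1)
  :2 = con (ℤ.+ 2)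
  :3 = con (ℤ.+ 3)
  :4 = con (ℤ.+ 4)
  :8 = con (ℤ.+ 8)

  -- Ordered field arithmetic

  ≤-resp : ∀ {x y x′ y′} → x ≈ x′ → y ≈ y′ → x ≤ y → x′ ≤ y′
  ≤-resp p q x≤y = ≤-trans (≤-reflexive (sym p)) (≤-trans x≤y (≤-reflexive q))

  ≰⇒≥ : ∀ {x y} → ¬ x ≤ y → y ≤ x
  ≰⇒≥ {x} {y} x≰y = [ (λ p → ⊥-elim (x≰y p)) , id ]′ (total x y)

  ≰⇒> : ∀ {x y} → ¬ x ≤ y → y < x
  ≰⇒> x≰y = ≰⇒≥ x≰y , λ e → x≰y (≤-reflexive (sym e))

  <⇒≱ : ∀ {x y} → x < y → ¬ y ≤ x
  <⇒≱ (p , ne) q = ne (antisym p q)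

  <⇒≤ : ∀ {x y} → x < y → x ≤ y
  <⇒≤ = proj₁

  ≮⇒≥ : ∀ {x y} → ¬ x < y → y ≤ x
  ≮⇒≥ {x} {y} x≮y with em {y ≤ x}
  ... | yes p = p
  ... | no  p = ⊥-elim (x≮y (≰⇒> p))

  <-resp : ∀ {x y x′ y′} → x ≈ x′ → y ≈ y′ → x < y → x′ < y′
  <-resp p q (l , ne) = ≤-resp p q l , λ e → ne (trans p (trans e (sym q)))

  ≤-<-trans : ∀ {x y z} → x ≤ y → y < z → x < z
  ≤-<-trans x≤y (y≤z , y≉z) = ≤-trans x≤y y≤z , λ e → y≉z (antisym y≤z (≤-trans (≤-reflexive (sym e)) x≤y))

  <-≤-trans : ∀ {x y z} → x < y → y ≤ z → x < z
  <-≤-trans (x≤y , x≉y) y≤z = ≤-trans x≤y y≤z , λ e → x≉y (antisym x≤y (≤-trans y≤z (≤-reflexive (sym e))))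

  x≤y⇒0≤y-x : ∀ {x y} → x ≤ y → 0# ≤ y - x
  x≤y⇒0≤y-x {x} x≤y = ≤-resp (-‿inverseʳ x) refl (+-mono-≤ (- x) x≤y)

  0≤y-x⇒x≤y : ∀ {x y} → 0# ≤ y - x → x ≤ y
  0≤y-x⇒x≤y {x} {y} p = ≤-resp (+-identityˡ x) (solve 2 (λ x y → (y :- x) :+ x := y) refl x y) (+-mono-≤ x p)

  -- The standard way to prove an inequality below: exhibit a certificate `s` that is visibly
  -- nonnegative and leave the identity to the ring solver.
  by-cert : ∀ {x y s} → 0# ≤ s → y - x ≈ s → x ≤ y
  by-cert p e = 0≤y-x⇒x≤y (≤-resp refl (sym e) p)

  x<y⇒0<y-x : ∀ {x y} → x < y → 0# < y - x
  x<y⇒0<y-x {x} {y} (p , ne) = x≤y⇒0≤y-x p , λ e → ne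
    (trans (sym (+-identityˡ x)) (trans (+-congʳ e) (solve 2 (λ x y → (y :- x) :+ x := y) refl x y)))

  by-cert< : ∀ {x y s} → 0# < s → y - x ≈ s → x < y
  by-cert< {x} {y} (p , ne) e = by-cert p e , λ x≈y → ne (trans (sym (-‿inverseʳ x)) (trans (+-congʳ x≈y) e))

  +-mono₂-≤ : ∀ {x y u v} → x ≤ y → u ≤ v → x + u ≤ y + v
  +-mono₂-≤ {x} {y} {u} {v} p q = ≤-trans (+-mono-≤ u p) (≤-resp (+-comm u y) (+-comm v y) (+-mono-≤ y q))

  0≤+ : ∀ {x y} → 0# ≤ x → 0# ≤ y → 0# ≤ x + y
  0≤+ p q = ≤-resp (+-identityˡ 0#) refl (+-mono₂-≤ p q)

  0<+≤ : ∀ {x y} → 0# < x → 0# ≤ y → 0# < x + y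
  0<+≤ {x} {y} p q = <-≤-trans p (by-cert q (solve 2 (λ x y → (x :+ y) :- x := y) refl x y))

  0≤* : ∀ {x y} → 0# ≤ x → 0# ≤ y → 0# ≤ x * y
  0≤* = *-nonNeg

  neg-≤ : ∀ {x y} → x ≤ y → - y ≤ - x
  neg-≤ {x} {y} p = by-cert (x≤y⇒0≤y-x p) (solve 2 (λ x y → (:- x) :- (:- y) := y :- x) refl x y)

  neg≤0 : ∀ {x} → 0# ≤ x → - x ≤ 0#
  neg≤0 p = ≤-resp refl -0#≈0# (neg-≤ p)

  0≤neg : ∀ {x} → x ≤ 0# → 0# ≤ - x
  0≤neg p = ≤-resp -0#≈0# refl (neg-≤ p)

  0≤x² : ∀ x → 0# ≤ x * x
  0≤x² x with total 0# x
  ... | inj₁ p = 0≤* p p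
  ... | inj₂ p = ≤-resp refl (solve 1 (λ x → (:- x) :* (:- x) := x :* x) refl x) (0≤* p′ p′)
    where p′ = ≤-resp -0#≈0# refl (neg-≤ p)

  0≤1 : 0# ≤ 1#
  0≤1 = ≤-resp refl (*-identityˡ 1#) (0≤x² 1#)

  0<1 : 0# < 1#
  0<1 = 0≤1 , 0≉1

  ≉0-* : ∀ {x y} → ¬ x ≈ 0# → ¬ y ≈ 0# → ¬ x * y ≈ 0#
  ≉0-* {x} {y} x≉0 y≉0 xy≈0 = y≉0 (begin
    y                 ≈⟨ *-identityˡ y ⟨
    1# * y            ≈⟨ *-congʳ (⁻¹-inverse x≉0) ⟨
    (x * x ⁻¹) * y    ≈⟨ solve 3 (λ x i y → (x :* i) :* y := i :* (x :* y)) refl x (x ⁻¹) y ⟩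
    x ⁻¹ * (x * y)    ≈⟨ *-congˡ xy≈0 ⟩
    x ⁻¹ * 0#         ≈⟨ zeroʳ _ ⟩
    0#                ∎)
    where open ≈R

  0<⇒≉0 : ∀ {x} → 0# < x → ¬ x ≈ 0#
  0<⇒≉0 (_ , ne) e = ne (sym e)

  0<* : ∀ {x y} → 0# < x → 0# < y → 0# < x * y
  0<* p q = 0≤* (<⇒≤ p) (<⇒≤ q) , λ e → ≉0-* (0<⇒≉0 p) (0<⇒≉0 q) (sym e)

  *-monoʳ-≤ : ∀ {x y z} → 0# ≤ z → x ≤ y → x * z ≤ y * z
  *-monoʳ-≤ {x} {y} {z} p q = by-cert (0≤* (x≤y⇒0≤y-x q) p)
    (solve 3 (λ x y z → y :* z :- x :* z := (y :- x) :* z) refl x y z)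

  *-monoˡ-≤ : ∀ {x y z} → 0# ≤ z → x ≤ y → z * x ≤ z * y
  *-monoˡ-≤ p q = ≤-resp (*-comm _ _) (*-comm _ _) (*-monoʳ-≤ p q)

  *-mono₂-≤ : ∀ {x y u v} → 0# ≤ x → 0# ≤ v → x ≤ y → u ≤ v → x * u ≤ y * v
  *-mono₂-≤ 0≤x 0≤v x≤y u≤v = ≤-trans (*-monoˡ-≤ 0≤x u≤v) (*-monoʳ-≤ 0≤v x≤y)

  *-cancelʳ-≤ : ∀ {x y z} → 0# < z → x * z ≤ y * z → x ≤ y
  *-cancelʳ-≤ {x} {y} {z} 0<z p with em {x ≤ y}
  ... | yes q = q
  ... | no  q = ⊥-elim (<⇒≱ (by-cert< (0<* (x<y⇒0<y-x (≰⇒> q)) 0<z)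
                  (solve 3 (λ x y z → x :* z :- y :* z := (x :- y) :* z) refl x y z)) p)

  *-cancelʳ-≈ : ∀ {x y z} → 0# < z → x * z ≈ y * z → x ≈ y
  *-cancelʳ-≈ p e = antisym (*-cancelʳ-≤ p (≤-reflexive e)) (*-cancelʳ-≤ p (≤-reflexive (sym e)))

  sq-cancel-≤ : ∀ {x y} → 0# ≤ y → x * x ≤ y * y → x ≤ y
  sq-cancel-≤ {x} {y} 0≤y p with em {x ≤ y}
  ... | yes q = q
  ... | no  q = ⊥-elim (<⇒≱ (by-cert< (0<* d (0<+≤ d (0≤+ 0≤y 0≤y)))
                  (solve 2 (λ x y → x :* x :- y :* y := (x :- y) :* ((x :- y) :+ (y :+ y))) refl x y)) p)
    where d = x<y⇒0<y-x (≰⇒> q)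

  0<⁻¹ : ∀ {x} → 0# < x → 0# < x ⁻¹
  0<⁻¹ {x} p = ≰⇒> λ q → <⇒≱ 0<1 (≤-resp (⁻¹-inverse (0<⇒≉0 p)) (zeroʳ x) (*-monoˡ-≤ (<⇒≤ p) q))

  0≤⁻¹ : ∀ {x} → 0# < x → 0# ≤ x ⁻¹
  0≤⁻¹ p = <⇒≤ (0<⁻¹ p)

  x⁻¹*x≈1 : ∀ {x} → 0# < x → x ⁻¹ * x ≈ 1#
  x⁻¹*x≈1 p = trans (*-comm _ _) (⁻¹-inverse (0<⇒≉0 p))

  /*-cancel : ∀ {x y} → 0# < y → x / y * y ≈ x
  /*-cancel {x} {y} p = trans (*-assoc x _ y) (trans (*-congˡ (x⁻¹*x≈1 p)) (*-identityʳ x))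

  0≤/ : ∀ {x y} → 0# ≤ x → 0# < y → 0# ≤ x / y
  0≤/ p q = 0≤* p (0≤⁻¹ q)

  0</ : ∀ {x y} → 0# < x → 0# < y → 0# < x / y
  0</ p q = 0<* p (0<⁻¹ q)

  /-≤ : ∀ {x y z} → 0# < y → x ≤ z * y → x / y ≤ z
  /-≤ p q = *-cancelʳ-≤ p (≤-resp (sym (/*-cancel p)) refl q)

  ≤-/ : ∀ {x y z} → 0# < y → z * y ≤ x → z ≤ x / y
  ≤-/ p q = *-cancelʳ-≤ p (≤-resp refl (sym (/*-cancel p)) q)

  ≈-/ : ∀ {x y z} → 0# < y → z * y ≈ x → z ≈ x / y
  ≈-/ p q = *-cancelʳ-≈ p (trans q (sym (/*-cancel p)))

  fromℕ-nonNeg : ∀ n → 0# ≤ fromℕ n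
  fromℕ-nonNeg ℕ.zero    = ≤-refl
  fromℕ-nonNeg (ℕ.suc n) = 0≤+ 0≤1 (fromℕ-nonNeg n)

  fromℕ-pos : ∀ n → 0# < fromℕ (ℕ.suc n)
  fromℕ-pos n = 0<+≤ 0<1 (fromℕ-nonNeg n)

  0<fromℕ : ∀ {n} → 1 ℕ.≤ n → 0# < fromℕ n
  0<fromℕ (ℕ.s≤s {n = n} _) = fromℕ-pos n

  fromℕ-1 : fromℕ 1 ≈ 1#
  fromℕ-1 = +-identityʳ 1#

  fromℕ-mono : ∀ {m n} → m ℕ.≤ n → fromℕ m ≤ fromℕ n
  fromℕ-mono (ℕ.z≤n {n}) = fromℕ-nonNeg n
  fromℕ-mono (ℕ.s≤s p)   = +-mono₂-≤ ≤-refl (fromℕ-mono p)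

  fromℕ-cancel : ∀ {m n} → fromℕ m ≤ fromℕ n → m ℕ.≤ n
  fromℕ-cancel {m} {n} p with m ℕ.≤? n
  ... | yes q = q
  ... | no  q = ⊥-elim (<⇒≱ 0<1 (by-cert (0≤+ (x≤y⇒0≤y-x p) (x≤y⇒0≤y-x (fromℕ-mono {ℕ.suc n} {m} (ℕ.≰⇒> q))))
                  (solve 2 (λ x y → :0 :- :1 := (y :- x) :+ (x :- (:1 :+ y))) refl (fromℕ m) (fromℕ n))))

  half : R
  half = fromℕ 2 ⁻¹

  half+half : half + half ≈ 1#
  half+half = trans (solve 1 (λ h → h :+ h := h :* :2) refl half) (x⁻¹*x≈1 (fromℕ-pos 1))

  0<half : 0# < half
  0<half = 0<⁻¹ (fromℕ-pos 1)

  ^-nonNeg : ∀ {x} n → 0# ≤ x → 0# ≤ x ^ n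
  ^-nonNeg ℕ.zero    p = 0≤1
  ^-nonNeg (ℕ.suc n) p = 0≤* p (^-nonNeg n p)

  ^-pos : ∀ {x} n → 0# < x → 0# < x ^ n
  ^-pos ℕ.zero    p = 0<1
  ^-pos (ℕ.suc n) p = 0<* p (^-pos n p)

  ^-monoˡ-≤ : ∀ {x y} n → 0# ≤ x → x ≤ y → x ^ n ≤ y ^ n
  ^-monoˡ-≤ ℕ.zero    p q = ≤-refl
  ^-monoˡ-≤ (ℕ.suc n) p q = *-mono₂-≤ p (^-nonNeg n (≤-trans p q)) q (^-monoˡ-≤ n p q)

  1^n≈1 : ∀ n → 1# ^ n ≈ 1#
  1^n≈1 ℕ.zero    = refl
  1^n≈1 (ℕ.suc n) = trans (*-identityˡ _) (1^n≈1 n)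

  1≤^ : ∀ {x} n → 1# ≤ x → 1# ≤ x ^ n
  1≤^ n p = ≤-resp (1^n≈1 n) refl (^-monoˡ-≤ n 0≤1 p)

  ^≤1 : ∀ {x} n → 0# ≤ x → x ≤ 1# → x ^ n ≤ 1#
  ^≤1 n p q = ≤-resp refl (1^n≈1 n) (^-monoˡ-≤ n p q)

  ^-antimonoʳ-≤ : ∀ {x m n} → 0# ≤ x → x ≤ 1# → m ℕ.≤ n → x ^ n ≤ x ^ m
  ^-antimonoʳ-≤ {n = n} p q ℕ.z≤n     = ^≤1 n p q
  ^-antimonoʳ-≤ p q (ℕ.s≤s r) = *-monoˡ-≤ p (^-antimonoʳ-≤ p q r)

  x≤x^n : ∀ {x n} → 1# ≤ x → 1 ℕ.≤ n → x ≤ x ^ n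
  x≤x^n {x} p (ℕ.s≤s {n = n} _) = ≤-resp (*-identityʳ x) refl (*-monoˡ-≤ (≤-trans 0≤1 p) (1≤^ n p))

  -- Absolute values, minima and maxima

  abs-≤ : ∀ {x b} → x ≤ b → - b ≤ x → abs x ≤ b
  abs-≤ {x} {b} p q = ⊔-lub p (≤-resp refl (-‿involutive b) (neg-≤ q))

  x≤abs : ∀ x → x ≤ abs x
  x≤abs x = x≤x⊔y x (- x)

  -x≤abs : ∀ x → - x ≤ abs x
  -x≤abs x = x≤y⊔x x (- x)

  abs-≤-inv : ∀ {x b} → abs x ≤ b → x ≤ b × - x ≤ b
  abs-≤-inv {x} p = ≤-trans (x≤abs x) p , ≤-trans (-x≤abs x) p

  abs-cases : ∀ x → (abs x ≈ x × 0# ≤ x) ⊎ (abs x ≈ - x × x ≤ 0#)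
  abs-cases x with total 0# x
  ... | inj₁ p = inj₁ (antisym (abs-≤ ≤-refl (≤-trans (neg≤0 p) p)) (x≤abs x) , p)
  ... | inj₂ p = inj₂ (antisym (abs-≤ (≤-trans p (0≤neg p)) (≤-reflexive (-‿involutive x))) (-x≤abs x) , p)

  0≤abs : ∀ x → 0# ≤ abs x
  0≤abs x with abs-cases x
  ... | inj₁ (e , p) = ≤-resp refl (sym e) p
  ... | inj₂ (e , p) = ≤-resp refl (sym e) (0≤neg p)

  abs-+ : ∀ x y → abs (x + y) ≤ abs x + abs y
  abs-+ x y = abs-≤ (+-mono₂-≤ (x≤abs x) (x≤abs y))
    (by-cert (0≤+ (x≤y⇒0≤y-x (-x≤abs x)) (x≤y⇒0≤y-x (-x≤abs y)))
      (solve 4 (λ x y a b → (x :+ y) :- (:- (a :+ b)) := (a :- (:- x)) :+ (b :- (:- y))) refl x y (abs x)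
        (abs y)))

  abs-* : ∀ x y → abs (x * y) ≤ abs x * abs y
  abs-* x y with abs-cases x | abs-cases y
  ... | inj₁ (e , p) | inj₁ (f , q) = abs-≤ (≤-reflexive (sym (*-cong e f)))
    (≤-trans (neg≤0 (0≤* (0≤abs x) (0≤abs y))) (0≤* p q))
  ... | inj₁ (e , p) | inj₂ (f , q) = abs-≤
    (≤-trans (≤-resp refl (zeroʳ x) (*-monoˡ-≤ p q)) (0≤* (0≤abs x) (0≤abs y)))
    (≤-reflexive (trans (-‿cong (*-cong e f)) (solve 2 (λ x y → :- (x :* (:- y)) := x :* y) refl x y)))
  ... | inj₂ (e , p) | inj₁ (f , q) = abs-≤
    (≤-trans (≤-resp refl (zeroˡ y) (*-monoʳ-≤ q p)) (0≤* (0≤abs x) (0≤abs y)))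
    (≤-reflexive (trans (-‿cong (*-cong e f)) (solve 2 (λ x y → :- ((:- x) :* y) := x :* y) refl x y)))
  ... | inj₂ (e , p) | inj₂ (f , q) = abs-≤ (≤-reflexive xy)
    (≤-trans (neg≤0 (0≤* (0≤abs x) (0≤abs y))) (≤-resp refl (sym xy) (0≤* (0≤abs x) (0≤abs y))))
    where xy = trans (solve 2 (λ x y → x :* y := (:- x) :* (:- y)) refl x y) (sym (*-cong e f))

  abs-cong : ∀ {x y} → x ≈ y → abs x ≈ abs y
  abs-cong {x} {y} e = antisym (abs-≤ (≤-trans (≤-reflexive e) (x≤abs y)) (l e))
    (abs-≤ (≤-trans (≤-reflexive (sym e)) (x≤abs x)) (l (sym e)))
    where l : ∀ {x y} → x ≈ y → - abs y ≤ x
          l {x} {y} e = ≤-trans (neg-≤ (-x≤abs y)) (≤-reflexive (trans (-‿involutive y) (sym e)))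

  -- Definite descriptions

  ite-yes : ∀ {a} {A : Set a} {P : Set} {x y : A} → P → ite P x y ≡ x
  ite-yes {P = P} p with em {P}
  ... | yes _ = ≡.refl
  ... | no ¬p = ⊥-elim (¬p p)

  ite-no : ∀ {a} {A : Set a} {P : Set} {x y : A} → ¬ P → ite P x y ≡ y
  ite-no {P = P} ¬p with em {P}
  ... | yes p = ⊥-elim (¬p p)
  ... | no _  = ≡.refl

  theℝ-spec : ∀ {P} → ∃ P → P (theℝ P)
  theℝ-spec {P} e with em {∃ P}
  ... | yes (_ , p) = p
  ... | no ¬e       = ⊥-elim (¬e e)

  theℕ-spec : ∀ {P} → ∃ P → P (theℕ P)
  theℕ-spec {P} e with em {∃ P}
  ... | yes (_ , p) = p
  ... | no ¬e       = ⊥-elim (¬e e)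

  least-exists : ∀ (P : ℕ → Set) n → P n → ∃ λ l → P l × (∀ k → P k → l ℕ.≤ k)
  least-exists P n Pn with em {P 0}
  ... | yes P0 = 0 , P0 , λ _ _ → ℕ.z≤n
  least-exists P ℕ.zero    Pn | no ¬P0 = ⊥-elim (¬P0 Pn)
  least-exists P (ℕ.suc n) Pn | no ¬P0 with least-exists (P ∘ ℕ.suc) n Pn
  ... | l , Pl , l-least = ℕ.suc l , Pl , λ
    { ℕ.zero    P0 → ⊥-elim (¬P0 P0)
    ; (ℕ.suc k) Pk → ℕ.s≤s (l-least k Pk) }

  greatest-exists : ∀ (P : ℕ → Set) {n} → P n → ∀ b → (∀ k → P k → k ℕ.≤ b) →
                    ∃ λ g → P g × (∀ k → P k → k ℕ.≤ g)
  greatest-exists P {n} Pn b bd with em {P b}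
  ... | yes Pb = b , Pb , bd
  greatest-exists P {n} Pn ℕ.zero bd | no ¬Pb = ⊥-elim (¬Pb (≡.subst P (ℕ.n≤0⇒n≡0 (bd n Pn)) Pn))
  greatest-exists P {n} Pn (ℕ.suc b) bd | no ¬Pb = greatest-exists P Pn b λ k Pk →
    [ ℕ.≤-pred , (λ { ≡.refl → ⊥-elim (¬Pb Pk) }) ]′ (ℕ.m≤n⇒m<n∨m≡n (bd k Pk))

  least-spec : ∀ {P n} → P n → P (least P)
  least-spec {P} {n} Pn = proj₁ (theℕ-spec (least-exists P n Pn))

  greatest-spec : ∀ {P n} → P n → ∀ b → (∀ k → P k → k ℕ.≤ b) →
                  P (greatest P) × (∀ k → P k → k ℕ.≤ greatest P)
  greatest-spec {P} Pn b bd = theℕ-spec (greatest-exists P Pn b bd)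

  -- The Archimedean property, floor and ceiling

  -- Otherwise the naturals have a supremum `s`; since `n + 1 ≤ s` for every `n`, already `s - 1` is
  -- an upper bound.
  archimedean : ∀ x → ∃ λ n → x ≤ fromℕ n
  archimedean x with em {∃ λ n → x ≤ fromℕ n}
  ... | yes p = p
  ... | no ¬p = ⊥-elim (<⇒≱ 0<1
    (by-cert (x≤y⇒0≤y-x (lub (s - 1#) ub′)) (solve 1 (λ s → :0 :- :1 := (s :- :1) :- s) refl s)))
    where
    P : R → Set
    P y = ∃ λ n → y ≡ fromℕ n
    sup = complete P (0# , 0 , ≡.refl) (x , λ { (n , ≡.refl) → ≰⇒≥ (λ q → ¬p (n , q)) })
    s = proj₁ sup
    ub = proj₁ (proj₂ sup)
    lub = proj₂ (proj₂ sup)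
    ub′ : UpperBound P (s - 1#)
    ub′ (n , ≡.refl) = by-cert (x≤y⇒0≤y-x (ub (ℕ.suc n , ≡.refl)))
      (solve 2 (λ s n → (s :- :1) :- n := s :- (:1 :+ n)) refl s (fromℕ n))

  ≤⌈⌉ : ∀ x → x ≤ fromℕ ⌈ x ⌉
  ≤⌈⌉ x with archimedean x
  ... | n , p = least-spec {λ n → x ≤ fromℕ n} {n} p

  ⌊⌋-spec : ∀ {x} → 0# ≤ x → fromℕ ⌊ x ⌋ ≤ x × (∀ k → fromℕ k ≤ x → k ℕ.≤ ⌊ x ⌋)
  ⌊⌋-spec {x} 0≤x with archimedean x
  ... | b , x≤b = greatest-spec {λ n → fromℕ n ≤ x} {0} 0≤x b
                    λ k k≤x → fromℕ-cancel {k} {b} (≤-trans k≤x x≤b)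

  -- Limits

  half-< : ∀ {η} → 0# < η → η * half < η
  half-< {η} p = by-cert< (0<* p 0<half)
    (trans (+-congʳ (trans (sym (*-identityʳ η)) (*-congˡ (sym half+half))))
           (solve 2 (λ η h → η :* (h :+ h) :- η :* h := η :* h) refl η half))

  -- Non-strict estimates suffice, because they can be applied to half of `η`.
  lim-intro : ∀ {a l} → (∀ η → 0# < η → ∃ λ N → ∀ n → N ℕ.≤ n → abs (a n - l) ≤ η) → a ⟶ l
  lim-intro f η 0<η = proj₁ q , λ n p → ≤-<-trans (proj₂ q n p) (half-< 0<η)
    where q = f (η * half) (0<* 0<η 0<half)

  -- Otherwise, at a late common index, `a n` and `b n` lie within `(l - k) / 2` of limits that are
  -- in the opposite order.
  lim-≤ : ∀ {a b l k} → a ⟶ l → b ⟶ k → ∀ M → (∀ n → M ℕ.≤ n → a n ≤ b n) → l ≤ k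
  lim-≤ {a} {b} {l} {k} a→l b→k M a≤b = ≮⇒≥ contra
    where
    contra : ¬ k < l
    contra k<l = <⇒≱ gap (a≤b n (ℕ.m≤n+m M (N₁ ℕ.+ N₂)))
      where
      η = (l - k) * half
      0<η = 0<* (x<y⇒0<y-x k<l) 0<half
      N₁ = proj₁ (a→l η 0<η)
      N₂ = proj₁ (b→k η 0<η)
      n = N₁ ℕ.+ N₂ ℕ.+ M
      p₁ = proj₂ (a→l η 0<η) n (ℕ.≤-trans (ℕ.m≤m+n N₁ N₂) (ℕ.m≤m+n _ M))
      p₂ = proj₂ (b→k η 0<η) n (ℕ.≤-trans (ℕ.m≤n+m N₂ N₁) (ℕ.m≤m+n _ M))
      q₁ = x<y⇒0<y-x (≤-<-trans (-x≤abs (a n - l)) p₁)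
      q₂ = x<y⇒0<y-x (≤-<-trans (x≤abs (b n - k)) p₂)
      gap : b n < a n
      gap = by-cert< (0<+≤ q₁ (<⇒≤ q₂)) (begin
        a n - b n
          ≈⟨ solve 4 (λ a b l k → a :- b := ((a :- l) :- (b :- k)) :+ (l :- k) :* :1) refl (a n) (b n) l k ⟩
        ((a n - l) - (b n - k)) + (l - k) * 1#
          ≈⟨ +-congˡ (*-congˡ half+half) ⟨
        ((a n - l) - (b n - k)) + (l - k) * (half + half)
          ≈⟨ solve 5 (λ a b l k h → ((a :- l) :- (b :- k)) :+ (l :- k) :* (h :+ h)
               := ((l :- k) :* h :- (:- (a :- l))) :+ ((l :- k) :* h :- (b :- k))) refl (a n) (b n) l k half ⟩
        (η - (- (a n - l))) + (η - (b n - k)) ∎)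
        where open ≈R

  lim-unique : ∀ {a l k} → a ⟶ l → a ⟶ k → l ≈ k
  lim-unique p q = antisym (lim-≤ p q 0 λ _ _ → ≤-refl) (lim-≤ q p 0 λ _ _ → ≤-refl)

  lim-cong : ∀ {a b l} → (∀ n → a n ≈ b n) → a ⟶ l → b ⟶ l
  lim-cong e p η 0<η = proj₁ (p η 0<η) , λ n q → <-resp (abs-cong (+-congʳ (e n))) refl (proj₂ (p η 0<η) n q)

  lim-const : ∀ c → (λ _ → c) ⟶ c
  lim-const c = lim-intro λ η 0<η → 0 , λ _ _ →
    ≤-trans (≤-reflexive (abs-cong (-‿inverseʳ c))) (abs-≤ (<⇒≤ 0<η) (neg≤0 (<⇒≤ 0<η)))

  lim-dominated : ∀ {a l u} → (∀ n → abs (a n - l) ≤ u n) → u ⟶ 0# → a ⟶ l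
  lim-dominated {u = u} b u→0 η 0<η = proj₁ (u→0 η 0<η) , λ n q →
    ≤-<-trans (≤-trans (b n) (≤-trans (≤-reflexive (solve 1 (λ u → u := u :- :0) refl (u n))) (x≤abs _)))
      (proj₂ (u→0 η 0<η) n q)

  lim-+ : ∀ {a b l k} → a ⟶ l → b ⟶ k → (λ n → a n + b n) ⟶ (l + k)
  lim-+ {a} {b} {l} {k} p q = lim-intro λ η 0<η →
    let r = 0<* 0<η 0<half
        (N₁ , f₁) = p (η * half) r
        (N₂ , f₂) = q (η * half) r
    in N₁ ℕ.+ N₂ , λ n le →
      ≤-trans (≤-reflexive (abs-cong
        (solve 4 (λ a b l k → (a :+ b) :- (l :+ k) := (a :- l) :+ (b :- k)) refl (a n) (b n) l k)))
      (≤-trans (abs-+ _ _)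
      (≤-trans (+-mono₂-≤ (<⇒≤ (f₁ n (ℕ.≤-trans (ℕ.m≤m+n N₁ N₂) le)))
        (<⇒≤ (f₂ n (ℕ.≤-trans (ℕ.m≤n+m N₂ N₁) le))))
               (≤-reflexive (trans (solve 2 (λ η h → η :* h :+ η :* h := η :* (h :+ h)) refl η half)
                 (trans (*-congˡ half+half) (*-identityʳ η))))))

  lim-scale : ∀ {a l} c → a ⟶ l → (λ n → c * a n) ⟶ (c * l)
  lim-scale {a} {l} c p = lim-intro λ η 0<η →
    let 0<b = 0<+≤ 0<1 (0≤abs c)
        (N , f) = p (η / (1# + abs c)) (0</ 0<η 0<b)
    in N , λ n le →
      ≤-trans (≤-reflexive (abs-cong (solve 3 (λ a l c → c :* a :- c :* l := c :* (a :- l)) refl (a n) l c)))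
      (≤-trans (abs-* _ _)
      (≤-trans (*-mono₂-≤ (0≤abs c) (0≤/ (<⇒≤ 0<η) 0<b)
        (by-cert 0≤1 (solve 1 (λ c → (:1 :+ c) :- c := :1) refl (abs c))) (<⇒≤ (f n le)))
               (≤-reflexive (trans (*-comm _ _) (/*-cancel 0<b)))))

  -- Both factors converge to 0, so one of them may be compared with 1.
  lim-*-null : ∀ {a b} → a ⟶ 0# → b ⟶ 0# → (λ n → a n * b n) ⟶ 0#
  lim-*-null {a} {b} p q = lim-intro λ η 0<η →
    let (N₁ , f₁) = p η 0<η
        (N₂ , f₂) = q 1# 0<1
        z = λ x → ≤-reflexive (abs-cong (solve 1 (λ x → x := x :- :0) refl x))
    in N₁ ℕ.+ N₂ , λ n le →
      ≤-trans (≤-reflexive (abs-cong (solve 1 (λ x → x :- :0 := x) refl _)))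
      (≤-trans (abs-* _ _)
      (≤-resp refl (*-identityʳ η) (*-mono₂-≤ (0≤abs _) 0≤1
        (≤-trans (z (a n)) (<⇒≤ (f₁ n (ℕ.≤-trans (ℕ.m≤m+n N₁ N₂) le))))
        (≤-trans (z (b n)) (<⇒≤ (f₂ n (ℕ.≤-trans (ℕ.m≤n+m N₂ N₁) le)))))))

  lim-shift : ∀ {a l} → a ⟶ l → (λ n → a n - l) ⟶ 0#
  lim-shift {a} {l} p η 0<η = proj₁ (p η 0<η) , λ n le →
    <-resp (abs-cong (solve 2 (λ a l → a :- l := (a :- l) :- :0) refl (a n) l)) refl (proj₂ (p η 0<η) n le)

  -- Splits `a b - l k` into `(a - l) (b - k) + l (b - k) + k (a - l)`, three null sequences.
  lim-* : ∀ {a b l k} → a ⟶ l → b ⟶ k → (λ n → a n * b n) ⟶ (l * k)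
  lim-* {a} {b} {l} {k} p q = λ η 0<η →
    let (N , f) = r η 0<η in N , λ n le →
      <-resp (abs-cong (solve 4 (λ a b l k → ((a :- l) :* (b :- k) :+ (l :* (b :- k) :+ k :* (a :- l))) :-
        (:0 :+ (l :* :0 :+ k :* :0)) := a :* b :- l :* k) refl (a n) (b n) l k)) refl (f n le)
    where
    r = lim-+ (lim-*-null (lim-shift p) (lim-shift q))
      (lim-+ (lim-scale l (lim-shift q)) (lim-scale k (lim-shift p)))

  mono-≤ : ∀ (a : ℕ → R) → (∀ n → a n ≤ a (ℕ.suc n)) → ∀ {m n} → m ℕ.≤ n → a m ≤ a n
  mono-≤ a inc {m} {n} m≤n = go (ℕ.≤⇒≤′ m≤n)
    where
    go : ∀ {n} → m ℕ.≤′ n → a m ≤ a n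
    go (ℕ.≤′-reflexive ≡.refl) = ≤-refl
    go (ℕ.≤′-step {n} p) = ≤-trans (go p) (inc n)

  monotone-convergence : ∀ {a : ℕ → R} {b} → (∀ n → a n ≤ a (ℕ.suc n)) → (∀ n → a n ≤ b) →
                         ∃ λ l → a ⟶ l × (∀ n → a n ≤ l)
  monotone-convergence {a} {b} inc bd = s , lim-intro conv , λ n → ub (n , ≡.refl)
    where
    P : R → Set
    P y = ∃ λ n → y ≡ a n
    sup = complete P (a 0 , 0 , ≡.refl) (b , λ { (n , ≡.refl) → bd n })
    s = proj₁ sup
    ub = proj₁ (proj₂ sup)
    lub = proj₂ (proj₂ sup)
    conv : ∀ η → 0# < η → ∃ λ N → ∀ n → N ℕ.≤ n → abs (a n - s) ≤ η
    conv η 0<η with em {∃ λ N → s - η ≤ a N}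
    ... | yes (N , p) = N , λ n le → abs-≤
          (≤-trans (by-cert (x≤y⇒0≤y-x (ub (n , ≡.refl)))
            (solve 2 (λ a s → :0 :- (a :- s) := s :- a) refl (a n) s)) (<⇒≤ 0<η))
          (by-cert (x≤y⇒0≤y-x (≤-trans p (mono-≤ a inc le)))
            (solve 3 (λ a s η → (a :- s) :- (:- η) := a :- (s :- η)) refl (a n) s η))
    ... | no ¬p = ⊥-elim (<⇒≱ 0<η (by-cert (x≤y⇒0≤y-x (lub (s - η) λ { (n , ≡.refl) → ≰⇒≥ (λ q → ¬p (n , q)) }))
          (solve 2 (λ s η → :0 :- η := (s :- η) :- s) refl s η)))

  -- The limit is that of `a + b` minus that of `b`: `b` is increasing, and so is `a + b`, since a
  -- decrease of `a` is at most the increase of `b`. This stands in for the Cauchy criterion.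
  convergent-of-dominated : ∀ {a b c} → (∀ n → abs (a (ℕ.suc n) - a n) ≤ b (ℕ.suc n) - b n) →
                            (∀ n → b n ≤ c) → ∃ λ l → a ⟶ l
  convergent-of-dominated {a} {b} {c} dom bd = _ , lim-cong
    (λ n → solve 2 (λ a b → (a :+ b) :+ (:- :1) :* b := a) refl (a n) (b n))
      (lim-+ (proj₁ (proj₂ sum-conv)) (lim-scale (- 1#) (proj₁ (proj₂ b-conv))))
    where
    b-conv = monotone-convergence {b} {c} (λ n → 0≤y-x⇒x≤y (≤-trans (0≤abs _) (dom n))) bd
    a≤ : ∀ n → a n ≤ a 0 + (b n - b 0)
    a≤ ℕ.zero    = ≤-reflexive (solve 2 (λ a b → a := a :+ (b :- b)) refl (a 0) (b 0))
    a≤ (ℕ.suc n) = by-cert (0≤+ (x≤y⇒0≤y-x (a≤ n)) (x≤y⇒0≤y-x (proj₁ (abs-≤-inv (dom n)))))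
      (solve 6 (λ a₀ b₀ a b a′ b′ → (a₀ :+ (b′ :- b₀)) :- a′ := ((a₀ :+ (b :- b₀)) :- a) :+
        ((b′ :- b) :- (a′ :- a)))
        refl (a 0) (b 0) (a n) (b n) (a (ℕ.suc n)) (b (ℕ.suc n)))
    sum-conv = monotone-convergence {λ n → a n + b n} {a 0 + (c - b 0) + c}
      (λ n → by-cert (x≤y⇒0≤y-x (proj₂ (abs-≤-inv (dom n))))
        (solve 4 (λ a b a′ b′ → (a′ :+ b′) :- (a :+ b) := (b′ :- b) :- (:- (a′ :- a))) refl (a n) (b n)
          (a (ℕ.suc n)) (b (ℕ.suc n))))
      (λ n → +-mono₂-≤ (≤-trans (a≤ n) (+-mono₂-≤ ≤-refl (+-mono₂-≤ (bd n) ≤-refl))) (bd n))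

  -- Sums over initial segments of ℕ

  Σ< : ℕ → (ℕ → R) → R
  Σ< ℕ.zero    f = 0#
  Σ< (ℕ.suc n) f = Σ< n f + f n

  Σ<-cong : ∀ {f g} n → (∀ i → i ℕ.< n → f i ≈ g i) → Σ< n f ≈ Σ< n g
  Σ<-cong ℕ.zero    e = refl
  Σ<-cong (ℕ.suc n) e = +-cong (Σ<-cong n λ i p → e i (ℕ.m<n⇒m<1+n p)) (e n ℕ.≤-refl)

  Σ<-mono : ∀ {f g} n → (∀ i → i ℕ.< n → f i ≤ g i) → Σ< n f ≤ Σ< n g
  Σ<-mono ℕ.zero    e = ≤-refl
  Σ<-mono (ℕ.suc n) e = +-mono₂-≤ (Σ<-mono n λ i p → e i (ℕ.m<n⇒m<1+n p)) (e n ℕ.≤-refl)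

  Σ<-+ : ∀ f g n → Σ< n (λ i → f i + g i) ≈ Σ< n f + Σ< n g
  Σ<-+ f g ℕ.zero    = sym (+-identityˡ 0#)
  Σ<-+ f g (ℕ.suc n) = trans (+-congʳ (Σ<-+ f g n))
    (solve 4 (λ a b c d → (a :+ b) :+ (c :+ d) := (a :+ c) :+ (b :+ d)) refl _ _ _ _)

  Σ<-*ˡ : ∀ c f n → Σ< n (λ i → c * f i) ≈ c * Σ< n f
  Σ<-*ˡ c f ℕ.zero    = sym (zeroʳ c)
  Σ<-*ˡ c f (ℕ.suc n) = trans (+-congʳ (Σ<-*ˡ c f n)) (sym (distribˡ c _ _))

  Σ<-*ʳ : ∀ c f n → Σ< n (λ i → f i * c) ≈ Σ< n f * c
  Σ<-*ʳ c f n = trans (Σ<-cong n λ i _ → *-comm _ c) (trans (Σ<-*ˡ c f n) (*-comm c _))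

  Σ<-head : ∀ f n → Σ< (ℕ.suc n) f ≈ f 0 + Σ< n (f ∘ ℕ.suc)
  Σ<-head f ℕ.zero    = +-comm _ _
  Σ<-head f (ℕ.suc n) = trans (+-congʳ (Σ<-head f n)) (+-assoc _ _ _)

  abs-Σ< : ∀ {f g} n → (∀ i → i ℕ.< n → abs (f i) ≤ g i) → abs (Σ< n f) ≤ Σ< n g
  abs-Σ< ℕ.zero    e = abs-≤ ≤-refl (neg≤0 ≤-refl)
  abs-Σ< (ℕ.suc n) e = ≤-trans (abs-+ _ _) (+-mono₂-≤ (abs-Σ< n λ i p → e i (ℕ.m<n⇒m<1+n p)) (e n ℕ.≤-refl))

  Σ<-incr : ∀ {f} → (∀ i → 0# ≤ f i) → ∀ {m n} → m ℕ.≤ n → Σ< m f ≤ Σ< n f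
  Σ<-incr {f} pos = mono-≤ (λ n → Σ< n f) λ n → by-cert (pos n) (solve 2 (λ a b → (a :+ b) :- a := b) refl _ _)

  abs-Σ<-tail : ∀ {f g} → (∀ i → abs (f i) ≤ g i) → ∀ {m n} → m ℕ.≤ n →
                abs (Σ< n f - Σ< m f) ≤ Σ< n g - Σ< m g
  abs-Σ<-tail {f} {g} b {m} {n} m≤n = go (ℕ.≤⇒≤′ m≤n)
    where
    go : ∀ {n} → m ℕ.≤′ n → abs (Σ< n f - Σ< m f) ≤ Σ< n g - Σ< m g
    go (ℕ.≤′-reflexive ≡.refl) = ≤-trans (≤-reflexive (abs-cong (-‿inverseʳ _)))
      (≤-trans (abs-≤ ≤-refl (neg≤0 ≤-refl)) (≤-reflexive (sym (-‿inverseʳ _))))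
    go (ℕ.≤′-step {n} p) = ≤-trans (≤-reflexive (abs-cong (e _ _ _)))
      (≤-trans (abs-+ _ _) (≤-trans (+-mono₂-≤ (go p) (b n)) (≤-reflexive (sym (e _ _ _)))))
      where e = solve 3 (λ x y z → (x :+ y) :- z := (x :- z) :+ y) refl

  -- The exponential series

  term : R → ℕ → R
  term x n = x ^ n / fromℕ (n ℕ.!)

  E : R → ℕ → R
  E x n = Σ< n (term x)

  -- `sum` splits off its first summand and `Σ<` its last; the latter makes `E x (suc n)` unfold to
  -- `E x n + term x n`.
  expPartialSum≈E : ∀ x n → expPartialSum x n ≈ E x n
  expPartialSum≈E x ℕ.zero    = refl
  expPartialSum≈E x (ℕ.suc n) = trans (sum-init-last {n} (λ k → term x (Fin.toℕ k)))
    (+-cong (trans (sum-cong-≋ {n} {λ k → term x (Fin.toℕ (Fin.inject₁ k))} {λ k → term x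
      (Fin.toℕ k)} λ i → reflexive (≡.cong (term x) (Fin.toℕ-inject₁ i))) (expPartialSum≈E x n))
            (reflexive (≡.cong (term x) (Fin.toℕ-fromℕ n))))

  0<n! : ∀ n → 0# < fromℕ (n ℕ.!)
  0<n! n = 0<fromℕ (ℕ.1≤n! n)

  term-suc : ∀ x n → term x (ℕ.suc n) * fromℕ (ℕ.suc n) ≈ x * term x n
  term-suc x n = *-cancelʳ-≈ (0<n! n) (begin
    term x (ℕ.suc n) * fromℕ (ℕ.suc n) * fromℕ (n ℕ.!)    ≈⟨ *-assoc _ _ _ ⟩
    term x (ℕ.suc n) * (fromℕ (ℕ.suc n) * fromℕ (n ℕ.!))  ≈⟨ *-congˡ (fromℕ-* (ℕ.suc n) (n ℕ.!)) ⟨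
    term x (ℕ.suc n) * fromℕ (ℕ.suc n ℕ.!)                ≈⟨ /*-cancel (0<n! (ℕ.suc n)) ⟩
    x * x ^ n                                             ≈⟨ *-congˡ (/*-cancel (0<n! n)) ⟨
    x * (term x n * fromℕ (n ℕ.!))                        ≈⟨ *-assoc _ _ _ ⟨
    x * term x n * fromℕ (n ℕ.!)                          ∎)
    where open ≈R

  term-0 : ∀ x → term x 0 ≈ 1#
  term-0 x = sym (≈-/ (0<n! 0) (trans (*-identityˡ _) fromℕ-1))

  term-nonNeg : ∀ {x} → 0# ≤ x → ∀ n → 0# ≤ term x n
  term-nonNeg p n = 0≤/ (^-nonNeg n p) (0<n! n)

  term≤^ : ∀ {x} → 0# ≤ x → ∀ n → term x n ≤ x ^ n
  term≤^ {x} p n = /-≤ (0<n! n) (≤-resp (*-identityʳ _) refl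
    (*-monoˡ-≤ (^-nonNeg n p) (≤-resp fromℕ-1 refl (fromℕ-mono (ℕ.1≤n! n)))))

  term-mono : ∀ {x y} → 0# ≤ x → x ≤ y → ∀ n → term x n ≤ term y n
  term-mono p q n = *-monoʳ-≤ (0≤⁻¹ (0<n! n)) (^-monoˡ-≤ n p q)

  abs-^ : ∀ x n → abs (x ^ n) ≤ abs x ^ n
  abs-^ x ℕ.zero    = abs-≤ ≤-refl (≤-trans (neg≤0 0≤1) 0≤1)
  abs-^ x (ℕ.suc n) = ≤-trans (abs-* _ _) (*-monoˡ-≤ (0≤abs x) (abs-^ x n))

  abs-term : ∀ x n → abs (term x n) ≤ term (abs x) n
  abs-term x n = ≤-trans (abs-* _ _) (*-mono₂-≤ (0≤abs _) (0≤⁻¹ (0<n! n)) (abs-^ x n)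
    (abs-≤ ≤-refl (≤-trans (neg≤0 (0≤⁻¹ (0<n! n))) (0≤⁻¹ (0<n! n)))))

  -- The Cauchy product of the two exponential series, by the recurrence
  -- (n + 1) cₙ₊₁ = (x + y) cₙ.

  module _ (x y : R) where

    private
      a b : ℕ → R
      a = term x
      b = term y

      cauchy : ℕ → R
      cauchy n = Σ< (ℕ.suc n) (λ i → a i * b (n ℕ.∸ i))

      left : ∀ n → Σ< (ℕ.suc (ℕ.suc n)) (λ i → (a i * fromℕ i) * b (ℕ.suc n ℕ.∸ i)) ≈ x * cauchy n
      left n = begin
        Σ< (ℕ.suc (ℕ.suc n)) (λ i → (a i * fromℕ i) * b (ℕ.suc n ℕ.∸ i))
          ≈⟨ Σ<-head _ (ℕ.suc n) ⟩
        (a 0 * 0#) * b (ℕ.suc n) + Σ< (ℕ.suc n) (λ i → (a (ℕ.suc i) * fromℕ (ℕ.suc i)) * b (n ℕ.∸ i))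
          ≈⟨ +-cong (trans (*-congʳ (zeroʳ _)) (zeroˡ _))
            (Σ<-cong (ℕ.suc n) λ i _ → trans (*-congʳ (term-suc x i)) (*-assoc _ _ _)) ⟩
        0# + Σ< (ℕ.suc n) (λ i → x * (a i * b (n ℕ.∸ i)))
          ≈⟨ trans (+-identityˡ _) (Σ<-*ˡ x _ (ℕ.suc n)) ⟩
        x * cauchy n ∎
        where open ≈R

      right : ∀ n → Σ< (ℕ.suc (ℕ.suc n))
        (λ i → a i * (b (ℕ.suc n ℕ.∸ i) * fromℕ (ℕ.suc n ℕ.∸ i))) ≈ y * cauchy n
      right n = trans (+-cong
        (trans (Σ<-cong (ℕ.suc n) λ i i≤n → trans (*-congˡ (step i (ℕ.≤-pred i≤n)))
                 (solve 3 (λ a y b → a :* (y :* b) := y :* (a :* b)) refl (a i) y (b (n ℕ.∸ i))))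
               (Σ<-*ˡ y _ (ℕ.suc n)))
        (trans (*-congˡ (*-congˡ (reflexive (≡.cong fromℕ (ℕ.n∸n≡0 n)))))
          (trans (*-congˡ (zeroʳ _)) (zeroʳ _))))
        (+-identityʳ _)
        where
        step : ∀ i → i ℕ.≤ n → b (ℕ.suc n ℕ.∸ i) * fromℕ (ℕ.suc n ℕ.∸ i) ≈ y * b (n ℕ.∸ i)
        step i i≤n = ≡.subst (λ k → b k * fromℕ k ≈ y * b (n ℕ.∸ i)) (≡.sym (ℕ.+-∸-assoc 1 i≤n))
          (term-suc y (n ℕ.∸ i))

      cauchy≈term : ∀ n → cauchy n ≈ term (x + y) n
      cauchy≈term ℕ.zero    = trans (+-identityˡ _)
        (trans (*-cong (term-0 x) (term-0 y)) (trans (*-identityʳ 1#) (sym (term-0 (x + y)))))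
      cauchy≈term (ℕ.suc n) = *-cancelʳ-≈ (fromℕ-pos n) (begin
        cauchy (ℕ.suc n) * fromℕ (ℕ.suc n)
          ≈⟨ Σ<-*ʳ _ _ (ℕ.suc (ℕ.suc n)) ⟨
        Σ< (ℕ.suc (ℕ.suc n)) (λ i → (a i * b (ℕ.suc n ℕ.∸ i)) * fromℕ (ℕ.suc n))
          ≈⟨ Σ<-cong (ℕ.suc (ℕ.suc n)) (λ i i≤ → split i (ℕ.≤-pred i≤)) ⟩
        Σ< (ℕ.suc (ℕ.suc n)) (λ i → (a i * fromℕ i) * b (ℕ.suc n ℕ.∸ i) + a i *
          (b (ℕ.suc n ℕ.∸ i) * fromℕ (ℕ.suc n ℕ.∸ i)))
          ≈⟨ Σ<-+ _ _ (ℕ.suc (ℕ.suc n)) ⟩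
        _ ≈⟨ +-cong (left n) (right n) ⟩
        x * cauchy n + y * cauchy n
          ≈⟨ distribʳ _ _ _ ⟨
        (x + y) * cauchy n
          ≈⟨ *-congˡ (cauchy≈term n) ⟩
        (x + y) * term (x + y) n
          ≈⟨ term-suc (x + y) n ⟨
        term (x + y) (ℕ.suc n) * fromℕ (ℕ.suc n) ∎)
        where
        open ≈R
        split : ∀ i → i ℕ.≤ ℕ.suc n → (a i * b (ℕ.suc n ℕ.∸ i)) * fromℕ (ℕ.suc n)
                ≈ (a i * fromℕ i) * b (ℕ.suc n ℕ.∸ i) + a i * (b (ℕ.suc n ℕ.∸ i) * fromℕ (ℕ.suc n ℕ.∸ i))
        split i i≤ = trans
          (*-congˡ (trans (reflexive (≡.cong fromℕ (≡.sym (ℕ.m+[n∸m]≡n i≤)))) (fromℕ-+ i (ℕ.suc n ℕ.∸ i))))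
          (solve 4 (λ a b i j → (a :* b) :* (i :+ j) := (a :* i) :* b :+ a :* (b :* j)) refl _ _ _ _)

    -- By the binomial identity the left side runs over the triangle of index pairs with sum below
    -- `n`; on the right the triangle is summed row by row.
    E-+ : ∀ n → E (x + y) n ≈ Σ< n (λ i → a i * E y (n ℕ.∸ i))
    E-+ ℕ.zero    = refl
    E-+ (ℕ.suc n) = begin
      E (x + y) n + term (x + y) n
        ≈⟨ +-cong (E-+ n) (sym (cauchy≈term n)) ⟩
      Σ< n (λ i → a i * E y (n ℕ.∸ i)) + Σ< (ℕ.suc n) (λ i → a i * b (n ℕ.∸ i))
        ≈⟨ +-congʳ (trans (sym (+-identityʳ _))
          (+-congˡ (sym (trans (*-congˡ (reflexive (≡.cong (E y) (ℕ.n∸n≡0 n)))) (zeroʳ _))))) ⟩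
      Σ< (ℕ.suc n) (λ i → a i * E y (n ℕ.∸ i)) + Σ< (ℕ.suc n) (λ i → a i * b (n ℕ.∸ i))
        ≈⟨ Σ<-+ _ _ (ℕ.suc n) ⟨
      Σ< (ℕ.suc n) (λ i → a i * E y (n ℕ.∸ i) + a i * b (n ℕ.∸ i))
        ≈⟨ Σ<-cong (ℕ.suc n) (λ i i≤n → trans (sym (distribˡ _ _ _))
          (*-congˡ (reflexive (≡.cong (E y) (≡.sym (ℕ.+-∸-assoc 1 (ℕ.≤-pred i≤n))))))) ⟩
      Σ< (ℕ.suc n) (λ i → a i * E y (ℕ.suc n ℕ.∸ i)) ∎
      where open ≈R

    -- The product of the partial sums runs over a square of index pairs, the partial sum at `x + y`
    -- over a triangle inside it; the right side collects the pairs in between.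
    E-defect : ∀ n → E x n * E y n - E (x + y) n ≈ Σ< n (λ i → a i * (E y n - E y (n ℕ.∸ i)))
    E-defect n = begin
      E x n * E y n - E (x + y) n
        ≈⟨ +-cong (sym (Σ<-*ʳ _ _ n)) (-‿cong (E-+ n)) ⟩
      Σ< n (λ i → a i * E y n) - Σ< n (λ i → a i * E y (n ℕ.∸ i))
        ≈⟨ +-congˡ (trans (solve 1 (λ x → :- x := (:- :1) :* x) refl _) (sym (Σ<-*ˡ _ _ n))) ⟩
      Σ< n (λ i → a i * E y n) + Σ< n (λ i → - 1# * (a i * E y (n ℕ.∸ i)))
        ≈⟨ Σ<-+ _ _ n ⟨
      Σ< n (λ i → a i * E y n + - 1# * (a i * E y (n ℕ.∸ i)))
        ≈⟨ Σ<-cong n (λ i _ → solve 3 (λ a u v → a :* u :+ (:- :1) :* (a :* v) := a :* (u :- v)) refl _ _ _) ⟩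
      Σ< n (λ i → a i * (E y n - E y (n ℕ.∸ i))) ∎
      where open ≈R

  -- The defect is a polynomial in the two arguments with nonnegative coefficients, so passing to
  -- absolute values can only enlarge it. This reduces the functional equation to nonnegative
  -- arguments.
  abs-E-defect : ∀ x y n → abs (E x n * E y n - E (x + y) n) ≤ E (abs x) n * E (abs y) n - E (abs x + abs y) n
  abs-E-defect x y n = ≤-trans (≤-reflexive (abs-cong (E-defect x y n)))
    (≤-trans (abs-Σ< n λ i _ → ≤-trans (abs-* _ _) (*-mono₂-≤ (0≤abs _)
                (≤-trans (0≤abs _) (abs-Σ<-tail (abs-term y) (ℕ.m∸n≤m n i)))
                (abs-term x i) (abs-Σ<-tail (abs-term y) (ℕ.m∸n≤m n i))))
             (≤-reflexive (sym (E-defect (abs x) (abs y) n))))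

  E-submultiplicative : ∀ {x y} → 0# ≤ x → 0# ≤ y → ∀ n → E (x + y) n ≤ E x n * E y n
  E-submultiplicative {x} {y} p q n = 0≤y-x⇒x≤y (≤-resp (Σ<-zero n) (sym (E-defect x y n)) (Σ<-mono n λ i _ →
      0≤* (term-nonNeg p i) (x≤y⇒0≤y-x (Σ<-incr (term-nonNeg q) (ℕ.m∸n≤m n i)))))
    where
    Σ<-zero : ∀ n → Σ< n (λ _ → 0#) ≈ 0#
    Σ<-zero ℕ.zero    = refl
    Σ<-zero (ℕ.suc n) = trans (+-identityʳ _) (Σ<-zero n)

  -- The square of side `n` fits into the triangle of side `n + n`.
  E-product≤ : ∀ {x y} → 0# ≤ x → 0# ≤ y → ∀ n → E x n * E y n ≤ E (x + y) (n ℕ.+ n)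
  E-product≤ {x} {y} p q n = ≤-resp (Σ<-*ʳ _ _ n) (sym (E-+ x y (n ℕ.+ n)))
    (≤-trans (Σ<-mono n λ i i<n → *-monoˡ-≤ (term-nonNeg p i) (Σ<-incr (term-nonNeg q)
                (ℕ.≤-trans (ℕ.m≤m+n n (n ℕ.∸ i)) (ℕ.≤-reflexive (≡.sym (ℕ.+-∸-assoc n (ℕ.<⇒≤ i<n)))))))
             (Σ<-incr (λ i → 0≤* (term-nonNeg p i) (Σ<-incr (term-nonNeg q) {0} {n ℕ.+ n ℕ.∸ i} ℕ.z≤n))
               (ℕ.m≤m+n n n)))

  -- Comparison with the geometric series through `term≤^`; the remainder `x ^ n` is kept on the
  -- left so that the induction closes.
  E-geometric : ∀ {x} → 0# ≤ x → x ≤ 1# → ∀ n → (1# - x) * E x n + x ^ n ≤ 1#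
  E-geometric {x} p q ℕ.zero    = ≤-reflexive (solve 1 (λ x → (:1 :- x) :* :0 :+ :1 := :1) refl x)
  E-geometric {x} p q (ℕ.suc n) = ≤-trans
    (by-cert (0≤* (x≤y⇒0≤y-x q) (x≤y⇒0≤y-x (term≤^ p n)))
      (solve 4 (λ x e t z → ((:1 :- x) :* e :+ z) :- ((:1 :- x) :* (e :+ t) :+ x :* z) := (:1 :- x) :*
        (z :- t)) refl x (E x n) (term x n) (x ^ n)))
    (E-geometric p q n)

  E-geometric≤ : ∀ {x} → 0# ≤ x → x ≤ 1# → ∀ n → (1# - x) * E x n ≤ 1#
  E-geometric≤ {x} p q n = ≤-trans (by-cert (^-nonNeg n p) (solve 2 (λ a b → (a :+ b) :- a := b) refl _ _))
    (E-geometric p q n)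

  -- At `half` the geometric comparison gives the bound 2. An arbitrary `x` lies below a multiple
  -- `k` of `half`, and submultiplicativity turns the bound into `2 ^ k`.
  E-bounded : ∀ {x} → 0# ≤ x → ∃ λ b → ∀ n → E x n ≤ b
  E-bounded {x} p = fromℕ 2 ^ k , λ n → ≤-trans (Σ<-mono n λ i _ → term-mono p x≤ i) (bound k n)
    where
    k = proj₁ (archimedean (x * fromℕ 2))
    1-half : 1# - half ≈ half
    1-half = trans (+-congʳ (sym half+half)) (solve 1 (λ h → (h :+ h) :- h := h) refl half)
    half≤1 : half ≤ 1#
    half≤1 = 0≤y-x⇒x≤y (≤-resp refl (sym 1-half) (<⇒≤ 0<half))
    x≤ : x ≤ fromℕ k * half
    x≤ = ≤-/ (fromℕ-pos 1) (proj₂ (archimedean (x * fromℕ 2)))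
    E-half : ∀ n → E half n ≤ fromℕ 2
    E-half n = *-cancelʳ-≤ 0<half
      (≤-resp (trans (*-congʳ 1-half) (*-comm _ _)) (sym (⁻¹-inverse (0<⇒≉0 (fromℕ-pos 1))))
        (E-geometric≤ (<⇒≤ 0<half) half≤1 n))
    E-0 : ∀ n → E 0# n ≤ 1#
    E-0 n = ≤-trans (≤-reflexive (solve 1 (λ e → e := (:1 :- :0) :* e) refl _)) (E-geometric≤ ≤-refl 0≤1 n)
    bound : ∀ k n → E (fromℕ k * half) n ≤ fromℕ 2 ^ k
    bound ℕ.zero    n = ≤-trans
      (Σ<-mono n λ i _ → term-mono (≤-reflexive (sym (zeroˡ half))) (≤-reflexive (zeroˡ half)) i) (E-0 n)
    bound (ℕ.suc k) n = ≤-trans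
      (Σ<-mono n λ i _ → term-mono (0≤* (fromℕ-nonNeg (ℕ.suc k)) h)
        (≤-reflexive (trans (distribʳ _ _ _) (+-congʳ (*-identityˡ _)))) i)
      (≤-trans (E-submultiplicative h (0≤* (fromℕ-nonNeg k) h) n)
        (*-mono₂-≤ (Σ<-incr (term-nonNeg h) {0} {n} ℕ.z≤n) (^-nonNeg k (fromℕ-nonNeg 2)) (E-half n)
          (bound k n)))
      where h = <⇒≤ 0<half

  -- The exponential function: functional equation and elementary inequalities

  expPartialSum-converges : ∀ x → ∃ λ y → expPartialSum x ⟶ y
  expPartialSum-converges x = proj₁ conv , lim-cong (λ n → sym (expPartialSum≈E x n)) (proj₂ conv)
    where
    conv = convergent-of-dominated {E x} {E (abs x)}
      (λ n → abs-Σ<-tail (abs-term x) (ℕ.n≤1+n n)) (proj₂ (E-bounded (0≤abs x)))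

  exp-limit : ∀ x → E x ⟶ exp x
  exp-limit x = lim-cong (expPartialSum≈E x) (theℝ-spec (expPartialSum-converges x))

  E-cong : ∀ {x y} → x ≈ y → ∀ n → E x n ≈ E y n
  E-cong e n = Σ<-cong n λ i _ → *-congʳ (^-congˡ i e)

  exp-cong : ∀ {x y} → x ≈ y → exp x ≈ exp y
  exp-cong {x} {y} e = lim-unique (lim-cong (E-cong e) (exp-limit x)) (exp-limit y)

  E≤exp : ∀ {x} → 0# ≤ x → ∀ n → E x n ≤ exp x
  E≤exp {x} p n = lim-≤ (lim-const (E x n)) (exp-limit x) n λ _ → Σ<-incr (term-nonNeg p)

  -- At the absolute values `X` and `Y` the product of the partial sums is at most
  -- `E (X + Y) (n + n)`, hence at most `exp (X + Y)`. The defect is thus dominated by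
  -- `exp (X + Y) - E (X + Y) n`, which tends to 0.
  exp-+ : ∀ x y → exp (x + y) ≈ exp x * exp y
  exp-+ x y = lim-unique (exp-limit (x + y))
      (lim-cong (λ n → solve 2 (λ a b → a :- (a :- b) := b) refl (E x n * E y n) (E (x + y) n))
        (λ η 0<η → let (N , f) = r η 0<η in N , λ n le → <-resp (abs-cong (solve 3 (λ u v w → (u :+ (:- :1) :* w) :- (v :+ (:- :1) :* :0) := (u :- w) :- v) refl _ _ _)) refl (f n le)))
    where
    X = abs x
    Y = abs y
    gap : (λ n → exp (X + Y) + - 1# * E (X + Y) n) ⟶ 0#
    gap = λ η 0<η → let (N , f) = lim-+ (lim-const (exp (X + Y))) (lim-scale (- 1#) (exp-limit (X + Y))) η 0<η
      in N , λ n le → <-resp (abs-cong (+-congˡ (-‿cong (solve 1 (λ e → e :+ (:- :1) :* e := :0) refl (exp (X + Y)))))) refl (f n le)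
    defect : (λ n → E x n * E y n - E (x + y) n) ⟶ 0#
    defect = lim-dominated (λ n → ≤-trans (≤-reflexive (abs-cong (solve 1 (λ u → u :- :0 := u) refl _)))
      (≤-trans (abs-E-defect x y n)
        (by-cert (x≤y⇒0≤y-x (≤-trans (E-product≤ (0≤abs x) (0≤abs y) n)
          (E≤exp (0≤+ (0≤abs x) (0≤abs y)) (n ℕ.+ n))))
          (solve 3 (λ u v w → (u :+ (:- :1) :* w) :- (v :- w) := u :- v) refl _ _ _)))) gap
    r = lim-+ (lim-* (exp-limit x) (exp-limit y)) (lim-scale (- 1#) defect)

  exp-0 : exp 0# ≈ 1#
  exp-0 = antisym
    (lim-≤ (exp-limit 0#) (lim-const 1#) 0 λ n _ → ≤-trans
      (≤-reflexive (solve 1 (λ e → e := (:1 :- :0) :* e) refl _)) (E-geometric≤ ≤-refl 0≤1 n))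
    (≤-trans (≤-reflexive (trans (sym (term-0 0#)) (sym (+-identityˡ _)))) (E≤exp ≤-refl 1))

  exp-inverse : ∀ x → exp x * exp (- x) ≈ 1#
  exp-inverse x = trans (sym (exp-+ x (- x))) (trans (exp-cong (-‿inverseʳ x)) exp-0)

  -- It is the square of `exp (x / 2)`, and it is invertible.
  exp-pos : ∀ x → 0# < exp x
  exp-pos x = ≤-resp refl (trans (sym (exp-+ _ _))
    (exp-cong (trans (sym (distribˡ x half half)) (trans (*-congˡ half+half) (*-identityʳ x)))))
      (0≤x² (exp (x * half))) ,
    λ e → 0≉1 (trans (sym (zeroˡ _)) (trans (*-congʳ e) (exp-inverse x)))

  1+x≤exp-nonNeg : ∀ {x} → 0# ≤ x → 1# + x ≤ exp x
  1+x≤exp-nonNeg {x} p = ≤-trans (≤-reflexive (+-cong (sym (trans (+-identityˡ _) (term-0 x))) (sym (begin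
      term x 1              ≈⟨ *-identityʳ _ ⟨
      term x 1 * 1#         ≈⟨ *-congˡ fromℕ-1 ⟨
      term x 1 * fromℕ 1    ≈⟨ term-suc x 0 ⟩
      x * term x 0          ≈⟨ trans (*-congˡ (term-0 x)) (*-identityʳ x) ⟩
      x                     ∎)))) (E≤exp p 2)
    where open ≈R

  -- For `x ≥ 0` the first two terms of the series suffice, and for `1 + x ≤ 0` positivity does. In
  -- between, the geometric comparison at `- x` gives `(1 + x) exp (- x) ≤ 1`.
  1+x≤exp : ∀ x → 1# + x ≤ exp x
  1+x≤exp x = [ 1+x≤exp-nonNeg ,
    (λ x≤0 → [ (λ q → ≤-trans q (<⇒≤ (exp-pos x))) , small x≤0 ]′ (total (1# + x) 0#)) ]′ (total 0# x)
    where
    small : x ≤ 0# → 0# ≤ 1# + x → 1# + x ≤ exp x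
    small x≤0 q = *-cancelʳ-≤ (exp-pos (- x)) (≤-resp refl (sym (exp-inverse x))
      (lim-≤ (lim-scale (1# + x) (exp-limit (- x))) (lim-const 1#) 0 λ n _ →
        ≤-resp (*-congʳ (solve 1 (λ x → :1 :- (:- x) := :1 :+ x) refl x)) refl
          (E-geometric≤ (0≤neg x≤0) (by-cert q (solve 1 (λ x → :1 :- (:- x) := :1 :+ x) refl x)) n)))

  exp-mono : ∀ {x y} → x ≤ y → exp x ≤ exp y
  exp-mono {x} {y} p = ≤-resp (*-identityʳ _)
    (trans (sym (exp-+ _ _)) (exp-cong (solve 2 (λ x y → x :+ (y :- x) := y) refl x y)))
    (*-monoˡ-≤ (<⇒≤ (exp-pos x))
      (≤-trans (by-cert (x≤y⇒0≤y-x p) (solve 1 (λ z → (:1 :+ z) :- :1 := z) refl _)) (1+x≤exp (y - x))))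

  exp-cancel-≤ : ∀ {x y} → exp x ≤ exp y → x ≤ y
  exp-cancel-≤ {x} {y} p = ≮⇒≥ λ y<x → <⇒≱ (<-≤-trans
    (by-cert< (0<* (exp-pos y) (x<y⇒0<y-x y<x))
      (solve 2 (λ e z → e :* (:1 :+ z) :- e := e :* z) refl (exp y) (x - y)))
    (≤-resp refl (trans (sym (exp-+ y (x - y))) (exp-cong (solve 2 (λ x y → y :+ (x :- y) := x) refl x y)))
      (*-monoˡ-≤ (<⇒≤ (exp-pos y)) (1+x≤exp (x - y))))) p

  exp-^ : ∀ x n → exp x ^ n ≈ exp (fromℕ n * x)
  exp-^ x ℕ.zero    = sym (trans (exp-cong (zeroˡ x)) exp-0)
  exp-^ x (ℕ.suc n) = trans (*-congˡ (exp-^ x n)) (trans (sym (exp-+ _ _))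
    (exp-cong (solve 2 (λ x n → x :+ n :* x := (:1 :+ n) :* x) refl x (fromℕ n))))

  -- (2n)! ≥ 2ⁿ n! compares the even part of the exponential series with the series of exp (u² / 2).

  cosh≤ : ∀ u → exp u + exp (- u) ≤ fromℕ 2 * exp (u * u * half)
  cosh≤ u = lim-≤ (lim-+ (double (exp-limit u)) (double (exp-limit (- u))))
    (lim-scale (fromℕ 2) (exp-limit v)) 0 λ n _ → bound n
    where
    v = u * u * half
    -- Doubling by recursion rather than `n + n`, so that `E u (dbl (suc n))` unfolds to
    -- `E u (dbl n)` plus one even and one odd term.
    dbl : ℕ → ℕ
    dbl ℕ.zero    = ℕ.zero
    dbl (ℕ.suc n) = ℕ.suc (ℕ.suc (dbl n))
    n≤dbl : ∀ n → n ℕ.≤ dbl n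
    n≤dbl ℕ.zero    = ℕ.z≤n
    n≤dbl (ℕ.suc n) = ℕ.s≤s (ℕ.m≤n⇒m≤1+n (n≤dbl n))
    dbl≈ : ∀ n → fromℕ (dbl n) ≈ fromℕ 2 * fromℕ n
    dbl≈ ℕ.zero    = sym (zeroʳ _)
    dbl≈ (ℕ.suc n) = trans (+-congˡ (+-congˡ (dbl≈ n)))
      (solve 1 (λ n → :1 :+ (:1 :+ :2 :* n) := :2 :* (:1 :+ n)) refl (fromℕ n))
    double : ∀ {a l} → a ⟶ l → (λ n → a (dbl n)) ⟶ l
    double p η 0<η = proj₁ (p η 0<η) , λ n le → proj₂ (p η 0<η) (dbl n) (ℕ.≤-trans le (n≤dbl n))
    odd : ∀ n → term (- u) (dbl n) ≈ term u (dbl n) → term (- u) (ℕ.suc (dbl n)) ≈ - term u (ℕ.suc (dbl n))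
    odd n e = *-cancelʳ-≈ (fromℕ-pos (dbl n)) (trans (term-suc (- u) (dbl n)) (trans (*-congˡ e)
      (trans (solve 2 (λ u t → (:- u) :* t := :- (u :* t)) refl u _) (trans (-‿cong (sym (term-suc u (dbl n))))
        (solve 2 (λ t n → :- (t :* n) := (:- t) :* n) refl _ _)))))
    even : ∀ n → term (- u) (dbl n) ≈ term u (dbl n)
    even ℕ.zero    = trans (term-0 (- u)) (sym (term-0 u))
    even (ℕ.suc n) = *-cancelʳ-≈ (fromℕ-pos (ℕ.suc (dbl n)))
      (trans (term-suc (- u) (ℕ.suc (dbl n))) (trans (*-congˡ (odd n (even n)))
      (trans (solve 2 (λ u t → (:- u) :* (:- t) := u :* t) refl u _) (sym (term-suc u (ℕ.suc (dbl n)))))))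
    0≤v : 0# ≤ v
    0≤v = 0≤* (0≤x² u) (<⇒≤ 0<half)
    even-step : ∀ n → term u (dbl (ℕ.suc n)) * fromℕ (ℕ.suc (dbl n)) * fromℕ (ℕ.suc n) ≈ v * term u (dbl n)
    even-step n = *-cancelʳ-≈ (fromℕ-pos 1) (begin
      T * fromℕ (ℕ.suc (dbl n)) * fromℕ (ℕ.suc n) * fromℕ 2
        ≈⟨ solve 3 (λ t a b → t :* a :* b :* :2 := t :* (:2 :* b) :* a) refl T _ _ ⟩
      T * (fromℕ 2 * fromℕ (ℕ.suc n)) * fromℕ (ℕ.suc (dbl n))
        ≈⟨ *-congʳ (*-congˡ (dbl≈ (ℕ.suc n))) ⟨
      T * fromℕ (dbl (ℕ.suc n)) * fromℕ (ℕ.suc (dbl n))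
        ≈⟨ *-congʳ (term-suc u (ℕ.suc (dbl n))) ⟩
      u * term u (ℕ.suc (dbl n)) * fromℕ (ℕ.suc (dbl n))
        ≈⟨ trans (*-assoc _ _ _) (*-congˡ (term-suc u (dbl n))) ⟩
      u * (u * term u (dbl n))
        ≈⟨ solve 2 (λ u t → u :* (u :* t) := u :* u :* t :* :1) refl u _ ⟩
      u * u * term u (dbl n) * 1#
        ≈⟨ *-congˡ half+half ⟨
      u * u * term u (dbl n) * (half + half)
        ≈⟨ solve 3 (λ u t h → u :* u :* t :* (h :+ h) := u :* u :* h :* t :* :2) refl u _ half ⟩
      v * term u (dbl n) * fromℕ 2 ∎)
      where open ≈R
            T = term u (dbl (ℕ.suc n))
    even-nonNeg : ∀ n → 0# ≤ term u (dbl n)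
    even-nonNeg n = 0≤* (sq n) (0≤⁻¹ (0<n! (dbl n)))
      where
      sq : ∀ n → 0# ≤ u ^ dbl n
      sq ℕ.zero    = 0≤1
      sq (ℕ.suc n) = ≤-resp refl (*-assoc _ _ _) (0≤* (0≤x² u) (sq n))
    even≤ : ∀ n → term u (dbl n) ≤ term v n
    even≤ ℕ.zero    = ≤-reflexive (trans (term-0 u) (sym (term-0 v)))
    -- Dropping the factor `dbl n + 1 ≥ 1` from `even-step` leaves the recurrence satisfied by
    -- `term v`.
    even≤ (ℕ.suc n) = ≤-trans
      (≤-resp (*-identityʳ _) refl
        (*-monoˡ-≤ (even-nonNeg (ℕ.suc n)) (≤-resp fromℕ-1 refl (fromℕ-mono (ℕ.s≤s (ℕ.z≤n {dbl n}))))))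
      (*-cancelʳ-≤ (fromℕ-pos n) (≤-resp (sym (even-step n)) (sym (term-suc v n)) (*-monoˡ-≤ 0≤v (even≤ n))))
    -- The odd terms at `u` and `- u` cancel and each even term is counted twice.
    bound : ∀ n → E u (dbl n) + E (- u) (dbl n) ≤ fromℕ 2 * E v n
    bound ℕ.zero    = ≤-reflexive (solve 0 (:0 :+ :0 := :2 :* :0) refl)
    bound (ℕ.suc n) = ≤-trans (≤-reflexive (+-congˡ (+-cong (+-congˡ (even n)) (odd n (even n)))))
      (by-cert (0≤+ (x≤y⇒0≤y-x (bound n)) (0≤+ (x≤y⇒0≤y-x (even≤ n)) (x≤y⇒0≤y-x (even≤ n))))
        (solve 6 (λ e e′ f t o s → :2 :* (f :+ s) :- (((e :+ t) :+ o) :+ ((e′ :+ t) :+ (:- o)))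
          := (:2 :* f :- (e :+ e′)) :+ ((s :- t) :+ (s :- t))) refl _ _ _ _ _ _))

  -- The supremum s of {y : exp y ≤ x} satisfies exp s ≈ x, since 1 - η ≤ exp (- η)
  -- controls exp near s from both sides.

  exp-surjective : ∀ {x} → 1# ≤ x → ∃ λ y → exp y ≈ x
  exp-surjective {x} 1≤x = s , antisym (≮⇒≥ upper) (≮⇒≥ lower)
    where
    0<x : 0# < x
    0<x = <-≤-trans 0<1 1≤x
    P : R → Set
    P y = exp y ≤ x
    sup = complete P (0# , ≤-trans (≤-reflexive exp-0) 1≤x)
      (x , λ {y} q → ≤-trans (by-cert 0≤1 (solve 1 (λ y → (:1 :+ y) :- y := :1) refl y)) (≤-trans (1+x≤exp y) q))
    s = proj₁ sup
    ub = proj₁ (proj₂ sup)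
    lub = proj₂ (proj₂ sup)

    upper : ¬ x < exp s
    upper x<e = <⇒≱ 0<η (by-cert (x≤y⇒0≤y-x (lub (s - η) λ {y} q → exp-cancel-≤ (≤-trans q x≤)))
        (solve 2 (λ s η → :0 :- η := (s :- η) :- s) refl s η))
      where
      η = (exp s - x) / exp s
      0<η = 0</ (x<y⇒0<y-x x<e) (exp-pos s)
      x≤ : x ≤ exp (s - η)
      x≤ = ≤-resp (begin
          exp s * (1# + - η)       ≈⟨ solve 2 (λ e η → e :* (:1 :- η) := e :- η :* e) refl (exp s) η ⟩
          exp s - η * exp s        ≈⟨ +-congˡ (-‿cong (/*-cancel (exp-pos s))) ⟩
          exp s - (exp s - x)      ≈⟨ solve 2 (λ e x → e :- (e :- x) := x) refl (exp s) x ⟩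
          x                        ∎)
        (sym (exp-+ s (- η))) (*-monoˡ-≤ (<⇒≤ (exp-pos s)) (1+x≤exp (- η)))
        where open ≈R

    lower : ¬ exp s < x
    lower e<x = <⇒≱ 0<η (by-cert (x≤y⇒0≤y-x (ub {s + η} ≤x))
        (solve 2 (λ s η → :0 :- η := s :- (s :+ η)) refl s η))
      where
      η = (x - exp s) / x
      0<η = 0</ (x<y⇒0<y-x e<x) 0<x
      e : x * (1# + - η) ≈ exp s
      e = begin
        x * (1# + - η)       ≈⟨ solve 2 (λ e η → e :* (:1 :- η) := e :- η :* e) refl x η ⟩
        x - η * x            ≈⟨ +-congˡ (-‿cong (/*-cancel 0<x)) ⟩
        x - (x - exp s)      ≈⟨ solve 2 (λ e x → e :- (e :- x) := x) refl x (exp s) ⟩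
        exp s                ∎
        where open ≈R
      ≤x : exp (s + η) ≤ x
      ≤x = *-cancelʳ-≤ (exp-pos (- η)) (≤-trans
        (≤-reflexive (trans (sym (exp-+ (s + η) (- η)))
          (trans (exp-cong (solve 2 (λ s η → (s :+ η) :- η := s) refl s η)) (sym e))))
        (*-monoˡ-≤ (<⇒≤ 0<x) (1+x≤exp (- η))))

  -- For `x ≥ 1` the point 0 witnesses that the set behind the supremum is inhabited; the logarithms
  -- of the algorithm have arguments `A₀ / δ` and `A₁ / δ`, which are in this range.
  exp-ln : ∀ {x} → 1# ≤ x → exp (ln x) ≈ x
  exp-ln p = theℝ-spec (exp-surjective p)

  ln-nonNeg : ∀ {x} → 1# ≤ x → 0# ≤ ln x
  ln-nonNeg p = exp-cancel-≤ (≤-resp (sym exp-0) (sym (exp-ln p)) p)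

  -- Sums over finite types

  sum-mono : ∀ {n} {f g : Fin n → R} → (∀ i → f i ≤ g i) → sum f ≤ sum g
  sum-mono {ℕ.zero}  p = ≤-refl
  sum-mono {ℕ.suc n} p = +-mono₂-≤ (p Fin.zero) (sum-mono (p ∘ Fin.suc))

  sum-cong : ∀ {n} {f g : Fin n → R} → (∀ i → f i ≈ g i) → sum f ≈ sum g
  sum-cong = sum-cong-≋

  sum-nonNeg : ∀ {n} {f : Fin n → R} → (∀ i → 0# ≤ f i) → 0# ≤ sum f
  sum-nonNeg {ℕ.zero}  p = ≤-refl
  sum-nonNeg {ℕ.suc n} p = 0≤+ (p Fin.zero) (sum-nonNeg (p ∘ Fin.suc))

  ≤sum : ∀ {n} {f : Fin n → R} → (∀ i → 0# ≤ f i) → ∀ i → f i ≤ sum f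
  ≤sum {f = f} p Fin.zero    = by-cert (sum-nonNeg (p ∘ Fin.suc))
    (solve 2 (λ a b → (a :+ b) :- a := b) refl (f Fin.zero) (sum (f ∘ Fin.suc)))
  ≤sum {f = f} p (Fin.suc i) = ≤-trans (≤sum (p ∘ Fin.suc) i)
    (by-cert (p Fin.zero) (solve 2 (λ a b → (a :+ b) :- b := a) refl (f Fin.zero) (sum (f ∘ Fin.suc))))

  sum-const : ∀ n c → sum {n} (λ _ → c) ≈ fromℕ n * c
  sum-const ℕ.zero    c = sym (zeroˡ c)
  sum-const (ℕ.suc n) c = trans (+-congˡ (sum-const n c))
    (solve 2 (λ n c → c :+ n :* c := (:1 :+ n) :* c) refl (fromℕ n) c)

  sum-affine : ∀ {n} c e (f : Fin n → R) → sum (λ i → c + e * f i) ≈ fromℕ n * c + e * sum f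
  sum-affine {n} c e f = trans (∑-distrib-+ (λ _ → c) (λ i → e * f i))
    (+-cong (sum-const n c) (sym (*-distribˡ-sum e f)))

  -- Sums over all vectors of draws

  vsum : ∀ {d} N → (Vec (Fin d) N → R) → R
  vsum ℕ.zero    f = f Vec.[]
  vsum (ℕ.suc N) f = sum λ i → vsum N (λ v → f (i Vec.∷ v))

  vsum-cong : ∀ {d} N {f g : Vec (Fin d) N → R} → (∀ v → f v ≈ g v) → vsum N f ≈ vsum N g
  vsum-cong ℕ.zero    e = e Vec.[]
  vsum-cong (ℕ.suc N) e = sum-cong λ i → vsum-cong N λ v → e (i Vec.∷ v)

  vsum-nonNeg : ∀ {d} N {f : Vec (Fin d) N → R} → (∀ v → 0# ≤ f v) → 0# ≤ vsum N f
  vsum-nonNeg ℕ.zero    p = p Vec.[]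
  vsum-nonNeg (ℕ.suc N) p = sum-nonNeg λ i → vsum-nonNeg N λ v → p (i Vec.∷ v)

  ≤vsum : ∀ {d} N {f : Vec (Fin d) N → R} → (∀ v → 0# ≤ f v) → ∀ v → f v ≤ vsum N f
  ≤vsum ℕ.zero    p Vec.[]      = ≤-refl
  ≤vsum (ℕ.suc N) {f} p (i Vec.∷ v) = ≤-trans (≤vsum N {λ v → f (i Vec.∷ v)} (λ v → p (i Vec.∷ v)) v)
    (≤sum {f = λ i → vsum N (λ v → f (i Vec.∷ v))} (λ i → vsum-nonNeg N λ v → p (i Vec.∷ v)) i)

  vsum-*ʳ : ∀ {d} N (f : Vec (Fin d) N → R) c → vsum N (λ v → f v * c) ≈ vsum N f * c
  vsum-*ʳ ℕ.zero    f c = refl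
  vsum-*ʳ (ℕ.suc N) f c = trans (sum-cong λ i → vsum-*ʳ N (λ v → f (i Vec.∷ v)) c)
    (sym (*-distribʳ-sum c (λ i → vsum N (λ v → f (i Vec.∷ v)))))

  sum-vsum-comm : ∀ {d k} N (f : Fin k → Vec (Fin d) N → R) →
                  sum (λ ω → vsum N (f ω)) ≈ vsum N (λ v → sum (λ ω → f ω v))
  sum-vsum-comm ℕ.zero    f = refl
  sum-vsum-comm (ℕ.suc N) f = trans (∑-comm (λ ω i → vsum N (λ v → f ω (i Vec.∷ v))))
    (sum-cong λ i → sum-vsum-comm N (λ ω v → f ω (i Vec.∷ v)))

  vprod : ∀ {d N} → (Fin d → R) → Vec (Fin d) N → R
  vprod g Vec.[]      = 1#
  vprod g (i Vec.∷ v) = g i * vprod g v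

  -- Distributivity; after division by `d ^ N` this is the independence of the draws within one
  -- sample.
  vsum-vprod : ∀ {d} N (g : Fin d → R) → vsum N (vprod g) ≈ sum g ^ N
  vsum-vprod ℕ.zero    g = refl
  vsum-vprod (ℕ.suc N) g = trans
    (sum-cong λ i → trans (vsum-cong N λ v → *-comm (g i) _)
      (trans (vsum-*ʳ N (vprod g) (g i)) (trans (*-comm _ (g i)) (*-congˡ (vsum-vprod N g)))))
    (sym (*-distribʳ-sum (sum g ^ N) g))

  vprod-nonNeg : ∀ {d N} {g : Fin d → R} → (∀ i → 0# ≤ g i) → (v : Vec (Fin d) N) → 0# ≤ vprod g v
  vprod-nonNeg p Vec.[]      = 0≤1
  vprod-nonNeg p (i Vec.∷ v) = 0≤* (p i) (vprod-nonNeg p v)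

  vtotal : ∀ {d N} → (Fin d → R) → Vec (Fin d) N → R
  vtotal y Vec.[]      = 0#
  vtotal y (i Vec.∷ v) = y i + vtotal y v

  vprod-exp : ∀ {d N} (y : Fin d → R) (v : Vec (Fin d) N) → vprod (exp ∘ y) v ≈ exp (vtotal y v)
  vprod-exp y Vec.[]      = sym exp-0
  vprod-exp y (i Vec.∷ v) = trans (*-congˡ (vprod-exp y v)) (sym (exp-+ _ _))

  vtotal-affine : ∀ {d N} (c e : R) (y : Fin d → R) (v : Vec (Fin d) N) →
                  vtotal (λ i → c + e * y i) v ≈ fromℕ N * c + e * vtotal y v
  vtotal-affine c e y Vec.[] = solve 2 (λ c e → :0 := :0 :* c :+ e :* :0) refl c e
  vtotal-affine {N = ℕ.suc N} c e y (i Vec.∷ v) = trans (+-congˡ (vtotal-affine c e y v))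
    (solve 5 (λ c e n y t → (c :+ e :* y) :+ (n :* c :+ e :* t) := (:1 :+ n) :* c :+ e :* (y :+ t)) refl c e
      (fromℕ N) (y i) (vtotal y v))

  vtotal-- : ∀ {d N} (y z : Fin d → R) (v : Vec (Fin d) N) → vtotal (λ i → y i - z i) v ≈ vtotal y v - vtotal z v
  vtotal-- y z Vec.[] = solve 0 (:0 := :0 :- :0) refl
  vtotal-- y z (i Vec.∷ v) = trans (+-congˡ (vtotal-- y z v))
    (solve 4 (λ y z t u → (y :- z) :+ (t :- u) := (y :+ t) :- (z :+ u)) refl (y i) (z i) (vtotal y v)
      (vtotal z v))

  -- Elementary probability

  ite-mono : ∀ {P Q : Set} {x y z : R} → 0# ≤ y → (P → Q) → (P → x ≤ y) → ite P x 0# ≤ ite Q y 0#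
  ite-mono {P} {Q} 0≤y f le with em {P} | em {Q}
  ... | yes p | yes q = le p
  ... | yes p | no ¬q = ⊥-elim (¬q (f p))
  ... | no ¬p | yes q = 0≤y
  ... | no ¬p | no ¬q = ≤-refl

  ite-nonNeg : ∀ {P : Set} {x : R} → 0# ≤ x → 0# ≤ ite P x 0#
  ite-nonNeg {P} p with em {P}
  ... | yes _ = p
  ... | no _  = ≤-refl

  ite-cover : ∀ {P Q T : Set} {x : R} → 0# ≤ x → (P → Q ⊎ T) → ite P x 0# ≤ ite Q x 0# + ite T x 0#
  ite-cover {P} {Q} {T} {x} 0≤x f with em {P} | em {Q} | em {T}
  ... | yes p | yes q | yes t = by-cert 0≤x (solve 1 (λ x → (x :+ x) :- x := x) refl x)
  ... | yes p | yes q | no ¬t = ≤-reflexive (sym (+-identityʳ x))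
  ... | yes p | no ¬q | yes t = ≤-reflexive (sym (+-identityˡ x))
  ... | yes p | no ¬q | no ¬t = ⊥-elim ([ ¬q , ¬t ]′ (f p))
  ... | no _  | yes q | yes t = 0≤+ 0≤x 0≤x
  ... | no _  | yes q | no ¬t = ≤-resp refl (sym (+-identityʳ x)) 0≤x
  ... | no _  | no ¬q | yes t = ≤-resp refl (sym (+-identityˡ x)) 0≤x
  ... | no _  | no ¬q | no ¬t = ≤-reflexive (sym (+-identityˡ 0#))

  module _ (Ω : FiniteProbabilitySpace) where
    open FiniteProbabilitySpace Ω

    Pr-mono : ∀ {E F : Outcome → Set} → (∀ ω → E ω → F ω) → Pr E ≤ Pr F
    Pr-mono f = sum-mono λ ω → ite-mono {z = 0#} (nonNeg ω) (f ω) λ _ → ≤-refl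

    Pr-∪ : ∀ {E F G : Outcome → Set} → (∀ ω → E ω → F ω ⊎ G ω) → Pr E ≤ Pr F + Pr G
    Pr-∪ {E} {F} {G} f = ≤-trans (sum-mono λ ω → ite-cover (nonNeg ω) (f ω))
      (≤-reflexive (∑-distrib-+ (λ ω → ite (F ω) (weight ω) 0#) (λ ω → ite (G ω) (weight ω) 0#)))

    Pr-∅ : ∀ {E : Outcome → Set} → (∀ ω → ¬ E ω) → Pr E ≤ 0#
    Pr-∅ {E} f = ≤-trans (sum-mono {f = λ ω → ite (E ω) (weight ω) 0#} {λ _ → 0#} λ ω → ≤-reflexive
      (reflexive (ite-no (f ω)))) (≤-reflexive (trans (sum-const size 0#) (zeroʳ _)))

    Pr-complement : ∀ {E F : Outcome → Set} → (∀ ω → ¬ E ω → F ω) → 1# - Pr E ≤ Pr F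
    Pr-complement {E} {F} f = by-cert (x≤y⇒0≤y-x (≤-trans
        (≤-reflexive (trans (sym total-1)
          (sum-cong {size} {weight} {λ ω → ite ⊤ (weight ω) 0#} λ ω → reflexive (≡.sym (ite-yes {P = ⊤} tt)))))
        (Pr-∪ {λ _ → ⊤} {E} {F} λ ω _ → [ inj₁ , (λ ¬e → inj₂ (f ω ¬e)) ]′ (toSum em))))
      (solve 2 (λ e f → f :- (:1 :- e) := (e :+ f) :- :1) refl (Pr E) (Pr F))

    Pr-Any : ∀ {A : Set} {B : A → Outcome → Set} {c} (xs : List A) → All (λ x → Pr (B x) ≤ c) xs →
             Pr (λ ω → Any (λ x → B x ω) xs) ≤ fromℕ (length xs) * c
    Pr-Any {c = c} [] [] = ≤-resp refl (sym (zeroˡ c)) (Pr-∅ λ _ ())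
    Pr-Any {B = B} {c = c} (x ∷ xs) (p ∷ ps) = ≤-trans
      (Pr-∪ {F = B x} {λ ω → Any (λ x → B x ω) xs} λ { ω (here b) → inj₁ b ; ω (there b) → inj₂ b })
      (≤-trans (+-mono₂-≤ p (Pr-Any xs ps))
        (≤-reflexive (solve 2 (λ c n → c :+ n :* c := (:1 :+ n) :* c) refl c (fromℕ (length xs)))))

    Pr-∃< : ∀ {B : ℕ → Outcome → Set} {c : ℕ → R} n → (∀ i → i ℕ.< n → Pr (B i) ≤ c i) →
            Pr (λ ω → ∃ λ i → i ℕ.< n × B i ω) ≤ Σ< n c
    Pr-∃< ℕ.zero    p = Pr-∅ λ { _ (_ , () , _) }
    Pr-∃< {B} {c} (ℕ.suc n) p = ≤-trans
      (Pr-∪ {F = λ ω → ∃ λ i → i ℕ.< n × B i ω} {B n} λ { ω (i , i≤n , b) →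
         [ (λ i<n → inj₁ (i , i<n , b)) , (λ { ≡.refl → inj₂ b }) ]′ (ℕ.m≤n⇒m<n∨m≡n (ℕ.≤-pred i≤n)) })
      (+-mono₂-≤ (Pr-∃< n λ i i<n → p i (ℕ.m<n⇒m<1+n i<n)) (p n ℕ.≤-refl))

    module _ {d N : ℕ} (1≤d : 1 ℕ.≤ d) (Z : Outcome → Vec (Fin d) N)
             (uniform : ∀ v → Pr (λ ω → Z ω ≡ v) ≈ 1# / fromℕ d ^ N) where

      -- Markov's inequality for a product with one factor per draw: under the uniform law the
      -- expectation of `vprod g` is the `N`-th power of the mean of `g`.
      markov : ∀ {B : Vec (Fin d) N → Set} (g : Fin d → R) {q} → (∀ i → 0# ≤ g i) → 0# ≤ q →
               sum g ≤ fromℕ d * q → (∀ v → B v → 1# ≤ vprod g v) → Pr (λ ω → B (Z ω)) ≤ q ^ N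
      markov {B} g {q} 0≤g 0≤q sum≤ B⇒ = ≤-trans (sum-mono pointwise) (≤-trans (≤-reflexive weighted) final)
        where
        0<d^N : 0# < fromℕ d ^ N
        0<d^N = ^-pos N (0<fromℕ 1≤d)
        -- The mass of the pair `(ω , v)`, weighted by the product; it vanishes unless `v` is `Z ω`.
        -- Summing over `ω` first brings in `uniform`, the only information about `Z`, and the sum
        -- over `v` then factorises.
        f : Outcome → Vec (Fin d) N → R
        f ω v = vprod g v * ite (Z ω ≡ v) (weight ω) 0#
        f-nonNeg : ∀ ω v → 0# ≤ f ω v
        f-nonNeg ω v = 0≤* (vprod-nonNeg 0≤g v) (ite-nonNeg (nonNeg ω))
        pointwise : ∀ ω → ite (B (Z ω)) (weight ω) 0# ≤ vsum N (f ω)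
        pointwise ω = ≤-trans (atZ (em {B (Z ω)})) (≤vsum N (f-nonNeg ω) (Z ω))
          where
          atZ : Dec (B (Z ω)) → ite (B (Z ω)) (weight ω) 0# ≤ f ω (Z ω)
          atZ (yes b) = ≤-resp (trans (*-identityˡ _) (reflexive (≡.sym (ite-yes b))))
            (*-congˡ (reflexive (≡.sym (ite-yes ≡.refl))))
                          (*-monoʳ-≤ (nonNeg ω) (B⇒ (Z ω) b))
          atZ (no ¬b) = ≤-trans (≤-reflexive (reflexive (ite-no ¬b))) (f-nonNeg ω (Z ω))
        weighted : sum (λ ω → vsum N (f ω)) ≈ sum g ^ N * (1# / fromℕ d ^ N)
        weighted = trans (sum-vsum-comm N f) (trans
          (vsum-cong N λ v → trans (sym (*-distribˡ-sum (vprod g v) (λ ω → ite (Z ω ≡ v) (weight ω) 0#)))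
            (*-congˡ (uniform v)))
          (trans (vsum-*ʳ N (vprod g) _) (*-congʳ (vsum-vprod N g))))
        final : sum g ^ N * (1# / fromℕ d ^ N) ≤ q ^ N
        final = ≤-trans (≤-reflexive
          (solve 2 (λ s i → s :* (:1 :* i) := s :* i) refl (sum g ^ N) ((fromℕ d ^ N) ⁻¹)))
          (/-≤ 0<d^N (≤-trans (^-monoˡ-≤ N (sum-nonNeg 0≤g) sum≤)
            (≤-reflexive (trans (^-distrib-* _ _ N) (*-comm _ _)))))

  -- Exponential moments

  1≤exp : ∀ {x} → 0# ≤ x → 1# ≤ exp x
  1≤exp p = ≤-resp exp-0 refl (exp-mono p)

  exp-swap : ∀ {x y z} → x + y ≈ z → exp x * exp y ≈ exp z
  exp-swap e = trans (sym (exp-+ _ _)) (exp-cong e)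

  drop-null : ∀ {s z} t → z ≈ 0# → s + z * t ≈ s
  drop-null t e = trans (+-congˡ (trans (*-congʳ e) (zeroˡ t))) (+-identityʳ _)

  x*half+x*half : ∀ x → x * half + x * half ≈ x
  x*half+x*half x = trans (sym (distribˡ x half half)) (trans (*-congˡ half+half) (*-identityʳ x))

  -- Hoeffding's bound with exponent a² instead of 2 a².  With A± the exponential
  -- moments of ±2a (X - p) for a Bernoulli variable X of mean p, Jensen's inequality
  -- gives 1 ≤ A₋, hence A₊ ≤ A₊ A₋ ≤ cosh² a ≤ exp (a²).

  bernoulli-moment : ∀ {p} → 0# ≤ p → p ≤ 1# → ∀ a →
                     exp (- ((a + a) * p)) * ((1# - p) + p * exp (a + a)) ≤ exp (a * a)
  bernoulli-moment {p} 0≤p p≤1 a = begin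
      c′ * m          ≤⟨ ≤-resp (*-identityʳ _) refl (*-monoˡ-≤ A₊≥0 1≤A₋) ⟩
      (c′ * m) * A₋   ≈⟨ A₊A₋ ⟩
      m * m′          ≤⟨ ≤cosh² ⟩
      k * k           ≤⟨ *-mono₂-≤ 0≤k (<⇒≤ (exp-pos _)) k≤ k≤ ⟩
      exp (a * a * half) * exp (a * a * half)  ≈⟨ exp-swap (x*half+x*half (a * a)) ⟩
      exp (a * a)     ∎
    where
    open ≤R
    b b′ c c′ m m′ k A₋ : R
    b  = exp a
    b′ = exp (- a)
    c  = exp ((a + a) * p)
    c′ = exp (- ((a + a) * p))
    m  = (1# - p) + p * exp (a + a)
    m′ = (1# - p) + p * exp (- (a + a))
    k  = half * (b + b′)
    A₋ = (1# - p) * c + p * exp ((a + a) * p - (a + a))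
    bb′ : b * b′ ≈ 1#
    bb′ = exp-inverse a
    A₊≥0 : 0# ≤ c′ * m
    A₊≥0 = 0≤* (<⇒≤ (exp-pos _)) (0≤+ (x≤y⇒0≤y-x p≤1) (0≤* 0≤p (<⇒≤ (exp-pos _))))
    1≤A₋ : 1# ≤ A₋
    1≤A₋ = by-cert (0≤+ (0≤* (x≤y⇒0≤y-x p≤1) (x≤y⇒0≤y-x (1+x≤exp ((a + a) * p))))
                        (0≤* 0≤p (x≤y⇒0≤y-x (1+x≤exp ((a + a) * p - (a + a))))))
      (solve 4 (λ a p e f → ((:1 :- p) :* e :+ p :* f) :- :1
          := (:1 :- p) :* (e :- (:1 :+ (a :+ a) :* p)) :+ p :* (f :- (:1 :+ ((a :+ a) :* p :- (a :+ a)))))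
        refl a p c (exp ((a + a) * p - (a + a))))
    A₊A₋ : (c′ * m) * A₋ ≈ m * m′
    A₊A₋ = trans (*-congˡ (+-congˡ (*-congˡ (exp-+ ((a + a) * p) (- (a + a))))))
      (trans (solve 5 (λ c c′ m p f → (c′ :* m) :* ((:1 :- p) :* c :+ p :* (c :* f)) := (c :* c′) :*
        (m :* ((:1 :- p) :+ p :* f)))
               refl c c′ m p (exp (- (a + a))))
      (trans (*-congʳ (exp-inverse ((a + a) * p))) (*-identityˡ _)))
    -- The difference is `(1 - 2p)² (b - b′)² / 4` modulo the relations `b b′ = 1` and
    -- `half + half = 1`; the solver identity carries their multiples along and `drop-null` removes
    -- them.
    ≤cosh² : m * m′ ≤ k * k
    ≤cosh² = by-cert (0≤* (0≤x² half) (0≤* (0≤x² (1# - (p + p))) (0≤x² (b - b′))))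
      (trans (+-congˡ (-‿cong mm′))
      (trans (solve 4 (λ h p b b′ →
          (h :* (b :+ b′)) :* (h :* (b :+ b′)) :- ((:1 :- p) :+ p :* (b :* b)) :* ((:1 :- p) :+ p :* (b′ :* b′))
          := ((h :* h) :* (((:1 :- (p :+ p)) :* (:1 :- (p :+ p))) :* ((b :- b′) :* (b :- b′)))
             :+ (b :* b′ :- :1) :* (h :* h :* (:4 :- :8 :* p :- :4 :* (p :* p) :* (b :* b′ :- :1))))
             :+ ((h :+ h) :- :1) :* (((h :+ h) :+ :1) :* ((:1 :- p) :+ p :* (b :* b)) :*
               ((:1 :- p) :+ p :* (b′ :* b′))))
          refl half p b b′)
      (trans (drop-null _ (trans (+-congʳ half+half) (-‿inverseʳ 1#)))
             (drop-null _ (trans (+-congʳ bb′) (-‿inverseʳ 1#))))))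
      where
      mm′ : m * m′ ≈ ((1# - p) + p * (b * b)) * ((1# - p) + p * (b′ * b′))
      mm′ = *-cong (+-congˡ (*-congˡ (exp-+ a a)))
                   (+-congˡ (*-congˡ (trans (exp-cong
                     (solve 1 (λ a → :- (a :+ a) := (:- a) :+ (:- a)) refl a)) (exp-+ (- a) (- a)))))
    0≤k : 0# ≤ k
    0≤k = 0≤* (<⇒≤ 0<half) (0≤+ (<⇒≤ (exp-pos a)) (<⇒≤ (exp-pos (- a))))
    k≤ : k ≤ exp (a * a * half)
    k≤ = ≤-resp refl (trans (sym (*-assoc half _ _)) (trans (*-congʳ (x⁻¹*x≈1 (fromℕ-pos 1))) (*-identityˡ _)))
           (*-monoˡ-≤ (<⇒≤ 0<half) (cosh≤ a))

  Binary : ∀ {d} → (Fin d → R) → Set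
  Binary h = ∀ i → h i ≈ 0# ⊎ h i ≈ 1#

  -- On the values 0 and 1 every function agrees with an affine one, so that summation leaves only
  -- the mean of `h`.
  exp-affine : ∀ {d} {h : Fin d → R} → Binary h → ∀ c e i →
               exp (c + e * h i) ≈ exp c + (exp c * (exp e - 1#)) * h i
  exp-affine {h = h} bin c e i = [ zero-case , one-case ]′ (bin i)
    where
    zero-case : h i ≈ 0# → exp (c + e * h i) ≈ exp c + (exp c * (exp e - 1#)) * h i
    zero-case p = trans (exp-cong (trans (+-congˡ (*-congˡ p)) (solve 2 (λ c e → c :+ e :* :0 := c) refl c e)))
      (trans (solve 2 (λ c e → c := c :+ (c :* (e :- :1)) :* :0) refl (exp c) (exp e))
        (+-congˡ (*-congˡ (sym p))))
    one-case : h i ≈ 1# → exp (c + e * h i) ≈ exp c + (exp c * (exp e - 1#)) * h i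
    one-case p = trans (exp-cong (trans (+-congˡ (*-congˡ p)) (+-congˡ (*-identityʳ e))))
      (trans (exp-+ c e) (trans (solve 2 (λ c e → c :* e := c :+ (c :* (e :- :1)) :* :1) refl (exp c)
        (exp e)) (+-congˡ (*-congˡ (sym p)))))

  -- Chernoff's method with parameter `2a`: the centred moment costs a factor `exp (a²)`, and the
  -- threshold `p + a` saves `exp (2 a²)`.
  binary-moment : ∀ {d} {h : Fin d → R} {p} → Binary h → sum h ≈ fromℕ d * p → 0# ≤ p → p ≤ 1# → ∀ a →
                  sum (λ i → exp (- ((a + a) * (p + a)) + (a + a) * h i)) ≤ fromℕ d * exp (- (a * a))
  binary-moment {d} {h} {p} bin mean 0≤p p≤1 a = ≤-trans (≤-reflexive (begin
      sum (λ i → exp (- ((a + a) * (p + a)) + (a + a) * h i))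
        ≈⟨ sum-cong (exp-affine bin (- ((a + a) * (p + a))) (a + a)) ⟩
      sum (λ i → C + (C * (B - 1#)) * h i)
        ≈⟨ sum-affine C (C * (B - 1#)) h ⟩
      fromℕ d * C + (C * (B - 1#)) * sum h
        ≈⟨ +-congˡ (*-congˡ mean) ⟩
      fromℕ d * C + (C * (B - 1#)) * (fromℕ d * p)
        ≈⟨ solve 4 (λ d c b p → d :* c :+ (c :* (b :- :1)) :* (d :* p) := d :*
          (c :* ((:1 :- p) :+ p :* b))) refl (fromℕ d) C B p ⟩
      fromℕ d * (C * M)
        ≈⟨ *-congˡ (*-congʳ (exp-swap
          (solve 2 (λ a p → :- ((a :+ a) :* p) :+ :- (a :* a :+ a :* a) := :-
            ((a :+ a) :* (p :+ a))) refl a p))) ⟨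
      fromℕ d * ((exp (- ((a + a) * p)) * exp (- (a * a + a * a))) * M)
        ≈⟨ *-congˡ (solve 3 (λ u v m → (u :* v) :* m := (u :* m) :* v) refl (exp (- ((a + a) * p)))
          (exp (- (a * a + a * a))) M) ⟩
      fromℕ d * ((exp (- ((a + a) * p)) * M) * exp (- (a * a + a * a))) ∎))
    (*-monoˡ-≤ (fromℕ-nonNeg d) (≤-trans (*-monoʳ-≤ (<⇒≤ (exp-pos _)) (bernoulli-moment 0≤p p≤1 a))
      (≤-reflexive (exp-swap (solve 1 (λ s → s :+ :- (s :+ s) := :- s) refl (a * a))))))
    where
    open ≈R
    C B M : R
    C = exp (- ((a + a) * (p + a)))
    B = exp (a + a)
    M = (1# - p) + p * B

  -- For Z = Y - X with mean at most - ε the moment E exp (l Z) is at most (1 - ε) exp l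
  -- when exp (2 l) = (1 + ε) / (1 - ε), and its square is 1 - ε².

  tilt : ∀ {ε} → 0# < ε → ε < 1# → ∃ λ l → 0# ≤ l × (1# - ε) * (exp l * exp l) ≈ 1# + ε
  tilt {ε} 0<ε ε<1 = l , 0≤* (ln-nonNeg 1≤ρ) (<⇒≤ 0<half) ,
    trans (*-congˡ (trans (exp-swap (x*half+x*half (ln ρ))) (exp-ln 1≤ρ)))
      (trans (*-comm _ _) (/*-cancel 0<1-ε))
    where
    0<1-ε = x<y⇒0<y-x ε<1
    ρ = (1# + ε) / (1# - ε)
    1≤ρ : 1# ≤ ρ
    1≤ρ = ≤-/ 0<1-ε (by-cert (0≤+ (<⇒≤ 0<ε) (<⇒≤ 0<ε))
      (solve 1 (λ ε → (:1 :+ ε) :- :1 :* (:1 :- ε) := ε :+ ε) refl ε))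
    l = ln ρ * half

  difference-moment : ∀ {d} {g h : Fin d → R} {p q ε l} → Binary g → Binary h →
                      sum g ≈ fromℕ d * p → sum h ≈ fromℕ d * q → q + ε ≤ p → 0# < ε → ε < 1# →
                      0# ≤ l → (1# - ε) * (exp l * exp l) ≈ 1# + ε →
                      sum (λ i → exp (l * (h i - g i))) ≤ fromℕ d * exp (- (ε * ε * half))
  difference-moment {d} {g} {h} {p} {q} {ε} {l} bin-g bin-h mean-g mean-h gap 0<ε ε<1 0≤l tilted =
    ≤-trans (sum-mono convex) (≤-trans (≤-reflexive affine) (*-monoˡ-≤ (fromℕ-nonNeg d) (≤-trans M≤ last)))
    where
    open ≈R
    -- `s` and `t` are the hyperbolic cosine and sine of `l`. The line `s + t z` meets `exp (l z)`
    -- at `z = 1` and `z = -1` and lies above it at `z = 0`, so only the means of `g` and `h` enter,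
    -- however the two are correlated.
    β β′ s t : R
    β  = exp l
    β′ = exp (- l)
    s  = half * (β + β′)
    t  = half * (β - β′)
    ββ′ : β * β′ ≈ 1#
    ββ′ = exp-inverse l
    s+t : s + t ≈ β
    s+t = trans (solve 3 (λ h b b′ → h :* (b :+ b′) :+ h :* (b :- b′) := (h :+ h) :* b) refl half β β′)
      (trans (*-congʳ half+half) (*-identityˡ β))
    s-t : s - t ≈ β′
    s-t = trans (solve 3 (λ h b b′ → h :* (b :+ b′) :- h :* (b :- b′) := (h :+ h) :* b′) refl half β β′)
      (trans (*-congʳ half+half) (*-identityˡ β′))
    1≤s : 1# ≤ s
    1≤s = by-cert (0≤* (<⇒≤ 0<half) (0≤+ (x≤y⇒0≤y-x (1+x≤exp l)) (x≤y⇒0≤y-x (1+x≤exp (- l)))))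
      (trans (+-congˡ (-‿cong (sym half+half)))
        (solve 4 (λ h b b′ l → h :* (b :+ b′) :- (h :+ h) := h :*
          ((b :- (:1 :+ l)) :+ (b′ :- (:1 :- l)))) refl half β β′ l))
    at : ∀ {u v z} i → h i ≈ u → g i ≈ v → u - v ≈ z → exp (l * z) ≤ s + t * z → exp
      (l * (h i - g i)) ≤ s + t * (h i - g i)
    at i e f e′ = ≤-resp (exp-cong (*-congˡ (sym eq))) (+-congˡ (*-congˡ (sym eq)))
      where eq = trans (+-cong e (-‿cong f)) e′
    convex0 : exp (l * 0#) ≤ s + t * 0#
    convex0 = ≤-resp (sym (trans (exp-cong (zeroʳ l)) exp-0)) (solve 2 (λ s t → s := s :+ t :* :0) refl s t) 1≤s
    convex1 : exp (l * 1#) ≤ s + t * 1#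
    convex1 = ≤-reflexive (trans (exp-cong (*-identityʳ l)) (trans (sym s+t) (+-congˡ (sym (*-identityʳ t)))))
    convex-1 : exp (l * - 1#) ≤ s + t * - 1#
    convex-1 = ≤-reflexive (trans (exp-cong (solve 1 (λ l → l :* (:- :1) := :- l) refl l))
      (trans (sym s-t) (solve 2 (λ s t → s :- t := s :+ t :* (:- :1)) refl s t)))
    convex : ∀ i → exp (l * (h i - g i)) ≤ s + t * (h i - g i)
    convex i = [ (λ h0 → [ (λ g0 → at i h0 g0 (-‿inverseʳ 0#) convex0) ,
      (λ g1 → at i h0 g1 (+-identityˡ _) convex-1) ]′ (bin-g i))
               , (λ h1 → [ (λ g0 → at i h1 g0 (solve 0 (:1 :- :0 := :1) refl) convex1) ,
                 (λ g1 → at i h1 g1 (-‿inverseʳ 1#) convex0) ]′ (bin-g i)) ]′ (bin-h i)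
    M : R
    M = s + t * (q - p)
    affine : sum (λ i → s + t * (h i - g i)) ≈ fromℕ d * M
    affine = begin
      sum (λ i → s + t * (h i - g i))                 ≈⟨ sum-affine s t (λ i → h i - g i) ⟩
      fromℕ d * s + t * sum (λ i → h i - g i)         ≈⟨ +-congˡ (*-congˡ diff) ⟩
      fromℕ d * s + t * (fromℕ d * q - fromℕ d * p)   ≈⟨ solve 5
        (λ d s t q p → d :* s :+ t :* (d :* q :- d :* p) := d :* (s :+ t :* (q :- p))) refl (fromℕ d) s t q p ⟩
      fromℕ d * M                                     ∎
      where
      diff : sum (λ i → h i - g i) ≈ fromℕ d * q - fromℕ d * p
      diff = begin
        sum (λ i → h i - g i)           ≈⟨ sum-cong
          (λ i → solve 2 (λ h g → h :- g := h :+ (:- :1) :* g) refl (h i) (g i)) ⟩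
        sum (λ i → h i + - 1# * g i)    ≈⟨ ∑-distrib-+ h (λ i → - 1# * g i) ⟩
        sum h + sum (λ i → - 1# * g i)  ≈⟨ +-congˡ (*-distribˡ-sum (- 1#) g) ⟨
        sum h + - 1# * sum g            ≈⟨ +-cong mean-h (*-congˡ mean-g) ⟩
        fromℕ d * q + - 1# * (fromℕ d * p) ≈⟨ solve 3
          (λ d q p → d :* q :+ (:- :1) :* (d :* p) := d :* q :- d :* p) refl (fromℕ d) q p ⟩
        fromℕ d * q - fromℕ d * p       ∎
    0≤t : 0# ≤ t
    0≤t = 0≤* (<⇒≤ 0<half) (x≤y⇒0≤y-x (exp-mono (≤-trans (neg≤0 0≤l) 0≤l)))
    -- The choice of `l` makes the two exponentials in `s - t ε` contribute equally: `(1 + ε) β′`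
    -- equals `(1 - ε) β`.
    M≤ : M ≤ (1# - ε) * β
    M≤ = ≤-trans (by-cert (0≤* 0≤t (x≤y⇒0≤y-x gap))
           (solve 5 (λ s t p q ε → (s :- t :* ε) :- (s :+ t :* (q :- p)) := t :*
             (p :- (q :+ ε))) refl s t p q ε))
      (≤-reflexive (begin
        s - t * ε
          ≈⟨ solve 4 (λ h b b′ ε → h :* (b :+ b′) :- h :* (b :- b′) :* ε := h :* (:1 :- ε) :* b :+ h :*
            ((:1 :+ ε) :* b′)) refl half β β′ ε ⟩
        half * (1# - ε) * β + half * ((1# + ε) * β′)
          ≈⟨ +-congˡ (*-congˡ (*-congʳ tilted)) ⟨
        half * (1# - ε) * β + half * ((1# - ε) * (β * β) * β′)
          ≈⟨ solve 4 (λ h b b′ ε → h :* (:1 :- ε) :* b :+ h :* ((:1 :- ε) :* (b :* b) :* b′) := h :*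
            (:1 :- ε) :* b :+ h :* (:1 :- ε) :* b :* (b :* b′)) refl half β β′ ε ⟩
        half * (1# - ε) * β + half * (1# - ε) * β * (β * β′)
          ≈⟨ +-congˡ (trans (*-congˡ ββ′) (*-identityʳ _)) ⟩
        half * (1# - ε) * β + half * (1# - ε) * β
          ≈⟨ solve 3 (λ h b ε → h :* (:1 :- ε) :* b :+ h :* (:1 :- ε) :* b := (h :+ h) :*
            ((:1 :- ε) :* b)) refl half β ε ⟩
        (half + half) * ((1# - ε) * β)
          ≈⟨ trans (*-congʳ half+half) (*-identityˡ _) ⟩
        (1# - ε) * β ∎))
    last : (1# - ε) * β ≤ exp (- (ε * ε * half))
    last = sq-cancel-≤ (<⇒≤ (exp-pos _)) (≤-trans (≤-reflexive (begin
        ((1# - ε) * β) * ((1# - ε) * β)   ≈⟨ solve 2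
          (λ e b → ((:1 :- e) :* b) :* ((:1 :- e) :* b) := (:1 :- e) :* ((:1 :- e) :* (b :* b))) refl ε β ⟩
        (1# - ε) * ((1# - ε) * (β * β))   ≈⟨ *-congˡ tilted ⟩
        (1# - ε) * (1# + ε)               ≈⟨ solve 1
          (λ e → (:1 :- e) :* (:1 :+ e) := :1 :+ (:- (e :* e))) refl ε ⟩
        1# + - (ε * ε)                    ∎))
      (≤-trans (1+x≤exp _) (≤-reflexive
        (sym (exp-swap (trans (solve 1 (λ x → (:- x) :+ (:- x) := :- (x :+ x)) refl (ε * ε * half))
          (-‿cong (x*half+x*half (ε * ε)))))))))

  -- Frequencies as averages of indicators

  indicator : ∀ {n} → Itemset n → Transaction n → R
  indicator x T = if does (x ⊆? T) then 1# else 0#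

  indicator-cases : ∀ {n} (x : Itemset n) T → indicator x T ≈ 0# ⊎ indicator x T ≈ 1#
  indicator-cases x T = cases (does (x ⊆? T))
    where
    cases : ∀ b → (if b then 1# else 0#) ≈ 0# ⊎ (if b then 1# else 0#) ≈ 1#
    cases false = inj₁ refl
    cases true  = inj₂ refl

  fromℕ-step : ∀ b k → fromℕ ((if b then ℕ.suc else id) $ k) ≈ (if b then 1# else 0#) + fromℕ k
  fromℕ-step true  k = refl
  fromℕ-step false k = sym (+-identityˡ _)

  module _ {n d : ℕ} (D : Dataset n d) (x : Itemset n) where

    contains : Fin d → R
    contains i = indicator x (Vec.lookup D i)

    contains-binary : Binary contains
    contains-binary i = indicator-cases x (Vec.lookup D i)

    count-sample : ∀ {N} (v : Vec (Fin d) N) → fromℕ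
      (Vec.count (x ⊆?_) (Vec.map (Vec.lookup D) v)) ≈ vtotal contains v
    count-sample Vec.[]      = refl
    count-sample (i Vec.∷ v) = trans (fromℕ-step (does (x ⊆? Vec.lookup D i)) _) (+-congˡ (count-sample v))

  count-all : ∀ {n d} (D : Dataset n d) x → fromℕ (Vec.count (x ⊆?_) D) ≈ sum (contains D x)
  count-all Vec.[]      x = refl
  count-all (T Vec.∷ D) x = trans (fromℕ-step (does (x ⊆? T)) _) (+-congˡ (count-all D x))

  count≤ : ∀ {n d} (D : Dataset n d) x → Vec.count (x ⊆?_) D ℕ.≤ d
  count≤ Vec.[]      x = ℕ.z≤n
  count≤ (T Vec.∷ D) x = step (does (x ⊆? T)) (count≤ D x)
    where
    step : ∀ b {k m} → k ℕ.≤ m → ((if b then ℕ.suc else id) $ k) ℕ.≤ ℕ.suc m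
    step true  p = ℕ.s≤s p
    step false p = ℕ.m≤n⇒m≤1+n p

  freq-* : ∀ {n d} (D : Dataset n d) x → 1 ℕ.≤ d → freq D x * fromℕ d ≈ fromℕ (Vec.count (x ⊆?_) D)
  freq-* D x 1≤d = /*-cancel (0<fromℕ 1≤d)

  freq-bounds : ∀ {n d} (D : Dataset n d) x → 0# ≤ freq D x × freq D x ≤ 1#
  -- The frequency in an empty dataset is `0# * 0# ⁻¹`, which is 0 whatever value the inverse takes
  -- at 0.
  freq-bounds Vec.[] x = ≤-reflexive (sym (zeroˡ _)) , ≤-trans (≤-reflexive (zeroˡ _)) 0≤1
  freq-bounds {d = ℕ.suc d} D@(_ Vec.∷ _) x = 0≤/ (fromℕ-nonNeg (Vec.count (x ⊆?_) D)) (fromℕ-pos d) ,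
    /-≤ (fromℕ-pos d) (≤-resp refl (sym (*-identityˡ _)) (fromℕ-mono (count≤ D x)))

  -- Tail bounds for uniform samples

  module Tails (Ω : FiniteProbabilitySpace) {n d N : ℕ} (D : Dataset n d) (1≤d : 1 ℕ.≤ d) (1≤N : 1 ℕ.≤ N)
               (Z : FiniteProbabilitySpace.Outcome Ω → Vec (Fin d) N)
               (uniform : ∀ v → FiniteProbabilitySpace.Pr Ω (λ ω → Z ω ≡ v) ≈ 1# / fromℕ d ^ N) where
    open FiniteProbabilitySpace Ω

    S : Vec (Fin d) N → Dataset n N
    S = Vec.map (Vec.lookup D)

    binary-tail : ∀ {B : Vec (Fin d) N → Set} {h : Fin d → R} {p a} → Binary h → sum h ≈ fromℕ d * p →
                  0# ≤ p → p ≤ 1# → 0# ≤ a → (∀ v → B v → fromℕ N * (p + a) ≤ vtotal h v) →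
                  Pr (λ ω → B (Z ω)) ≤ exp (- (a * a)) ^ N
    binary-tail {B} {h} {p} {a} bin mean 0≤p p≤1 0≤a B⇒ = markov Ω 1≤d Z uniform {B} (exp ∘ y)
      (λ i → <⇒≤ (exp-pos _)) (<⇒≤ (exp-pos _)) (binary-moment bin mean 0≤p p≤1 a)
      λ v b → ≤-resp refl (sym (vprod-exp y v))
        (1≤exp (≤-resp refl (sym (trans (vtotal-affine (- ((a + a) * (p + a))) (a + a) h v)
        (solve 4 (λ n a p t → n :* (:- ((a :+ a) :* (p :+ a))) :+ (a :+ a) :* t := (a :+ a) :*
          (t :- n :* (p :+ a))) refl (fromℕ N) a p (vtotal h v))))
        (0≤* (0≤+ 0≤a 0≤a) (x≤y⇒0≤y-x (B⇒ v b)))))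
      where
      y : Fin d → R
      y i = - ((a + a) * (p + a)) + (a + a) * h i

    mean : ∀ x → sum (contains D x) ≈ fromℕ d * freq D x
    mean x = trans (sym (count-all D x)) (trans (sym (freq-* D x 1≤d)) (*-comm _ _))

    sample-total : ∀ x v → vtotal (contains D x) v ≈ fromℕ N * freq (S v) x
    sample-total x v = trans (sym (count-sample D x v)) (trans (sym (freq-* (S v) x 1≤N)) (*-comm _ _))

    upper-tail : ∀ x {a} → 0# ≤ a → Pr (λ ω → a ≤ freq (S (Z ω)) x - freq D x) ≤ exp (- (a * a)) ^ N
    upper-tail x {a} 0≤a = binary-tail {B = λ v → a ≤ freq (S v) x - freq D x} (contains-binary D x) (mean x)
      (proj₁ (freq-bounds D x)) (proj₂ (freq-bounds D x)) 0≤a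
      λ v b → ≤-resp refl (sym (sample-total x v)) (*-monoˡ-≤ (fromℕ-nonNeg N)
        (by-cert (x≤y⇒0≤y-x b) (solve 3 (λ f p a → f :- (p :+ a) := (f :- p) :- a) refl (freq (S v) x)
          (freq D x) a)))

    -- The upper bound applied to the complementary indicator, whose mean is `1 - freq D x`.
    lower-tail : ∀ x {a} → 0# ≤ a → Pr (λ ω → a ≤ freq D x - freq (S (Z ω)) x) ≤ exp (- (a * a)) ^ N
    lower-tail x {a} 0≤a = binary-tail {B = λ v → a ≤ freq D x - freq (S v) x} {h} {1# - freq D x}
      (λ i → [ (λ e → inj₂ (trans (+-congˡ (*-congˡ e)) (solve 0 (:1 :+ (:- :1) :* :0 := :1) refl)))
             , (λ e → inj₁ (trans (+-congˡ (*-congˡ e)) (solve 0 (:1 :+ (:- :1) :* :1 := :0) refl))) ]′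
               (contains-binary D x i))
      (trans (sum-affine 1# (- 1#) (contains D x)) (trans (+-congˡ (*-congˡ (mean x)))
        (solve 2 (λ d p → d :* :1 :+ (:- :1) :* (d :* p) := d :* (:1 :- p)) refl (fromℕ d) (freq D x))))
      (x≤y⇒0≤y-x (proj₂ (freq-bounds D x)))
      (by-cert (proj₁ (freq-bounds D x)) (solve 1 (λ p → :1 :- (:1 :- p) := p) refl (freq D x)))
      0≤a
      λ v b → ≤-resp refl (sym (trans (vtotal-affine 1# (- 1#) (contains D x) v)
        (trans (+-congˡ (*-congˡ (sample-total x v)))
          (solve 2 (λ n f → n :* :1 :+ (:- :1) :* (n :* f) := n :* (:1 :- f)) refl (fromℕ N) (freq (S v) x)))))
        (*-monoˡ-≤ (fromℕ-nonNeg N)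
          (by-cert (x≤y⇒0≤y-x b) (solve 3 (λ f p a → (:1 :- f) :- ((:1 :- p) :+ a) := (p :- f) :- a) refl
            (freq (S v) x) (freq D x) a)))
      where
      h : Fin d → R
      h i = 1# + - 1# * contains D x i

    deviation-tail : ∀ x {a} → 0# ≤ a → Pr (λ ω → ¬ abs (freq (S (Z ω)) x - freq D x) ≤ a)
                                        ≤ fromℕ 2 * exp (- (fromℕ N * (a * a)))
    deviation-tail x {a} 0≤a = ≤-trans
      (Pr-∪ Ω {F = λ ω → a ≤ freq (S (Z ω)) x - freq D x} {λ ω → a ≤ freq D x - freq
        (S (Z ω)) x} λ ω far → cases ω far (total _ _) (total _ _))
      (≤-trans (+-mono₂-≤ (upper-tail x 0≤a) (lower-tail x 0≤a))
        (≤-reflexive (trans (solve 1 (λ e → e :+ e := :2 :* e) refl (exp (- (a * a)) ^ N))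
          (*-congˡ (trans (exp-^ _ N)
            (exp-cong (solve 2 (λ n s → n :* (:- s) := :- (n :* s)) refl (fromℕ N) (a * a))))))))
      where
      cases : ∀ ω → ¬ abs (freq (S (Z ω)) x - freq D x) ≤ a →
              a ≤ freq (S (Z ω)) x - freq D x ⊎ freq (S (Z ω)) x - freq D x ≤ a →
              a ≤ freq D x - freq (S (Z ω)) x ⊎ freq D x - freq (S (Z ω)) x ≤ a →
              a ≤ freq (S (Z ω)) x - freq D x ⊎ a ≤ freq D x - freq (S (Z ω)) x
      cases ω far (inj₁ p) _        = inj₁ p
      cases ω far (inj₂ p) (inj₁ q) = inj₂ q
      cases ω far (inj₂ p) (inj₂ q) = ⊥-elim (far (abs-≤ p (by-cert (x≤y⇒0≤y-x q)
        (solve 3 (λ f p a → (f :- p) :- (:- a) := a :- (p :- f)) refl (freq (S (Z ω)) x) (freq D x) a))))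

    -- Both frequencies come from the same draws, so an inversion is a statement about one sum, that
    -- of the differences of the two indicators; each draw contributes the factor
    -- `exp (l * difference)`.
    inversion-tail : ∀ x y {ε} → 0# < ε → ε < 1# → freq D y + ε ≤ freq D x →
                     Pr (λ ω → freq (S (Z ω)) x ≤ freq (S (Z ω)) y) ≤ exp (- (fromℕ N * (ε * ε * half)))
    inversion-tail x y {ε} 0<ε ε<1 gap = ≤-trans
      (markov Ω 1≤d Z uniform {λ v → freq (S v) x ≤ freq (S v) y} (λ i → exp (z i)) (λ i → <⇒≤ (exp-pos _))
        (<⇒≤ (exp-pos _))
        (difference-moment (contains-binary D x) (contains-binary D y) (mean x) (mean y) gap 0<ε ε<1 0≤l tilted)
        λ v b → ≤-resp refl (sym (vprod-exp z v)) (1≤exp (≤-resp refl (sym (begin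
            vtotal z v
              ≈⟨ vtotal-cong v ⟩
            vtotal (λ i → 0# + l * (contains D y i - contains D x i)) v
              ≈⟨ vtotal-affine 0# l (λ i → contains D y i - contains D x i) v ⟩
            fromℕ N * 0# + l * vtotal (λ i → contains D y i - contains D x i) v
              ≈⟨ trans (+-congʳ (zeroʳ _)) (+-identityˡ _) ⟩
            l * vtotal (λ i → contains D y i - contains D x i) v
              ≈⟨ *-congˡ (trans (vtotal-- (contains D y) (contains D x) v) (+-cong (sample-total y v) (-‿cong (sample-total x v)))) ⟩
            l * (fromℕ N * freq (S v) y - fromℕ N * freq (S v) x) ∎))
          (0≤* 0≤l (x≤y⇒0≤y-x (*-monoˡ-≤ (fromℕ-nonNeg N) b))))))
      (≤-reflexive (trans (exp-^ _ N)
        (exp-cong (solve 2 (λ n s → n :* (:- s) := :- (n :* s)) refl (fromℕ N) (ε * ε * half)))))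
      where
      open ≈R
      l = proj₁ (tilt 0<ε ε<1)
      0≤l = proj₁ (proj₂ (tilt 0<ε ε<1))
      tilted = proj₂ (proj₂ (tilt 0<ε ε<1))
      z : Fin d → R
      z i = l * (contains D y i - contains D x i)
      vtotal-cong : ∀ {k} (v : Vec (Fin d) k) → vtotal z v ≈ vtotal
        (λ i → 0# + l * (contains D y i - contains D x i)) v
      vtotal-cong Vec.[]      = refl
      vtotal-cong (i Vec.∷ v) = +-cong (sym (+-identityˡ _)) (vtotal-cong v)

  -- Segments of lists

  module _ {A : Set} where

    lookup-injective : ∀ {xs : List A} → Unique xs → ∀ i j → lookup xs i ≡ lookup xs j → i ≡ j
    lookup-injective (_ ∷ _)  Fin.zero    Fin.zero    _ = ≡.refl
    lookup-injective (p ∷ _)  Fin.zero    (Fin.suc j) e = ⊥-elim (All.lookup p (∈-lookup j) e)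
    lookup-injective (p ∷ _)  (Fin.suc i) Fin.zero    e = ⊥-elim (All.lookup p (∈-lookup i) (≡.sym e))
    lookup-injective (_ ∷ ps) (Fin.suc i) (Fin.suc j) e = ≡.cong Fin.suc (lookup-injective ps i j e)

    Unique⇒length≤ : ∀ {xs ys : List A} → Unique xs → (∀ {x} → x ∈ xs → x ∈ ys) → length xs ℕ.≤ length ys
    Unique⇒length≤ {xs} {ys} uniq ⊆ys = Fin.injective⇒≤ {f = λ i → Any.index (⊆ys (∈-lookup i))} λ {i} {j} e →
      lookup-injective uniq i j (≡.trans (Any.lookup-index (⊆ys (∈-lookup i)))
        (≡.trans (≡.cong (lookup ys) e) (≡.sym (Any.lookup-index (⊆ys (∈-lookup j))))))

    take⊎drop : ∀ k {x} (xs : List A) → x ∈ xs → x ∈ take k xs ⊎ x ∈ drop k xs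
    take⊎drop k xs p = ∈-++⁻ (take k xs) (≡.subst (_ ∈_) (≡.sym (List.take++drop≡id k xs)) p)

    take⊆ : ∀ k {x} (xs : List A) → x ∈ take k xs → x ∈ xs
    take⊆ k xs p = ≡.subst (_ ∈_) (List.take++drop≡id k xs) (∈-++⁺ˡ p)

    drop⊆ : ∀ k {x} (xs : List A) → x ∈ drop k xs → x ∈ xs
    drop⊆ k xs p = ≡.subst (_ ∈_) (List.take++drop≡id k xs) (∈-++⁺ʳ (take k xs) p)

    take-mono : ∀ {j k x} (xs : List A) → j ℕ.≤ k → x ∈ take j xs → x ∈ take k xs
    take-mono (_ ∷ _)  (ℕ.s≤s p) (here e)  = here e
    take-mono (_ ∷ xs) (ℕ.s≤s p) (there q) = there (take-mono xs p q)

    drop-anti : ∀ {j k x} (xs : List A) → j ℕ.≤ k → x ∈ drop k xs → x ∈ drop j xs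
    drop-anti {k = k} xs ℕ.z≤n q = drop⊆ k xs q
    drop-anti (_ ∷ xs) (ℕ.s≤s p) q = drop-anti xs p q

    take-all : ∀ {k x} (xs : List A) → length xs ℕ.≤ k → x ∈ xs → x ∈ take k xs
    take-all (_ ∷ _)  (ℕ.s≤s p) (here e)  = here e
    take-all (_ ∷ xs) (ℕ.s≤s p) (there q) = there (take-all xs p q)

    take-+ : ∀ a b {x} (xs : List A) → x ∈ take (a ℕ.+ b) xs → x ∈ take a xs ⊎ x ∈ take b (drop a xs)
    take-+ ℕ.zero    b xs       p         = inj₂ p
    take-+ (ℕ.suc a) b (_ ∷ xs) (here e)  = inj₁ (here e)
    take-+ (ℕ.suc a) b (_ ∷ xs) (there p) = [ inj₁ ∘ there , inj₂ ]′ (take-+ a b xs p)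

    length-take≤ : ∀ k (xs : List A) → length (take k xs) ℕ.≤ k
    length-take≤ k xs = ≡.subst (ℕ._≤ k) (≡.sym (List.length-take k xs)) (ℕ.m⊓n≤m k (length xs))

    length-take≡ : ∀ {k} (xs : List A) → k ℕ.≤ length xs → length (take k xs) ≡ k
    length-take≡ {k} xs p = ≡.trans (List.length-take k xs) (ℕ.m≤n⇒m⊓n≡m p)

    -- Pigeonhole: more than `k` distinct members cannot all be among the first `k`. All comparisons
    -- between the rankings of the dataset and of the sample go through this.
    escape-take : ∀ {as xs : List A} {k} → Unique as → (∀ {a} → a ∈ as → a ∈ xs) → k ℕ.< length as →
                  ∃ λ a → a ∈ as × a ∈ drop k xs
    escape-take {as} {xs} {k} uniq ⊆xs k< = [ id , (λ none → ⊥-elim (ℕ.<⇒≱ k< (ℕ.≤-trans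
        (Unique⇒length≤ uniq λ {a} p → [ id , (λ q → ⊥-elim (none (a , p , q))) ]′ (take⊎drop k xs (⊆xs p)))
        (length-take≤ k xs)))) ]′ (toSum em)

    segment : ∀ (c s : ℕ → ℕ) → c 0 ≡ 0 → (∀ i → c (ℕ.suc i) ≡ c i ℕ.+ s i) →
              ∀ n {x} (xs : List A) → x ∈ take (c n) xs → ∃ λ i → i ℕ.< n × x ∈ take (s i) (drop (c i) xs)
    segment c s c0 c+ ℕ.zero xs p with c 0 | c0 | p
    ... | _ | ≡.refl | ()
    segment c s c0 c+ (ℕ.suc n) {x} xs p =
      [ (λ q → let (i , i<n , r) = segment c s c0 c+ n xs q in i , ℕ.m<n⇒m<1+n i<n , r)
      , (λ q → n , ℕ.n<1+n n , q) ]′ (take-+ (c n) (s n) xs (≡.subst (λ k → x ∈ take k xs) (c+ n) p))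

    -- Ranks count from 0 here; value is 0# past the end of the list.

    module Ranks (f : A → R) where

      value : List A → ℕ → R
      value xs k = maybe′ f 0# (head (drop k xs))

      Decreasing : List A → Set
      Decreasing = AllPairs (λ x y → f y ≤ f x)

      value-attained : ∀ {k} xs → k ℕ.< length xs → ∃ λ z → z ∈ xs × value xs k ≡ f z
      value-attained {ℕ.zero}  (x ∷ xs) _         = x , here ≡.refl , ≡.refl
      value-attained {ℕ.suc k} (x ∷ xs) (ℕ.s≤s p) = let (z , q , e) = value-attained xs p in z , there q , e

      drop≤value : ∀ k {xs b} → Decreasing xs → b ∈ drop k xs → f b ≤ value xs k
      drop≤value ℕ.zero    (_ ∷ _)  (here ≡.refl) = ≤-refl
      drop≤value ℕ.zero    (p ∷ _)  (there q)     = All.lookup p q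
      drop≤value (ℕ.suc k) (_ ∷ ps) q             = drop≤value k ps q

      value≤take : ∀ {k xs a} → Decreasing xs → k ℕ.< length xs → a ∈ take (ℕ.suc k) xs → value xs k ≤ f a
      value≤take {ℕ.zero}  (_ ∷ _)  _         (here ≡.refl) = ≤-refl
      value≤take {ℕ.suc k} {x ∷ xs} (p ∷ _) (ℕ.s≤s k<) (here ≡.refl) =
        let (z , q , e) = value-attained xs k< in ≤-trans (≤-reflexive (reflexive e)) (All.lookup p q)
      value≤take {ℕ.suc k} (_ ∷ ps) (ℕ.s≤s k<) (there q)     = value≤take ps k< q

  -- Rankings of the itemsets

  allItemsets-unique : ∀ n → Unique (allItemsets n)
  allItemsets-unique ℕ.zero    = [] ∷ []
  allItemsets-unique (ℕ.suc n) = Unique.++⁺ (Unique.map⁺ Vec.∷-injectiveʳ ih)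
    (Unique.map⁺ Vec.∷-injectiveʳ ih) disjoint
    where
    ih = allItemsets-unique n
    disjoint : ∀ {v} → v ∈ List.map (inside Vec.∷_) (allItemsets n) × v ∈ List.map (outside Vec.∷_)
      (allItemsets n) → ⊥
    disjoint (p , q) with ∈-map⁻ (inside Vec.∷_) p | ∈-map⁻ (outside Vec.∷_) q
    ... | _ , _ , ≡.refl | _ , _ , ()

  ∈allItemsets : ∀ {n} (x : Itemset n) → x ∈ allItemsets n
  ∈allItemsets Vec.[] = here ≡.refl
  ∈allItemsets (inside  Vec.∷ x) = ∈-++⁺ˡ (∈-map⁺ (inside Vec.∷_) (∈allItemsets x))
  ∈allItemsets {ℕ.suc n} (outside Vec.∷ x) = ∈-++⁺ʳ (List.map (inside Vec.∷_) (allItemsets n))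
    (∈-map⁺ (outside Vec.∷_) (∈allItemsets x))

  module _ {n k : ℕ} (w : ℕ) (T : Dataset n k) where

    private
      byFreq : DecTotalOrder 0ℓ 0ℓ 0ℓ
      byFreq = On.decTotalOrder (Flip.decTotalOrder decTotalOrder) (freq T)

      InU? : ∀ (x : Itemset n) → Dec (InU w x)
      InU? x = (1 ℕ.≤? ∣ x ∣) ×-dec (∣ x ∣ ℕ.≤? w)

    ranked-↭ : ranked w T ↭ U n w
    ranked-↭ = Sort.sort-↭ byFreq (U n w)

    ranked-decreasing : Ranks.Decreasing (freq T) (ranked w T)
    ranked-decreasing = Sorted.Sorted⇒AllPairs (DecTotalOrder.totalOrder byFreq) (Sort.sort-↗ byFreq (U n w))

    ranked-unique : Unique (ranked w T)
    ranked-unique = ↭ₛ.Unique-resp-↭ (≡.setoid (Itemset n)) (↭⇒↭ₛ (↭-sym ranked-↭))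
      (Unique.filter⁺ InU? (allItemsets-unique n))

    ranked-length : length (ranked w T) ≡ cardU n w
    ranked-length = ↭.↭-length ranked-↭

    ∈ranked⇒InU : ∀ {x} → x ∈ ranked w T → InU w x
    ∈ranked⇒InU p = proj₂ (∈-filter⁻ InU? {xs = allItemsets n} (↭.∈-resp-↭ ranked-↭ p))

    InU⇒∈ranked : ∀ {x} → InU w x → x ∈ ranked w T
    InU⇒∈ranked {x} p = ↭.∈-resp-↭ (↭-sym ranked-↭) (∈-filter⁺ InU? (∈allItemsets x) p)

  -- Deterministic approximation criteria, for the 0-based rank k = K - 1

  module Criteria {n d N : ℕ} (w : ℕ) (D : Dataset n d) (S : Dataset n N) (k : ℕ) (k<m : k ℕ.< cardU n w)
                  {ε : R} (0<ε : 0# < ε) where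

    xs ys : List (Itemset n)
    xs = ranked w D
    ys = ranked w S

    open Ranks (freq D) public using () renaming (value to valueᴰ)
    open Ranks (freq S) public using () renaming (value to valueˢ)

    θᴰ θˢ : R
    θᴰ = freqRank w D (ℕ.suc k)
    θˢ = freqRank w S (ℕ.suc k)

    xs⊆ys : ∀ {x} → x ∈ xs → x ∈ ys
    xs⊆ys p = InU⇒∈ranked w S (∈ranked⇒InU w D p)

    ys⊆xs : ∀ {x} → x ∈ ys → x ∈ xs
    ys⊆xs p = InU⇒∈ranked w D (∈ranked⇒InU w S p)

    dropᴰ : ∀ j {x} → x ∈ drop j xs → freq D x ≤ valueᴰ xs j
    dropᴰ j = Ranks.drop≤value (freq D) j (ranked-decreasing w D)

    dropˢ : ∀ j {x} → x ∈ drop j ys → freq S x ≤ valueˢ ys j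
    dropˢ j = Ranks.drop≤value (freq S) j (ranked-decreasing w S)

    takeᴰ : ∀ {j x} → j ℕ.< cardU n w → x ∈ take (ℕ.suc j) xs → valueᴰ xs j ≤ freq D x
    takeᴰ {j} j<m = Ranks.value≤take (freq D) (ranked-decreasing w D)
      (≡.subst (j ℕ.<_) (≡.sym (ranked-length w D)) j<m)

    takeˢ : ∀ {j x} → j ℕ.< cardU n w → x ∈ take (ℕ.suc j) ys → valueˢ ys j ≤ freq S x
    takeˢ {j} j<m = Ranks.value≤take (freq S) (ranked-decreasing w S)
      (≡.subst (j ℕ.<_) (≡.sym (ranked-length w S)) j<m)

    length-takeᴰ : ∀ {j} → j ℕ.≤ cardU n w → length (take j xs) ≡ j
    length-takeᴰ {j} p = length-take≡ xs (≡.subst (j ℕ.≤_) (≡.sym (ranked-length w D)) p)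

    length-takeˢ : ∀ {j} → j ℕ.≤ cardU n w → length (take j ys) ≡ j
    length-takeˢ {j} p = length-take≡ ys (≡.subst (j ℕ.≤_) (≡.sym (ranked-length w S)) p)

    -- The witness `a` links the values at position `j` of the two rankings: `freq D a` is at least
    -- the one of the dataset, and `freq S a` is at most the one of the sample.
    topᴰ-in-tailˢ : ∀ {j} → j ℕ.< cardU n w → ∃ λ a → a ∈ take (ℕ.suc j) xs × a ∈ drop j ys
    topᴰ-in-tailˢ {j} j<m = escape-take (Unique.take⁺ (ℕ.suc j) (ranked-unique w D)) (λ p → xs⊆ys (take⊆ (ℕ.suc j) xs p))
      (ℕ.≤-reflexive (≡.sym (length-takeᴰ j<m)))

    topˢ-in-tailᴰ : ∀ {j} → j ℕ.< cardU n w → ∃ λ a → a ∈ take (ℕ.suc j) ys × a ∈ drop j xs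
    topˢ-in-tailᴰ {j} j<m = escape-take (Unique.take⁺ (ℕ.suc j) (ranked-unique w S)) (λ p → ys⊆xs (take⊆ (ℕ.suc j) ys p))
      (ℕ.≤-reflexive (≡.sym (length-takeˢ j<m)))

    Approx : Set
    Approx = IsApproximation D (ℕ.suc k) w ε (TOPK S (ℕ.suc k) w)

    -- The first K entries of the sample ranking are witnesses; ties at the K-th frequency may add
    -- further pairs.
    topk-card : HasAtLeast (ℕ.suc k) (TOPK S (ℕ.suc k) w)
    topk-card = (λ i → nth i , freq S (nth i)) ,
      (λ i → ∈ranked⇒InU w S (take⊆ (ℕ.suc k) ys (nth∈ i)) , refl , takeˢ k<m (nth∈ i)) ,
      λ {i} {j} (e , _) → index-injective (lookup-injective (Unique.take⁺ (ℕ.suc k) (ranked-unique w S)) _ _ e)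
      where
      index : Fin (ℕ.suc k) → Fin (length (take (ℕ.suc k) ys))
      index = Fin.cast (≡.sym (length-takeˢ k<m))
      nth : Fin (ℕ.suc k) → Itemset n
      nth i = lookup (take (ℕ.suc k) ys) (index i)
      nth∈ : ∀ i → nth i ∈ take (ℕ.suc k) ys
      nth∈ i = ∈-lookup (index i)
      index-injective : ∀ {i j} → index i ≡ index j → i ≡ j
      index-injective {i} {j} e = Fin.toℕ-injective
        (≡.trans (≡.sym (Fin.toℕ-cast _ i)) (≡.trans (≡.cong Fin.toℕ e) (Fin.toℕ-cast _ j)))

    topk-approx : (∀ {x} → x ∈ xs → θˢ ≤ freq S x → θᴰ - ε ≤ freq D x) →
                  (∀ {x} → x ∈ xs → freq S x < θˢ → freq D x < θᴰ + ε) →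
                  (∀ {x} → x ∈ xs → θˢ ≤ freq S x → abs (freq S x - freq D x) ≤ ε) → Approx
    topk-approx p1 p2 p3 = record
      { card = topk-card
      ; inU  = λ x f (u , _) → u
      ; in01 = λ x f (_ , e , _) → ≤-resp refl (sym e) (proj₁ (freq-bounds S x)) , ≤-resp (sym e) refl
        (proj₂ (freq-bounds S x))
      ; P1   = λ x f (u , _ , le) → p1 (InU⇒∈ranked w D u) le
      ; P2   = λ x u ∉W → p2 (InU⇒∈ranked w D u) (≰⇒> λ le → ∉W (freq S x , u , refl , le))
      ; P3   = λ x f (u , e , le) → ≤-resp (abs-cong (+-congʳ (sym e))) refl (p3 (InU⇒∈ranked w D u) le)
      }

    -- An inversion of a gap ε in the ranking of D is the only obstruction to (P1) and (P2).

    final-criterion : (∀ {x} → x ∈ xs → abs (freq S x - freq D x) ≤ ε) →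
                      (∀ {x y} → x ∈ take (ℕ.suc k) xs → y ∈ drop
                        (ℕ.suc k) xs → freq D y + ε ≤ freq D x → ¬ freq S x ≤ freq S y) →
                      Approx
    final-criterion close no-inversion = topk-approx p1 p2 λ p _ → close p
      where
      -- A `y` that is too rare is outside the top K of the dataset. Some `a` of that top K has
      -- sample frequency at most `θˢ`, hence at most that of `y`, so the pair `a`, `y` is inverted.
      p1 : ∀ {y} → y ∈ xs → θˢ ≤ freq S y → θᴰ - ε ≤ freq D y
      p1 {y} y∈ θ≤y = ≮⇒≥ λ y< → [
        (λ q → <⇒≱ y< (≤-trans (by-cert (<⇒≤ 0<ε) (solve 2 (λ t e → t :- (t :- e) := e) refl θᴰ ε))
          (takeᴰ k<m q)))
                                  , (λ q → let (a , a∈t , a∈d) = topᴰ-in-tailˢ k<m in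
                                      no-inversion a∈t q (≤-trans
                                        (by-cert (x≤y⇒0≤y-x (<⇒≤ y<))
                                          (solve 3 (λ t e y → t :- (y :+ e) := (t :- e) :- y) refl θᴰ ε
                                            (freq D y))) (takeᴰ k<m a∈t))
                                        (≤-trans (dropˢ k a∈d) θ≤y)) ]′ (take⊎drop (ℕ.suc k) xs y∈)
      p2 : ∀ {x} → x ∈ xs → freq S x < θˢ → freq D x < θᴰ + ε
      p2 {x} x∈ x<θ = ≰⇒> λ far → contra far
        where
        module _ (far : θᴰ + ε ≤ freq D x) where
          not-tail : ∀ {z} → z ∈ drop (ℕ.suc k) xs → freq D z + ε ≤ freq D x
          not-tail q = ≤-trans (+-mono-≤ ε (dropᴰ k (drop-anti xs (ℕ.n≤1+n k) q))) far
          x-not-tail : x ∈ drop (ℕ.suc k) xs → ⊥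
          x-not-tail q = <⇒≱ 0<ε (by-cert (x≤y⇒0≤y-x (not-tail q))
            (solve 2 (λ z e → :0 :- e := z :- (z :+ e)) refl (freq D x) ε))
          x∈top : x ∈ take (ℕ.suc k) xs
          x∈top = [ id , (λ q → ⊥-elim (x-not-tail q)) ]′ (take⊎drop (ℕ.suc k) xs x∈)
          -- `x` lies below `θˢ`, so together with the top K of the sample it makes K + 1 distinct
          -- itemsets. One of them is outside the top K of the dataset; it is not `x`, and hence it
          -- is inverted with `x`.
          as : List (Itemset n)
          as = x ∷ take (ℕ.suc k) ys
          as-unique : Unique as
          as-unique = All.tabulate (λ {z} z∈ e → <⇒≱ x<θ (≡.subst (λ z → θˢ ≤ freq S z) (≡.sym e) (takeˢ k<m z∈)))
                      ∷ Unique.take⁺ (ℕ.suc k) (ranked-unique w S)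
          as⊆ : ∀ {a} → a ∈ as → a ∈ xs
          as⊆ (here ≡.refl) = x∈
          as⊆ (there p)     = ys⊆xs (take⊆ (ℕ.suc k) ys p)
          absurd-at : ∀ {a} → a ∈ as → a ∈ drop (ℕ.suc k) xs → ⊥
          absurd-at (here ≡.refl) q = x-not-tail q
          absurd-at (there p)     q = no-inversion x∈top q (not-tail q) (≤-trans (<⇒≤ x<θ) (takeˢ k<m p))
          contra : ⊥
          contra = let (a , p , q) = escape-take {k = ℕ.suc k} as-unique as⊆ (ℕ.s≤s (ℕ.≤-reflexive (≡.sym (length-takeˢ k<m)))) in absurd-at p q

    -- The i-th block of the ranking of D starts at the 0-based rank c i and has s i elements.

    module _ (c s : ℕ → ℕ) (H : ℕ) (c0 : c 0 ≡ 0) (c+ : ∀ i → c (ℕ.suc i) ≡ c i ℕ.+ s i) (1≤s : ∀ i → 1 ℕ.≤ s i)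
             (K≤c1 : ℕ.suc k ℕ.≤ c 1) (c<m : ∀ i → i ℕ.≤ H → c i ℕ.< cardU n w)
               (m≤c : cardU n w ℕ.≤ c (ℕ.suc H))
             (close : ∀ i → i ℕ.≤ H → ∀ {x} → x ∈ take (s i) (drop (c i) xs) → abs
               (freq S x - freq D x) ≤ fromℕ (i ℕ.+ 1) * (ε * half))
             (stop : ∀ i → 1 ℕ.≤ i → i ℕ.≤ H → fromℕ (i ℕ.+ 1) * ε < θˢ - valueˢ ys (c i)) where

      private
        η : R
        η = ε * half
        0≤η : 0# ≤ η
        0≤η = 0≤* (<⇒≤ 0<ε) (<⇒≤ 0<half)
        η≤ε : η ≤ ε
        η≤ε = by-cert 0≤η (trans (+-congʳ (sym (x*half+x*half ε))) (solve 1 (λ h → (h :+ h) :- h := h) refl η))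

        block : ∀ {x} → x ∈ xs → ∃ λ i → i ℕ.≤ H × x ∈ take (s i) (drop (c i) xs)
        block x∈ = let (i , i<H , q) = segment c s c0 c+ (ℕ.suc H) xs (take-all xs (≡.subst (ℕ._≤ c (ℕ.suc H)) (≡.sym (ranked-length w D)) m≤c) x∈)
                   in i , ℕ.≤-pred i<H , q

        c-mono : ∀ {i j} → i ℕ.≤ j → c i ℕ.≤ c j
        c-mono {i} i≤j = go (ℕ.≤⇒≤′ i≤j)
          where
          go : ∀ {j} → i ℕ.≤′ j → c i ℕ.≤ c j
          go (ℕ.≤′-reflexive ≡.refl) = ℕ.≤-refl
          go (ℕ.≤′-step {j} p) = ℕ.≤-trans (go p) (≡.subst (c j ℕ.≤_) (≡.sym (c+ j)) (ℕ.m≤m+n (c j) (s j)))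

        -- The first `c i + 1` ranks reach one element into block `i`, which is nonempty; the
        -- earlier blocks have smaller tolerances.
        close-up-to : ∀ i → i ℕ.≤ H → ∀ {x} → x ∈ take (ℕ.suc (c i)) xs → abs (freq S x - freq D x) ≤ fromℕ
          (i ℕ.+ 1) * η
        close-up-to i i≤H {x} p =
          let (i′ , i′<1+i , q) = segment c s c0 c+ (ℕ.suc i) xs (take-mono xs 1+c≤ p)
          in ≤-trans (close i′ (ℕ.≤-trans (ℕ.≤-pred i′<1+i) i≤H) q) (*-monoʳ-≤ 0≤η (fromℕ-mono (ℕ.+-monoˡ-≤ 1 (ℕ.≤-pred i′<1+i))))
          where
          1+c≤ : ℕ.suc (c i) ℕ.≤ c (ℕ.suc i)
          1+c≤ = ≡.subst (ℕ.suc (c i) ℕ.≤_) (≡.sym (c+ i))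
            (≡.subst (ℕ._≤ c i ℕ.+ s i) (ℕ.+-comm (c i) 1) (ℕ.+-monoʳ-≤ (c i) (1≤s i)))

        -- The intermediary `a` is at least as frequent in the dataset as `y`, and its sample
        -- frequency is at most the value at rank `c i` that the stopping condition separates from
        -- `θˢ`. The gap `(i + 1) ε` pays for the errors of `a` and `y`, half of it each.
        later-block-below : ∀ i → 1 ℕ.≤ i → i ℕ.≤ H → ∀ {y} → y ∈ take (s i) (drop (c i) xs) → freq S y < θˢ
        later-block-below i 1≤i i≤H {y} y∈ =
          let (a , a∈t , a∈d) = topᴰ-in-tailˢ (c<m i i≤H)
              r = fromℕ (i ℕ.+ 1)
              e₁ = proj₁ (abs-≤-inv (close i i≤H y∈))
              e₂ = proj₂ (abs-≤-inv (close-up-to i i≤H a∈t))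
              e₃ = dropᴰ (c i) (take⊆ (s i) (drop (c i) xs) y∈)
              e₄ = takeᴰ (c<m i i≤H) a∈t
              e₅ = dropˢ (c i) a∈d
          in by-cert< (0<+≤ (x<y⇒0<y-x (stop i 1≤i i≤H)) (0≤+ (0≤+ (x≤y⇒0≤y-x e₁) (x≤y⇒0≤y-x e₂)) (0≤+ (x≤y⇒0≤y-x (≤-trans e₃ e₄)) (x≤y⇒0≤y-x e₅))))
            (trans (solve 8 (λ r e h θ v sy dy sa → θ :- sy := ((θ :- v) :- r :* e :* :1) :+ r :* e :* :1 :+
              (v :- sy)) refl r ε half θˢ (valueˢ ys (c i)) (freq S y) (freq D y) (freq S a))
            (trans (+-congʳ (+-congˡ (*-congˡ (sym half+half))))
            (solve 9 (λ r e h θ v sy dy sa da → ((θ :- v) :- r :* e :* :1) :+ r :* e :* (h :+ h) :+ (v :- sy)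
                := ((θ :- v) :- r :* e) :+
                  (((r :* (e :* h) :- (sy :- dy)) :+ (r :* (e :* h) :- (:- (sa :- da)))) :+
                    ((da :- dy) :+ (v :- sa))))
              refl r ε half θˢ (valueˢ ys (c i)) (freq S y) (freq D y) (freq S a) (freq D a))))

        first-block-close : ∀ {x} → x ∈ take (s 0) (drop (c 0) xs) → abs (freq S x - freq D x) ≤ η
        first-block-close p = ≤-resp refl (solve 1 (λ h → (:1 :+ :0) :* h := h) refl η) (close 0 ℕ.z≤n p)

        selected-close : ∀ {x} → x ∈ xs → θˢ ≤ freq S x → abs (freq S x - freq D x) ≤ η
        selected-close x∈ θ≤ = cases (block x∈)
          where
          cases : _ → _
          cases (ℕ.zero  , _   , q) = first-block-close q
          cases (ℕ.suc i , i≤H , q) = ⊥-elim (<⇒≱ (later-block-below (ℕ.suc i) (ℕ.s≤s ℕ.z≤n) i≤H q) θ≤)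

        -- The top K of the dataset lies in block 0 because `K ≤ c 1`, so the linking itemset has an
        -- error of at most `η`. In the converse `θˢ≤` it is `selected-close` that provides this
        -- error bound.
        θᴰ≤ : θᴰ ≤ θˢ + η
        θᴰ≤ = let (a , a∈t , a∈d) = topᴰ-in-tailˢ k<m
                  (i , i<1 , q) = segment c s c0 c+ 1 xs (take-mono xs K≤c1 a∈t)
                  q′ = ≡.subst (λ i → a ∈ take (s i) (drop (c i) xs)) (ℕ.n<1⇒n≡0 i<1) q
              in by-cert (0≤+ (0≤+ (x≤y⇒0≤y-x (takeᴰ k<m a∈t)) (x≤y⇒0≤y-x (proj₂ (abs-≤-inv (first-block-close q′))))) (x≤y⇒0≤y-x (dropˢ k a∈d)))
                   (solve 5 (λ θ t h sa da → (θ :+ h) :- t := ((da :- t) :+ (h :- (:- (sa :- da)))) :+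
                     (θ :- sa)) refl θˢ θᴰ η (freq S a) (freq D a))

        θˢ≤ : θˢ ≤ θᴰ + η
        θˢ≤ = let (a , a∈t , a∈d) = topˢ-in-tailᴰ k<m
              in by-cert (0≤+ (0≤+ (x≤y⇒0≤y-x (takeˢ k<m a∈t)) (x≤y⇒0≤y-x (proj₁ (abs-≤-inv (selected-close (drop⊆ k xs a∈d) (takeˢ k<m a∈t)))))) (x≤y⇒0≤y-x (dropᴰ k a∈d)))
                   (solve 5 (λ θ t h sa da → (t :+ h) :- θ := ((sa :- θ) :+ (h :- (sa :- da))) :+
                     (t :- da)) refl θˢ θᴰ η (freq S a) (freq D a))

        2η≤ε : 0# ≤ ε - (η + η)
        2η≤ε = ≤-reflexive (sym (trans (+-congˡ (-‿cong (x*half+x*half ε))) (-‿inverseʳ ε)))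

      stopping-criterion : Approx
      stopping-criterion = topk-approx
        (λ {x} x∈ θ≤ → by-cert (0≤+ (0≤+ (0≤+ (x≤y⇒0≤y-x θ≤) (x≤y⇒0≤y-x θᴰ≤)) 2η≤ε) (x≤y⇒0≤y-x (proj₁ (abs-≤-inv (selected-close x∈ θ≤)))))
          (solve 6 (λ θ t h e sx dx → dx :- (t :- e) :=
            (((sx :- θ) :+ ((θ :+ h) :- t)) :+ (e :- (h :+ h))) :+ (h :- (sx :- dx))) refl θˢ θᴰ η ε
              (freq S x) (freq D x)))
        (λ {x} x∈ x<θ → unselected x<θ (block x∈))
        λ x∈ θ≤ → ≤-trans (selected-close x∈ θ≤) η≤ε
        where
        unselected : ∀ {x} → freq S x < θˢ →
          (∃ λ i → i ℕ.≤ H × x ∈ take (s i) (drop (c i) xs)) → freq D x < θᴰ + ε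
        unselected {x} x<θ (ℕ.zero , _ , q) = by-cert<
          (0<+≤ (x<y⇒0<y-x x<θ) (0≤+ (0≤+ (x≤y⇒0≤y-x θˢ≤) 2η≤ε)
            (x≤y⇒0≤y-x (proj₂ (abs-≤-inv (first-block-close q))))))
          (solve 6 (λ θ t h e sx dx → (t :+ e) :- dx := (θ :- sx) :+
            ((((t :+ h) :- θ) :+ (e :- (h :+ h))) :+ (h :- (:- (sx :- dx))))) refl θˢ θᴰ η ε (freq S x)
              (freq D x))
        -- Errors in later blocks may be large, but these blocks start behind the first K ranks of
        -- the dataset, so the rank alone bounds the frequency by `θᴰ`.
        unselected {x} x<θ (ℕ.suc i , i≤H , q) = by-cert<
          (0<+≤ 0<ε (x≤y⇒0≤y-x (dropᴰ k (drop-anti xs k≤c (take⊆ (s (ℕ.suc i)) (drop (c (ℕ.suc i)) xs) q)))))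
          (solve 3 (λ t e dx → (t :+ e) :- dx := e :+ (t :- dx)) refl θᴰ ε (freq D x))
          where
          k≤c : k ℕ.≤ c (ℕ.suc i)
          k≤c = ℕ.≤-trans (ℕ.n≤1+n k) (ℕ.≤-trans K≤c1 (c-mono (ℕ.s≤s ℕ.z≤n)))

  exact-approx : ∀ {n d} (w : ℕ) (D : Dataset n d) k → k ℕ.< cardU n w → ∀ {ε} → 0# < ε →
                 IsApproximation D (ℕ.suc k) w ε (TOPK D (ℕ.suc k) w)
  exact-approx w D k k<m {ε} 0<ε = Criteria.topk-approx w D D k k<m 0<ε
    (λ x∈ θ≤ → ≤-trans (by-cert (<⇒≤ 0<ε) (solve 2 (λ t e → t :- (t :- e) := e) refl _ ε)) θ≤)
    (λ x∈ x<θ → <-≤-trans x<θ (by-cert (<⇒≤ 0<ε) (solve 2 (λ t e → (t :+ e) :- t := e) refl _ ε)))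
    λ x∈ θ≤ → ≤-trans (≤-reflexive (abs-cong (-‿inverseʳ _))) (abs-≤ (<⇒≤ 0<ε) (neg≤0 (<⇒≤ 0<ε)))

  lookup-Any : ∀ {A : Set} {P : A → Set} {xs : List A} → ¬ Any P xs → ∀ {x} → x ∈ xs → ¬ P x
  lookup-Any none x∈ p = none (Any.map (λ { ≡.refl → p }) x∈)

  -- Numerical bounds

  x*y≤x : ∀ {x y} → 0# ≤ x → y ≤ 1# → x * y ≤ x
  x*y≤x {x} 0≤x y≤1 = ≤-resp refl (*-identityʳ x) (*-monoˡ-≤ 0≤x y≤1)

  half≤1 : half ≤ 1#
  half≤1 = by-cert (<⇒≤ 0<half) (trans (+-congʳ (sym half+half)) (solve 1 (λ h → (h :+ h) :- h := h) refl half))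

  half*2 : half * fromℕ 2 ≈ 1#
  half*2 = x⁻¹*x≈1 (fromℕ-pos 1)

  geometric-half : ∀ n → Σ< n (λ i → half ^ i) ≤ fromℕ 2
  geometric-half n = by-cert (0≤* (fromℕ-nonNeg 2) (^-nonNeg n (<⇒≤ 0<half)))
    (trans (+-congʳ (sym (invariant n)))
      (solve 2 (λ a b → (a :+ b) :- a := b) refl (Σ< n (λ i → half ^ i)) (fromℕ 2 * half ^ n)))
    where
    invariant : ∀ n → Σ< n (λ i → half ^ i) + fromℕ 2 * half ^ n ≈ fromℕ 2
    invariant ℕ.zero    = solve 0 (:0 :+ :2 :* :1 := :2) refl
    invariant (ℕ.suc n) = trans
      (solve 3 (λ a h x → (a :+ x) :+ :2 :* (h :* x) := a :+ (:1 :+ h :* :2) :* x) refl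
        (Σ< n (λ i → half ^ i)) half (half ^ n))
      (trans (+-congˡ (*-congʳ (trans (+-congˡ half*2) (solve 0 (:1 :+ :1 := :2) refl)))) (invariant n))

  suc≤square : ∀ i → ℕ.suc i ℕ.≤ (i ℕ.+ 1) ℕ.^ 2
  suc≤square i rewrite ℕ.+-comm i 1 | ℕ.*-identityʳ i = ℕ.m≤m*n (ℕ.suc i) (ℕ.suc i)

  fromℕ-square : ∀ i → fromℕ ((i ℕ.+ 1) ℕ.^ 2) ≈ fromℕ (i ℕ.+ 1) * fromℕ (i ℕ.+ 1)
  fromℕ-square i = trans (fromℕ-* (i ℕ.+ 1) ((i ℕ.+ 1) ℕ.* 1))
    (*-congˡ (reflexive (≡.cong fromℕ (ℕ.*-identityʳ (i ℕ.+ 1)))))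

  -- Since `(i + 1)²` is at least `i + 1`, the sum is dominated by a geometric one of ratio 1/2 with
  -- the factor `q` kept in front.
  Σ-square-powers : ∀ {q} → 0# ≤ q → q ≤ half → ∀ n → Σ< n (λ i → q ^ ((i ℕ.+ 1) ℕ.^ 2)) ≤ q * fromℕ 2
  Σ-square-powers {q} 0≤q q≤½ n = ≤-trans (Σ<-mono n λ i _ → power≤ i)
    (≤-trans (≤-reflexive (Σ<-*ˡ q (λ i → half ^ i) n)) (*-monoˡ-≤ 0≤q (geometric-half n)))
    where
    power≤ : ∀ i → q ^ ((i ℕ.+ 1) ℕ.^ 2) ≤ q * half ^ i
    power≤ i = ≤-trans (^-antimonoʳ-≤ 0≤q (≤-trans q≤½ half≤1) (suc≤square i))
      (*-monoˡ-≤ 0≤q (^-monoˡ-≤ i 0≤q q≤½))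

  -- The parameters of the algorithm and the failure budget

  module Analysis {n d : ℕ} (D : Dataset n d) (1≤d : 1 ℕ.≤ d) (w k : ℕ) (k<m : k ℕ.< cardU n w)
                  {ε δ : R} (0<ε : 0# < ε) (ε<1 : ε < 1#) (0<δ : 0# < δ) (δ<1 : δ < 1#) where

    K : ℕ
    K = ℕ.suc k

    open Progressive D K w ε δ

    private
      𝕂 𝕄 : R
      𝕂 = fromℕ K
      𝕄 = fromℕ m

      1≤𝕂 : 1# ≤ 𝕂
      1≤𝕂 = ≤-resp fromℕ-1 refl (fromℕ-mono {1} {K} (ℕ.s≤s ℕ.z≤n))

      𝕂≤𝕄 : 𝕂 ≤ 𝕄
      𝕂≤𝕄 = fromℕ-mono k<m

      1≤𝕄 : 1# ≤ 𝕄
      1≤𝕄 = ≤-trans 1≤𝕂 𝕂≤𝕄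

      δ≤1 : δ ≤ 1#
      δ≤1 = <⇒≤ δ<1

      0≤δ : 0# ≤ δ
      0≤δ = <⇒≤ 0<δ

      -- u = δ / A₀ is the failure scale of the sampled phases and z = δ / A₁ that of the last one.
      A₀ A₁ L₀ L₁ u z : R
      A₀ = fromℕ 8 * 𝕂
      A₁ = fromℕ 2 * 𝕄 + 𝕂 * (𝕄 - 𝕂)
      L₀ = ln (A₀ / δ)
      L₁ = ln (A₁ / δ)
      u  = exp (- L₀)
      z  = exp (- L₁)

      1≤A₀ : 1# ≤ A₀
      1≤A₀ = by-cert (0≤+ (x≤y⇒0≤y-x 1≤𝕂) (0≤* (fromℕ-nonNeg 7) (fromℕ-nonNeg K)))
        (solve 1 (λ k → :8 :* k :- :1 := (k :- :1) :+ con (ℤ.+ 7) :* k) refl 𝕂)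

      2𝕄≤A₁ : fromℕ 2 * 𝕄 ≤ A₁
      2𝕄≤A₁ = by-cert (0≤* (fromℕ-nonNeg K) (x≤y⇒0≤y-x 𝕂≤𝕄))
        (solve 2 (λ a b → (a :+ b) :- a := b) refl (fromℕ 2 * 𝕄) (𝕂 * (𝕄 - 𝕂)))

      2≤A₁ : fromℕ 2 ≤ A₁
      2≤A₁ = ≤-trans (≤-resp (*-identityʳ _) refl (*-monoˡ-≤ (fromℕ-nonNeg 2) 1≤𝕄)) 2𝕄≤A₁

      1≤A₁ : 1# ≤ A₁
      1≤A₁ = ≤-trans (by-cert 0≤1 (solve 0 (:2 :- :1 := :1) refl)) 2≤A₁

      1<A₀/δ : 1# < A₀ / δ
      1<A₀/δ = ≰⇒> λ p → <⇒≱ δ<1 (≤-trans 1≤A₀ (≤-resp (/*-cancel 0<δ) (*-identityˡ δ) (*-monoʳ-≤ 0≤δ p)))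

      exp-L₀ : exp L₀ ≈ A₀ / δ
      exp-L₀ = exp-ln (<⇒≤ 1<A₀/δ)

      exp-L₁ : exp L₁ ≈ A₁ / δ
      exp-L₁ = exp-ln (≤-/ 0<δ (≤-resp (sym (*-identityˡ δ)) refl (≤-trans δ≤1 1≤A₁)))

      0<L₀ : 0# < L₀
      0<L₀ = ≰⇒> λ p → <⇒≱ 1<A₀/δ (≤-resp exp-L₀ exp-0 (exp-mono p))

      exp-neg-* : ∀ {L A} → exp L ≈ A / δ → exp (- L) * A ≈ δ
      exp-neg-* {L} {A} e = begin
        exp (- L) * A               ≈⟨ *-congˡ (/*-cancel 0<δ) ⟨
        exp (- L) * (A / δ * δ)     ≈⟨ *-congˡ (*-congʳ e) ⟨
        exp (- L) * (exp L * δ)     ≈⟨ solve 3 (λ a b c → a :* (b :* c) := (b :* a) :* c) refl _ _ δ ⟩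
        exp L * exp (- L) * δ       ≈⟨ trans (*-congʳ (exp-inverse L)) (*-identityˡ δ) ⟩
        δ                           ∎
        where open ≈R

      uA₀ : u * A₀ ≈ δ
      uA₀ = exp-neg-* exp-L₀

      zA₁ : z * A₁ ≈ δ
      zA₁ = exp-neg-* exp-L₁

      0≤u : 0# ≤ u
      0≤u = <⇒≤ (exp-pos _)

      0≤z : 0# ≤ z
      0≤z = <⇒≤ (exp-pos _)

      u≤1 : u ≤ 1#
      u≤1 = ≤-resp refl exp-0 (exp-mono (neg≤0 (<⇒≤ 0<L₀)))

      z≤half : z ≤ half
      z≤half = *-cancelʳ-≤ (fromℕ-pos 1) (≤-trans (*-monoˡ-≤ 0≤z 2≤A₁) (≤-resp (sym zA₁) (sym half*2) δ≤1))

      𝕄z≤δ : 𝕄 * z ≤ δ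
      𝕄z≤δ = ≤-resp (*-comm z 𝕄) zA₁
        (*-monoˡ-≤ 0≤z (≤-trans (by-cert (fromℕ-nonNeg m) (solve 1 (λ m → :2 :* m :- m := m) refl 𝕄)) 2𝕄≤A₁))

      -- `A₁` is at most `8 K m`, and `u * (8 K)` is `δ ≤ 1`.
      uA₁≤𝕄 : u * A₁ ≤ 𝕄
      uA₁≤𝕄 = ≤-trans (by-cert (0≤+
        (0≤+ (0≤* 0≤u (0≤* (0≤* (fromℕ-nonNeg 2) (fromℕ-nonNeg m)) (x≤y⇒0≤y-x 1≤𝕂))) (0≤* 0≤u (0≤x² 𝕂)))
                                      (0≤* 0≤u (0≤* (fromℕ-nonNeg 5) (0≤* (fromℕ-nonNeg m) (fromℕ-nonNeg K)))))
          (solve 3 (λ u m k → m :* (u :* (:8 :* k)) :- u :* (:2 :* m :+ k :* (m :- k))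
            := (u :* ((:2 :* m) :* (k :- :1)) :+ u :* (k :* k)) :+ u :* (con (ℤ.+ 5) :* (m :* k))) refl u 𝕄 𝕂))
        (≤-trans (≤-reflexive (*-congˡ uA₀)) (x*y≤x (fromℕ-nonNeg m) δ≤1))

      δu≤𝕄z : δ * u ≤ 𝕄 * z
      δu≤𝕄z = ≤-resp (trans (solve 3 (λ z u a → z :* (u :* a) := (z :* a) :* u) refl z u A₁) (*-congʳ zA₁))
        (*-comm z 𝕄) (*-monoˡ-≤ 0≤z uA₁≤𝕄)

      0<ε² : 0# < ε ^ 2
      0<ε² = ^-pos 2 0<ε

      0<t : ∀ j → 0# < t j
      0<t j = 0<* (0</ (fromℕ-pos 7) 0<ε²) (0<+≤ 0<L₀ (fromℕ-nonNeg j))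

    1≤⌈t⌉ : ∀ j → 1 ℕ.≤ ⌈ t j ⌉
    1≤⌈t⌉ j = ℕ.≮⇒≥ λ N<1 → <⇒≱ (0<t j)
      (≤-trans (≤⌈⌉ (t j)) (≤-reflexive (reflexive (≡.cong fromℕ (ℕ.n<1⇒n≡0 N<1)))))

    private
      -- The exponent of the tail bound for an error of `ε / 2`: the 8 in `t j` becomes a 2, so that
      -- `ρ j` contains the square of `δ / (8 K)`. One of these factors pays for the size of the
      -- block.
      t*η² : ∀ j → t j * ((ε * half) * (ε * half)) ≈ fromℕ 2 * (L₀ + fromℕ j)
      t*η² j = trans (solve 4 (λ e i h l → (:8 :* i :* l) :* ((e :* h) :* (e :* h)) := ((e :^ 2) :* i) :*
        ((h :* :2) :* (h :* :2)) :* (:2 :* l)) refl ε ((ε ^ 2) ⁻¹) half (L₀ + fromℕ j))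
        (trans (*-congʳ (trans (*-cong (⁻¹-inverse (0<⇒≉0 0<ε²))
          (trans (*-cong half*2 half*2) (*-identityʳ 1#))) (*-identityʳ 1#))) (*-identityˡ _))

      tMax*ε² : tMax * (ε * ε * half) ≈ L₁
      tMax*ε² = trans (solve 4 (λ e i h l → (:2 :* i :* l) :* (e :* e :* h) := ((e :^ 2) :* i) :*
        (h :* :2) :* l) refl ε ((ε ^ 2) ⁻¹) half L₁)
        (trans (*-congʳ (trans (*-cong (⁻¹-inverse (0<⇒≉0 0<ε²)) half*2) (*-identityʳ 1#))) (*-identityˡ _))

      ρ q : ℕ → R
      ρ j = exp (- (fromℕ 2 * (L₀ + fromℕ j)))
      q j = fromℕ 2 * σ j * ρ j

      1≤𝕖/2 : 1# ≤ 𝕖 / fromℕ 2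
      1≤𝕖/2 = ≤-/ (fromℕ-pos 1) (≤-trans (≤-reflexive (solve 0 (:1 :* :2 := :1 :+ :1) refl)) (1+x≤exp 1#))

      𝕂≤σ : ∀ j → 𝕂 ≤ σ j
      𝕂≤σ j = ≤-resp (*-identityʳ 𝕂) refl (*-monoˡ-≤ (fromℕ-nonNeg K) (1≤^ j 1≤𝕖/2))

      2σ : ℕ → R
      2σ j = fromℕ 2 * σ j

      0≤2σ : ∀ j → 0# ≤ 2σ j
      0≤2σ j = 0≤* (fromℕ-nonNeg 2) (≤-trans (fromℕ-nonNeg K) (𝕂≤σ j))

      1≤2σ : ∀ j → 1# ≤ 2σ j
      1≤2σ j = ≤-trans (≤-trans 1≤𝕂 (𝕂≤σ j))
        (by-cert (≤-trans (fromℕ-nonNeg K) (𝕂≤σ j)) (solve 1 (λ s → :2 :* s :- s := s) refl (σ j)))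

      -- The lower bound comes from `e / 2 ≥ 1`, which keeps `σ j` at least K. It places the top K
      -- in block 0, makes every block nonempty and thereby ensures that `h j` exists.
      s-bounds : ∀ j i → fromℕ (s j i) ≤ 2σ j ^ ((i ℕ.+ 1) ℕ.^ 2) / fromℕ 2 × K ℕ.≤ s j i
      s-bounds j i = proj₁ spec , proj₂ spec K (≤-/ (fromℕ-pos 1) (≤-trans
          (≤-trans (≤-reflexive (*-comm 𝕂 (fromℕ 2))) (*-monoˡ-≤ (fromℕ-nonNeg 2) (𝕂≤σ j)))
          (x≤x^n (1≤2σ j) (ℕ.≤-trans (ℕ.s≤s ℕ.z≤n) (suc≤square i)))))
        where spec = ⌊⌋-spec (0≤/ (^-nonNeg ((i ℕ.+ 1) ℕ.^ 2) (0≤2σ j)) (fromℕ-pos 1))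

      S<-suc : ∀ j i → S< j (ℕ.suc i) ≡ S< j i ℕ.+ s j i
      S<-suc j i = ≡.trans (≡.cong (List.foldr ℕ._+_ 0 ∘ List.map (s j)) (≡.sym (List.upTo-∷ʳ i)))
        (≡.trans (≡.cong (List.foldr ℕ._+_ 0) (List.map-++ (s j) (List.upTo i) (i ∷ [])))
        (≡.trans (ListAction.sum-++ (List.map (s j) (List.upTo i)) (s j i ∷ []))
                 (≡.cong (S< j i ℕ.+_) (ℕ.+-identityʳ (s j i)))))

      1≤s : ∀ j i → 1 ℕ.≤ s j i
      1≤s j i = ℕ.≤-trans (ℕ.s≤s ℕ.z≤n) (proj₂ (s-bounds j i))

      S<-step : ∀ j i → ℕ.suc (S< j i) ℕ.≤ S< j (ℕ.suc i)
      S<-step j i = ≡.subst (ℕ.suc (S< j i) ℕ.≤_) (≡.sym (S<-suc j i))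
        (≡.subst (ℕ._≤ S< j i ℕ.+ s j i) (ℕ.+-comm (S< j i) 1) (ℕ.+-monoʳ-≤ (S< j i) (1≤s j i)))

      i≤S< : ∀ j i → i ℕ.≤ S< j i
      i≤S< j ℕ.zero    = ℕ.z≤n
      i≤S< j (ℕ.suc i) = ℕ.≤-trans (ℕ.s≤s (i≤S< j i)) (S<-step j i)

      S<-mono : ∀ j {i i′} → i ℕ.≤ i′ → S< j i ℕ.≤ S< j i′
      S<-mono j {i} i≤i′ = go (ℕ.≤⇒≤′ i≤i′)
        where
        go : ∀ {i′} → i ℕ.≤′ i′ → S< j i ℕ.≤ S< j i′
        go (ℕ.≤′-reflexive ≡.refl) = ℕ.≤-refl
        go (ℕ.≤′-step {i′} p) = ℕ.≤-trans (go p) (ℕ.≤-trans (ℕ.n≤1+n _) (S<-step j i′))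

      h-spec : ∀ j → S< j (h j) ℕ.+ 1 ℕ.≤ m × (∀ i → S< j i ℕ.+ 1 ℕ.≤ m → i ℕ.≤ h j)
      h-spec j = greatest-spec {λ i → S< j i ℕ.+ 1 ℕ.≤ m} {0} (ℕ.≤-trans (ℕ.s≤s ℕ.z≤n) k<m) m
        λ i p → ℕ.≤-trans (i≤S< j i) (ℕ.≤-trans (ℕ.m≤m+n (S< j i) 1) p)

      S<-below : ∀ j i → i ℕ.≤ h j → S< j i ℕ.< m
      S<-below j i i≤h = ℕ.≤-trans (ℕ.s≤s (S<-mono j i≤h))
        (≡.subst (ℕ._≤ m) (ℕ.+-comm (S< j (h j)) 1) (proj₁ (h-spec j)))

      -- By maximality of `h j`. The blocks 0 to `h j` thus exhaust the ranking, and the stopping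
      -- condition constrains all of them except the first.
      S<-above : ∀ j → m ℕ.≤ S< j (ℕ.suc (h j))
      S<-above j = ℕ.≮⇒≥ λ p → ℕ.1+n≰n
        (proj₂ (h-spec j) (ℕ.suc (h j)) (≡.subst (ℕ._≤ m) (ℕ.+-comm 1 (S< j (ℕ.suc (h j)))) p))

      K≤S<1 : ∀ j → K ℕ.≤ S< j 1
      K≤S<1 j = ≡.subst (K ℕ.≤_) (≡.sym (ℕ.+-identityʳ (s j 0))) (proj₂ (s-bounds j 0))

      -- q j ≤ B / 2ʲ with 4 B = δ u; this is where σⱼ = K (e/2)ʲ is balanced against e⁻²ʲ.

      B v : R
      B = fromℕ 2 * 𝕂 * (u * u)
      v = exp (- 1#)

      4B : B * fromℕ 2 * fromℕ 2 ≈ δ * u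
      4B = trans (solve 2 (λ k u → :2 :* k :* (u :* u) :* :2 :* :2 := (u :* (:8 :* k)) :* u) refl 𝕂 u)
        (*-congʳ uA₀)

      0≤B : 0# ≤ B
      0≤B = 0≤* (0≤* (fromℕ-nonNeg 2) (fromℕ-nonNeg K)) (0≤* 0≤u 0≤u)

      B≤half : B ≤ half
      B≤half = *-cancelʳ-≤ (fromℕ-pos 1) (≤-resp refl (sym half*2)
        (≤-trans (by-cert (0≤* 0≤B (fromℕ-nonNeg 2))
          (solve 1 (λ b → b :* :2 :* :2 :- b :* :2 := b :* :2) refl B))
          (≤-trans (≤-reflexive 4B) (≤-trans (x*y≤x 0≤δ u≤1) δ≤1))))

      0≤v : 0# ≤ v
      0≤v = <⇒≤ (exp-pos _)

      v≤1 : v ≤ 1#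
      v≤1 = ≤-resp refl exp-0 (exp-mono (neg≤0 0≤1))

      ρ≈ : ∀ j → ρ j ≈ (u * u) * (v ^ j * v ^ j)
      ρ≈ j = trans (exp-cong (solve 2
        (λ l j → :- (:2 :* (l :+ j)) := ((:- l) :+ (:- l)) :+ (j :* (:- :1) :+ j :* (:- :1))) refl L₀
          (fromℕ j)))
        (trans (exp-+ _ _) (*-cong (exp-+ _ _)
          (trans (exp-+ _ _) (*-cong (sym (exp-^ (- 1#) j)) (sym (exp-^ (- 1#) j))))))

      𝕖/2-v : ∀ j → (𝕖 / fromℕ 2) ^ j * v ^ j ≈ half ^ j
      𝕖/2-v j = trans (sym (^-distrib-* (𝕖 / fromℕ 2) v j))
        (^-congˡ j (trans (solve 3 (λ e h v → (e :* h) :* v := (e :* v) :* h) refl 𝕖 half v)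
          (trans (*-congʳ (exp-inverse 1#)) (*-identityˡ half))))

      -- Of the two factors `v ^ j` in `ρ j`, one turns `(e / 2) ^ j` into `half ^ j`; the other is
      -- bounded by 1.
      q≤ : ∀ j → q j ≤ B * half ^ j
      q≤ j = ≤-trans (≤-reflexive (trans (*-congˡ (ρ≈ j))
          (trans (solve 4 (λ k e u v → :2 :* (k :* e) :* ((u :* u) :* (v :* v)) := (:2 :* k :* (u :* u)) :*
            ((e :* v) :* v)) refl 𝕂 ((𝕖 / fromℕ 2) ^ j) u (v ^ j))
                 (*-congˡ (*-congʳ (𝕖/2-v j))))))
        (*-monoˡ-≤ 0≤B (x*y≤x (^-nonNeg j (<⇒≤ 0<half)) (^≤1 j 0≤v v≤1)))

      0≤q : ∀ j → 0# ≤ q j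
      0≤q j = 0≤* (0≤2σ j) (<⇒≤ (exp-pos _))

      q≤half : ∀ j → q j ≤ half
      q≤half j = ≤-trans (q≤ j) (≤-trans (x*y≤x 0≤B (^≤1 j (<⇒≤ 0<half) half≤1)) B≤half)

      -- The index `d` qualifies, because `8 / ε²` is at least 1 and `L₀` is positive, so that
      -- `t d ≥ d`.
      jMax-spec : fromℕ d ⊓ tMax ≤ t jMax
      jMax-spec = least-spec {λ j → fromℕ d ⊓ tMax ≤ t j} {d} (≤-trans (x⊓y≤x (fromℕ d) tMax) d≤td)
        where
        1≤8/ε² : 1# ≤ fromℕ 8 / ε ^ 2
        1≤8/ε² = ≤-/ 0<ε² (≤-trans (≤-reflexive (*-identityˡ _)) (≤-trans (^≤1 2 (<⇒≤ 0<ε) (<⇒≤ ε<1))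
          (by-cert (fromℕ-nonNeg 7) (solve 0 (:8 :- :1 := con (ℤ.+ 7)) refl))))
        d≤td : fromℕ d ≤ t d
        d≤td = ≤-trans (by-cert (<⇒≤ 0<L₀) (solve 2 (λ l d → (l :+ d) :- d := l) refl L₀ (fromℕ d)))
          (≤-resp (*-identityˡ _) refl (*-monoʳ-≤ (0≤+ (<⇒≤ 0<L₀) (fromℕ-nonNeg d)) 1≤8/ε²))

      tMax≤t : ¬ fromℕ d ≤ t jMax → tMax ≤ t jMax
      tMax≤t d≰t = [ (λ e → ⊥-elim (d≰t (≤-resp e refl jMax-spec))) , (λ e → ≤-resp e refl jMax-spec) ]′
        (⊓-sel (fromℕ d) tMax)

    -- Union bounds over blocks, phases and the last sample

    module Run (Ω : FiniteProbabilitySpace) (X : FiniteProbabilitySpace.Outcome Ω → Draws) (uniform : UniformDraws Ω X) where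

      open FiniteProbabilitySpace Ω

      private
        xs : List (Itemset n)
        xs = ranked w D

        Sample : ∀ j → Outcome → Dataset n ⌈ t j ⌉
        Sample j ω = sample {j} (X ω j)

        Far : ℕ → R → Itemset n → Outcome → Set
        Far j a x ω = ¬ abs (freq (Sample j ω) x - freq D x) ≤ a

        block : ℕ → ℕ → List (Itemset n)
        block j i = take (s j i) (drop (S< j i) xs)

        BadBlock : ℕ → ℕ → Outcome → Set
        BadBlock j i ω = Any (λ x → Far j (fromℕ (i ℕ.+ 1) * (ε * half)) x ω) (block j i)

        BadPhase : ℕ → Outcome → Set
        BadPhase j ω = ∃ λ i → i ℕ.< ℕ.suc (h j) × BadBlock j i ω

        -- The gap does not depend on the outcome; keeping it inside the event lets the union bound
        -- run uniformly over all `K (m - K)` pairs, those without a gap having probability 0.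
        Inverted : Itemset n → Itemset n → Outcome → Set
        Inverted x y ω = freq D y + ε ≤ freq D x × freq (Sample jMax ω) x ≤ freq (Sample jMax ω) y

        -- `BadFinal` includes the condition that the last phase draws: otherwise the law of
        -- `X ω jMax` is unspecified, and the phase returns the exact answer.
        BadInversion BadDeviation BadFinal Bad : Outcome → Set
        BadInversion ω = Any (λ x → Any (λ y → Inverted x y ω) (drop K xs)) (take K xs)
        BadDeviation ω = Any (λ x → Far jMax ε x ω) xs
        BadFinal ω = ¬ fromℕ d ≤ t jMax × (BadDeviation ω ⊎ BadInversion ω)
        Bad ω = (∃ λ j → j ℕ.< jMax × BadPhase j ω) ⊎ BadFinal ω

        module T j (drawn : IsDrawn j) = Tails Ω D 1≤d (1≤⌈t⌉ j) (λ ω → X ω j) (uniform j drawn)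

      private
        far-bound : ∀ j → IsDrawn j → ∀ i x → Pr (Far j (fromℕ (i ℕ.+ 1) * (ε * half)) x) ≤ fromℕ 2 * ρ j ^
          ((i ℕ.+ 1) ℕ.^ 2)
        far-bound j drawn i x = ≤-trans (T.deviation-tail j drawn x (0≤* (fromℕ-nonNeg (i ℕ.+ 1)) 0≤η))
          (*-monoˡ-≤ (fromℕ-nonNeg 2)
            (≤-trans (exp-mono (neg-≤ N≥))
              (≤-reflexive (trans (exp-cong (solve 2 (λ n l → :- (n :* l) := n :* (:- l)) refl _ _))
                (sym (exp-^ _ ((i ℕ.+ 1) ℕ.^ 2)))))))
          where
          r = fromℕ (i ℕ.+ 1)
          0≤η : 0# ≤ ε * half
          0≤η = 0≤* (<⇒≤ 0<ε) (<⇒≤ 0<half)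
          N≥ : fromℕ ((i ℕ.+ 1) ℕ.^ 2) * (fromℕ 2 * (L₀ + fromℕ j)) ≤ fromℕ ⌈ t j ⌉ *
            ((r * (ε * half)) * (r * (ε * half)))
          N≥ = ≤-resp (trans (solve 3
            (λ t r e → t :* ((r :* e) :* (r :* e)) := (r :* r) :* (t :* (e :* e))) refl (t j) r (ε * half))
                             (*-cong (sym (fromℕ-square i)) (t*η² j))) refl
                      (*-monoʳ-≤ (0≤x² (r * (ε * half))) (≤⌈⌉ (t j)))

        -- The division by 2 in the block size cancels the 2 of the two-sided tail bound, and the
        -- common exponent `(i + 1)²` merges both factors into a power of `q j`.
        block-bound : ∀ j → IsDrawn j → ∀ i → Pr (BadBlock j i) ≤ q j ^ ((i ℕ.+ 1) ℕ.^ 2)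
        block-bound j drawn i = ≤-trans (Pr-Any Ω (block j i) (All.universal (far-bound j drawn i) (block j i)))
          (≤-trans (*-monoʳ-≤ (0≤* (fromℕ-nonNeg 2) (^-nonNeg N (<⇒≤ (exp-pos _))))
                     (≤-trans (fromℕ-mono (length-take≤ (s j i) (drop (S< j i) xs))) (proj₁ (s-bounds j i))))
            (≤-reflexive (trans (solve 3 (λ a h r → (a :* h) :* (:2 :* r) := (h :* :2) :* (a :* r)) refl
              (2σ j ^ N) half (ρ j ^ N))
              (trans (trans (*-congʳ half*2) (*-identityˡ _)) (sym (^-distrib-* (2σ j) (ρ j) N))))))
          where N = (i ℕ.+ 1) ℕ.^ 2

        phase-bound : ∀ j → j ℕ.< jMax → Pr (BadPhase j) ≤ B * fromℕ 2 * half ^ j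
        phase-bound j j< = ≤-trans (Pr-∃< Ω (ℕ.suc (h j)) λ i _ → block-bound j (inj₁ j<) i)
          (≤-trans (Σ-square-powers (0≤q j) (q≤half j) (ℕ.suc (h j)))
            (≤-trans (*-monoʳ-≤ (fromℕ-nonNeg 2) (q≤ j))
              (≤-reflexive (solve 2 (λ b h → (b :* h) :* :2 := b :* :2 :* h) refl B (half ^ j)))))

        phases-bound : Pr (λ ω → ∃ λ j → j ℕ.< jMax × BadPhase j ω) ≤ δ * u
        phases-bound = ≤-trans (Pr-∃< Ω jMax phase-bound)
          (≤-trans (≤-reflexive (Σ<-*ˡ (B * fromℕ 2) (λ j → half ^ j) jMax))
          (≤-trans (*-monoˡ-≤ (0≤* 0≤B (fromℕ-nonNeg 2)) (geometric-half jMax)) (≤-reflexive 4B)))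

        module _ (d≰t : ¬ fromℕ d ≤ t jMax) where

          drawn : IsDrawn jMax
          drawn = inj₂ (≡.refl , d≰t)

          L₁≤ : L₁ ≤ fromℕ ⌈ t jMax ⌉ * (ε * ε * half)
          L₁≤ = ≤-resp tMax*ε² refl (*-monoʳ-≤ (0≤* (0≤x² ε) (<⇒≤ 0<half))
            (≤-trans (tMax≤t d≰t) (≤⌈⌉ (t jMax))))

          inverted-bound : ∀ x y → Pr (Inverted x y) ≤ z
          inverted-bound x y = [ gap , no-gap ]′ (toSum (em {freq D y + ε ≤ freq D x}))
            where
            gap : freq D y + ε ≤ freq D x → Pr (Inverted x y) ≤ z
            gap g = ≤-trans (Pr-mono Ω {Inverted x y} {λ ω → freq (Sample jMax ω) x ≤ freq
              (Sample jMax ω) y} λ _ → proj₂)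
              (≤-trans (T.inversion-tail jMax drawn x y 0<ε ε<1 g) (exp-mono (neg-≤ L₁≤)))
            no-gap : ¬ freq D y + ε ≤ freq D x → Pr (Inverted x y) ≤ z
            no-gap ¬g = ≤-trans (Pr-∅ Ω {Inverted x y} λ _ (g , _) → ¬g g) 0≤z

          inversion-bound : Pr BadInversion ≤ 𝕂 * ((𝕄 - 𝕂) * z)
          inversion-bound = ≤-trans (Pr-Any Ω (take K xs)
            (All.universal (λ x → Pr-Any Ω (drop K xs) (All.universal (inverted-bound x) (drop K xs)))
              (take K xs)))
            (≤-trans (*-monoʳ-≤ (0≤* (fromℕ-nonNeg (length (drop K xs))) 0≤z) (fromℕ-mono (length-take≤ K xs)))
              (≤-reflexive (*-congˡ {𝕂} (*-congʳ length-drop))))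
            where
            length-drop : fromℕ (length (drop K xs)) ≈ 𝕄 - 𝕂
            length-drop = begin
              fromℕ (length (drop K xs))  ≡⟨ ≡.cong fromℕ
                (≡.trans (List.length-drop K xs) (≡.cong (ℕ._∸ K) (ranked-length w D))) ⟩
              fromℕ (m ℕ.∸ K)             ≈⟨ solve 2 (λ a b → a := (a :+ b) :- b) refl (fromℕ (m ℕ.∸ K)) 𝕂 ⟩
              (fromℕ (m ℕ.∸ K) + 𝕂) - 𝕂   ≈⟨ +-congʳ (fromℕ-+ (m ℕ.∸ K) K) ⟨
              fromℕ (m ℕ.∸ K ℕ.+ K) - 𝕂   ≡⟨ ≡.cong (λ a → fromℕ a - 𝕂) (ℕ.m∸n+n≡m k<m) ⟩
              𝕄 - 𝕂                       ∎
              where open ≈R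

          deviation-bound : Pr BadDeviation ≤ 𝕄 * (fromℕ 2 * (z * z))
          deviation-bound = ≤-trans (Pr-Any Ω xs (All.universal far xs))
            (≤-reflexive (*-congʳ (reflexive (≡.cong fromℕ (ranked-length w D)))))
            where
            far : ∀ x → Pr (Far jMax ε x) ≤ fromℕ 2 * (z * z)
            far x = ≤-trans (T.deviation-tail jMax drawn x (<⇒≤ 0<ε)) (*-monoˡ-≤ (fromℕ-nonNeg 2)
              (≤-trans (exp-mono (neg-≤ (≤-trans (+-mono₂-≤ L₁≤ L₁≤)
                (≤-reflexive (trans (solve 3
                  (λ n e h → n :* (e :* e :* h) :+ n :* (e :* e :* h) := n :* (e :* e) :* (h :+ h)) refl
                    (fromℕ ⌈ t jMax ⌉) ε half)
                  (trans (*-congˡ half+half) (*-identityʳ _)))))))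
                (≤-reflexive (trans (exp-cong (solve 1 (λ l → :- (l :+ l) := (:- l) :+ (:- l)) refl L₁))
                  (exp-+ (- L₁) (- L₁))))))

        final-bound : Pr BadFinal ≤ δ - 𝕄 * z
        final-bound = [ (λ d≤t → ≤-trans (Pr-∅ Ω {BadFinal} λ _ (d≰t , _) → d≰t d≤t)
          (x≤y⇒0≤y-x 𝕄z≤δ)) , drawn-case ]′ (toSum (em {fromℕ d ≤ t jMax}))
          where
          drawn-case : ¬ fromℕ d ≤ t jMax → Pr BadFinal ≤ δ - 𝕄 * z
          drawn-case d≰t = ≤-trans (Pr-∪ Ω {BadFinal} {BadDeviation} {BadInversion} λ _ → proj₂)
            (≤-trans (+-mono₂-≤ (deviation-bound d≰t) (inversion-bound d≰t))
              -- With `δ` rewritten as `z * A₁`, the difference is `m z (1 - 2 z)`, which is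
              -- nonnegative because `z ≤ 1/2`.
              (by-cert (0≤* (0≤* (fromℕ-nonNeg m) 0≤z) (0≤* (fromℕ-nonNeg 2) (x≤y⇒0≤y-x z≤half)))
                (trans (+-congʳ (+-congʳ (sym zA₁)))
                  (trans (solve 4 (λ z m k h → (z :* (:2 :* m :+ k :* (m :- k)) :- m :* z) :-
                    (m :* (:2 :* (z :* z)) :+ k :* ((m :- k) :* z))
                      := (m :* z) :* (:2 :* (h :- z)) :+ (h :* :2 :- :1) :* (:- (m :* z))) refl z 𝕄 𝕂 half)
                    (drop-null _ (trans (+-congʳ half*2) (-‿inverseʳ 1#)))))))

        bad-bound : Pr Bad ≤ δ
        bad-bound = ≤-trans (Pr-∪ Ω {Bad} {λ ω → ∃ λ j → j ℕ.< jMax × BadPhase j ω} {BadFinal} λ _ → id)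
          (≤-trans (+-mono₂-≤ phases-bound final-bound)
            (by-cert (x≤y⇒0≤y-x δu≤𝕄z)
              (solve 3 (λ d a b → d :- (a :+ (d :- b)) := b :- a) refl δ (δ * u) (𝕄 * z))))

        Good : PairSet n → Set
        Good = IsApproximation D K w ε

        ite-elim : ∀ {P : Set} {W W′ : PairSet n} → (P → Good W) → (¬ P → Good W′) → Good (ite P W W′)
        ite-elim {P} yes-case no-case = [ (λ p → ≡.subst Good (≡.sym (ite-yes p)) (yes-case p))
                                        , (λ ¬p → ≡.subst Good (≡.sym (ite-no ¬p)) (no-case ¬p)) ]′
                                          (toSum (em {P}))

        -- Correctness of the run outside the bad event

        module _ (ω : Outcome) (good : ¬ Bad ω) where

          final-good : Good (finalPhase (X ω))
          final-good = ite-elim (λ _ → exact-approx w D k k<m 0<ε) λ d≰t →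
            Criteria.final-criterion w D (Sample jMax ω) k k<m 0<ε
              (λ {x} x∈ → em⇒dne em (lookup-Any (λ b → good (inj₂ (d≰t , inj₁ b))) x∈))
              λ x∈ y∈ gap inv → lookup-Any (lookup-Any (λ b → good (inj₂ (d≰t , inj₂ b))) x∈) y∈ (gap , inv)

          phase-good : ∀ j → j ℕ.< jMax → StoppingCondition j (Sample j ω) → Good (TOPK (Sample j ω) K w)
          phase-good j j< stop = Criteria.stopping-criterion w D (Sample j ω) k k<m 0<ε (S< j) (s j)
            (h j) ≡.refl (S<-suc j) (1≤s j)
            (K≤S<1 j) (S<-below j) (S<-above j)
            (λ i i≤h {x} x∈ → em⇒dne em (lookup-Any (λ b → good (inj₁ (j , j< , i , ℕ.s≤s i≤h , b))) x∈))
            -- Rank `S< j i + 1` counted from 1 is position `S< j i` counted from 0.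
            λ i 1≤i i≤h → ≡.subst (λ r → fromℕ (i ℕ.+ 1) * ε < freqRank w (Sample j ω) K - maybe′
              (freq (Sample j ω)) 0# (head (drop r (ranked w (Sample j ω)))))
              (ℕ.m+n∸n≡m (S< j i) 1) (stop i 1≤i i≤h)

          run-good : ∀ j r → j ℕ.+ r ≡ jMax → Good (runFrom (X ω) j r)
          run-good j ℕ.zero    e = final-good
          run-good j (ℕ.suc r) e = ite-elim (phase-good j (≡.subst (j ℕ.<_) e (ℕ.m<m+n j (ℕ.s≤s ℕ.z≤n))))
            λ _ → run-good (ℕ.suc j) r (≡.trans (≡.sym (ℕ.+-suc j r)) e)

      success-probability : 1# - δ ≤ Pr (λ ω → IsApproximation D K w ε (output (X ω)))
      success-probability = ≤-trans
        (by-cert (x≤y⇒0≤y-x bad-bound) (solve 2 (λ d b → (:1 :- b) :- (:1 :- d) := d :- b) refl δ (Pr Bad)))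
        (Pr-complement Ω {Bad} {λ ω → IsApproximation D K w ε
          (output (X ω))} λ ω good → run-good ω good 0 jMax ≡.refl)

theorem3 : (em : ExcludedMiddle 0ℓ) (ℝ : CompleteOrderedField) →
    let open Classical em ℝ in
    (n d : ℕ) (D : Dataset n d) → 1 ℕ.≤ d →
    (w : ℕ) → 1 ℕ.≤ w →
    (K : ℕ) → 1 ℕ.≤ K → K ℕ.≤ cardU n w →
    (ε δ : R) → 0# < ε → ε < 1# → 0# < δ → δ < 1# →
    let open Progressive D K w ε δ in
    (Ω : FiniteProbabilitySpace) →
    let open FiniteProbabilitySpace Ω in
    (X : Outcome → Draws) → UniformDraws Ω X →
    1# - δ ≤ Pr (λ ω → IsApproximation D K w ε (output (X ω)))
theorem3 em ℝ n d D 1≤d w _ (ℕ.suc k) _ K≤m ε δ 0<ε ε<1 0<δ δ<1 Ω X uniform =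
  Development.Analysis.Run.success-probability em ℝ D 1≤d w k K≤m 0<ε ε<1 0<δ δ<1 Ω X uniform
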